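{- Let $m,p,n$ be positive integers with $p\mid m$ and let $w\in G(m,p,n)$. Then $[\mathrm{id},w]_{\ell_R}=[\mathrm{id},w]_{\mathrm{cdf}}$ if and only if both of the following hold: (1) the multiset of cycle weights of $w$ that are not $\equiv 0 \pmod p$ can be partitioned into pairs whose two weights sum to $0$ in $\mathbb{Z}/m\mathbb{Z}$ (equivalently, $\ell_R(w)=\operatorname{codim}\operatorname{fix}(w)$); and (2) for every set $S$ of cycles of $w$ whose weights sum to $0 \pmod p$, the set $S$ can be partitioned into singletons $\{C\}$ with $C$ of weight $\equiv 0\pmod p$ and pairs $\{C,C'\}$ of cycles whose weights sum to $0$ in $\mathbb{Z}/m\mathbb{Z}$.
   Context: Let $m,p,n$ be positive integers with $p\mid m$ and $\zeta=e^{2\pi i/m}$. The group $G(m,1,n)$ consists of pairs $w=[u;a]$ with $u\in\mathfrak S_n$ (the underlying permutation) and $a=(a_1,\dots,a_n)\in(\mathbb Z/m\mathbb Z)^n$ (the weights); $[u;a]$ is identified with the $n\times n$ monomial matrix having entry $\zeta^{a_i}$ in position $(u(i),i)$ and zeros elsewhere, the group law is matrix multiplication, and the group acts on $\mathbb C^n$. A cycle of $w$ is a cycle of $u$ (fixed points count as cycles of size $1$); $c(w)$ is the number of cycles of $w$ and $c_0(w)$ the number of cycles of weight $0$, where the weight of a set $I\subseteq[n]$ (e.g. the underlying set of a cycle) is $\sum_{i\in I}a_i\in\mathbb Z/m\mathbb Z$, and $\mathrm{wt}(w)=\sum_{i=1}^n a_i$. Since $p\mid m$, it makes sense to say an element of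 $\mathbb Z/m\mathbb Z$ is $\equiv 0\pmod p$. $G(m,p,n)=\{w\in G(m,1,n):\mathrm{wt}(w)\equiv 0\pmod p\}$. A reflection is an element $g$ whose fixed space $\operatorname{fix}(g)=\ker(g-1)\subseteq\mathbb C^n$ has codimension $1$; $R$ is the set of reflections of $G(m,p,n)$ (they generate the group). $\ell_R(g)$ is the minimum number of reflections whose product is $g$, and $\operatorname{codim}\operatorname{fix}(g)=n-\dim\operatorname{fix}(g)$. For $f\in\{\ell_R,\operatorname{codim}\operatorname{fix}\}$ define $x\le_f y$ iff $f(x)+f(x^{ -1}y)=f(y)$ (a partial order), and $[\mathrm{id},w]_f=\{u: u\le_f w\}$; the subscript $\mathrm{cdf}$ means $f=\operatorname{codim}\operatorname{fix}$. -}

module Defs where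

open import Level using (Level; 0ℓ; _⊔_)
open import Algebra.Apartness.Bundles using (HeytingField; HeytingCommutativeRing)
open import Algebra.Bundles using (CommutativeRing; Group)
import Algebra.Properties.CommutativeMonoid.Sum as MonoidSum
import Algebra.Properties.Semiring.Exp as SemiringExp
open import Data.Bool.Base using (if_then_else_)
import Data.Bool.Properties as Bool
open import Data.Fin.Base using (Fin; toℕ)
open import Data.Fin.Permutation as Perm using (Permutation′; _⟨$⟩ʳ_; _⟨$⟩ˡ_; _∘ₚ_)
open import Data.Fin.Properties as Fin using (_≟_; toℕ-fromℕ<; toℕ-injective; toℕ<n; punchInᵢ≢i)
open import Data.Fin.Subset using (Subset; ⁅_⁆; ⋃)
open import Data.Fin.Subset.Properties using (_∈?_)
open import Data.List.Base
  using (List; []; _∷_; _++_; allFin; concatMap; deduplicate; filter; foldr; iterate; length; map)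
import Data.List.Membership.Propositional as List
open import Data.List.Relation.Binary.Permutation.Propositional using (_↭_)
open import Data.List.Relation.Unary.All using (All)
open import Data.List.Relation.Unary.Unique.Propositional using (Unique)
open import Data.Nat.Base as ℕ using (ℕ; suc; NonZero; _≤_; _<_; _∸_; _%_)
open import Data.Nat.Divisibility using (_∣_; _∣?_)
open import Data.Nat.DivMod
  using (_mod_; m%n<n; m%n%n≡m%n; m<n⇒m%n≡m; n%n≡0; %-distribˡ-+; m≡m%n+[m/n]*n; _/_)
import Data.Nat.Properties as ℕ
open import Data.Product.Base using (Σ-syntax; ∃-syntax; _×_; _,_)
open import Data.Vec.Functional using (Vector; removeAt)
import Data.Vec.Properties as Vec
open import Relation.Binary.PropositionalEquality as ≡ using (_≡_; _≢_; refl; sym; trans; cong; cong₂)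
open import Relation.Nullary using (Dec; yes; no; does; contradiction)
open import Relation.Nullary.Decidable using (¬?)
open import Relation.Unary using (Pred)

-- ℤ/mℤ, with classes represented by their residues in {0, …, m - 1}.
ZMod : ℕ → Set
ZMod m = Fin m

module _ {m : ℕ} .{{_ : NonZero m}} where

  infixl 6 _⊕_
  infix  8 ⊖_

  0ₘ : ZMod m
  0ₘ = 0 mod m

  _⊕_ : ZMod m → ZMod m → ZMod m
  x ⊕ y = (toℕ x ℕ.+ toℕ y) mod m

  ⊖_ : ZMod m → ZMod m
  ⊖ x = (m ∸ toℕ x) mod m

  sumₘ : List (ZMod m) → ZMod m
  sumₘ = foldr _⊕_ 0ₘ

  private
    toℕ-mod : ∀ k → toℕ (k mod m) ≡ k % m
    toℕ-mod k = toℕ-fromℕ< (m%n<n k m)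

    toℕ-0ₘ : toℕ 0ₘ ≡ 0
    toℕ-0ₘ = trans (toℕ-mod 0) (m<n⇒m%n≡m (ℕ.>-nonZero⁻¹ m))

    mod-toℕ : ∀ (x : ZMod m) → toℕ x % m ≡ toℕ x
    mod-toℕ x = m<n⇒m%n≡m (toℕ<n x)

    %-+-absorbˡ : ∀ a b → (a % m ℕ.+ b) % m ≡ (a ℕ.+ b) % m
    %-+-absorbˡ a b = begin
      (a % m ℕ.+ b) % m             ≡⟨ %-distribˡ-+ (a % m) b m ⟩
      (a % m % m ℕ.+ b % m) % m     ≡⟨ cong (λ z → (z ℕ.+ b % m) % m) (m%n%n≡m%n a m) ⟩
      (a % m ℕ.+ b % m) % m         ≡⟨ %-distribˡ-+ a b m ⟨
      (a ℕ.+ b) % m                 ∎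
      where open ≡.≡-Reasoning

  ⊕-comm : ∀ x y → x ⊕ y ≡ y ⊕ x
  ⊕-comm x y = cong (_mod m) (ℕ.+-comm (toℕ x) (toℕ y))

  ⊕-assoc : ∀ x y z → (x ⊕ y) ⊕ z ≡ x ⊕ (y ⊕ z)
  ⊕-assoc x y z = toℕ-injective (begin
    toℕ ((x ⊕ y) ⊕ z)                            ≡⟨ toℕ-mod _ ⟩
    (toℕ (x ⊕ y) ℕ.+ toℕ z) % m                  ≡⟨ cong (λ k → (k ℕ.+ toℕ z) % m) (toℕ-mod _) ⟩
    ((toℕ x ℕ.+ toℕ y) % m ℕ.+ toℕ z) % m        ≡⟨ %-+-absorbˡ (toℕ x ℕ.+ toℕ y) (toℕ z) ⟩
    (toℕ x ℕ.+ toℕ y ℕ.+ toℕ z) % m              ≡⟨ cong (_% m) (ℕ.+-assoc (toℕ x) _ _) ⟩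
    (toℕ x ℕ.+ (toℕ y ℕ.+ toℕ z)) % m            ≡⟨ cong (_% m) (ℕ.+-comm (toℕ x) _) ⟩
    (toℕ y ℕ.+ toℕ z ℕ.+ toℕ x) % m              ≡⟨ %-+-absorbˡ (toℕ y ℕ.+ toℕ z) (toℕ x) ⟨
    ((toℕ y ℕ.+ toℕ z) % m ℕ.+ toℕ x) % m        ≡⟨ cong (_% m) (ℕ.+-comm _ (toℕ x)) ⟩
    (toℕ x ℕ.+ (toℕ y ℕ.+ toℕ z) % m) % m        ≡⟨ cong (λ k → (toℕ x ℕ.+ k) % m) (toℕ-mod _) ⟨
    (toℕ x ℕ.+ toℕ (y ⊕ z)) % m                  ≡⟨ toℕ-mod _ ⟨
    toℕ (x ⊕ (y ⊕ z))                            ∎)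
    where open ≡.≡-Reasoning

  ⊕-identityˡ : ∀ x → 0ₘ ⊕ x ≡ x
  ⊕-identityˡ x = toℕ-injective (begin
    toℕ (0ₘ ⊕ x)                ≡⟨ toℕ-mod _ ⟩
    (toℕ 0ₘ ℕ.+ toℕ x) % m      ≡⟨ cong (λ k → (k ℕ.+ toℕ x) % m) toℕ-0ₘ ⟩
    toℕ x % m                   ≡⟨ mod-toℕ x ⟩
    toℕ x                       ∎)
    where open ≡.≡-Reasoning

  ⊕-inverseˡ : ∀ x → (⊖ x) ⊕ x ≡ 0ₘ
  ⊕-inverseˡ x = toℕ-injective (begin
    toℕ ((⊖ x) ⊕ x)                     ≡⟨ toℕ-mod _ ⟩
    (toℕ (⊖ x) ℕ.+ toℕ x) % m           ≡⟨ cong (λ k → (k ℕ.+ toℕ x) % m) (toℕ-mod _) ⟩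
    ((m ∸ toℕ x) % m ℕ.+ toℕ x) % m     ≡⟨ %-+-absorbˡ (m ∸ toℕ x) (toℕ x) ⟩
    (m ∸ toℕ x ℕ.+ toℕ x) % m           ≡⟨ cong (_% m) (ℕ.m∸n+n≡m (ℕ.<⇒≤ (toℕ<n x))) ⟩
    m % m                               ≡⟨ n%n≡0 m ⟩
    0                                   ≡⟨ toℕ-0ₘ ⟨
    toℕ 0ₘ                              ∎)
    where open ≡.≡-Reasoning

  ⊕-identityʳ : ∀ x → x ⊕ 0ₘ ≡ x
  ⊕-identityʳ x = trans (⊕-comm x 0ₘ) (⊕-identityˡ x)

  ⊕-inverseʳ : ∀ x → x ⊕ (⊖ x) ≡ 0ₘ
  ⊕-inverseʳ x = trans (⊕-comm x (⊖ x)) (⊕-inverseˡ x)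

  infix 4 _≡0[mod_] _≡0[mod_]?

  -- Meaningful as a condition on classes modulo m when p ∣ m.
  _≡0[mod_] : ZMod m → ℕ → Set
  x ≡0[mod p ] = p ∣ toℕ x

  _≡0[mod_]? : ∀ x p → Dec (x ≡0[mod p ])
  x ≡0[mod p ]? = p ∣? toℕ x

infix 5 [_⨾_]

record G (m n : ℕ) : Set where
  constructor [_⨾_]
  field
    perm    : Permutation′ n
    weights : Fin n → ZMod m

open G public

module _ {m n : ℕ} .{{_ : NonZero m}} where

  infix  4 _≋_
  infixl 7 _∙_
  infix  8 _⁻¹

  _≋_ : G m n → G m n → Set
  x ≋ y = (∀ i → perm x ⟨$⟩ʳ i ≡ perm y ⟨$⟩ʳ i) × (∀ i → weights x i ≡ weights y i)

  ε : G m n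
  ε = [ Perm.id ⨾ (λ _ → 0ₘ) ]

  -- Multiplication of monomial matrices: the standard basis vector e_i goes
  -- to ζ^{b_i} e_{v(i)} under [v;b], and then to ζ^{b_i + a_{v(i)}} e_{u(v(i))}
  -- under [u;a]; see toMatrix-∙ below.  Note that v ∘ₚ u applies v first.
  _∙_ : G m n → G m n → G m n
  [ u ⨾ a ] ∙ [ v ⨾ b ] = [ v ∘ₚ u ⨾ (λ i → b i ⊕ a (v ⟨$⟩ʳ i)) ]

  _⁻¹ : G m n → G m n
  [ u ⨾ a ] ⁻¹ = [ Perm.flip u ⨾ (λ j → ⊖ a (u ⟨$⟩ˡ j)) ]

  group : Group 0ℓ 0ℓ
  group = record
    { Carrier = G m n ; _≈_ = _≋_ ; _∙_ = _∙_ ; ε = ε ; _⁻¹ = _⁻¹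
    ; isGroup = record
      { isMonoid = record
        { isSemigroup = record
          { isMagma = record
            { isEquivalence = record
              { refl  = (λ _ → refl) , (λ _ → refl)
              ; sym   = λ (e , f) → (λ i → sym (e i)) , (λ i → sym (f i))
              ; trans = λ (e , f) (e′ , f′) →
                  (λ i → trans (e i) (e′ i)) , (λ i → trans (f i) (f′ i))
              }
            ; ∙-cong = λ {x} {x′} {y} {y′} (e , f) (e′ , f′) →
                (λ i → trans (e _) (cong (perm x′ ⟨$⟩ʳ_) (e′ i))) ,
                (λ i → cong₂ _⊕_ (f′ i) (trans (f _) (cong (weights x′) (e′ i))))
            }
          ; assoc = λ x y z → (λ _ → refl) , (λ i → sym (⊕-assoc (weights z i) _ _))
          }
        ; identity = (λ x → (λ _ → refl) , (λ i → ⊕-identityʳ (weights x i)))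
                   , (λ x → (λ _ → refl) , (λ i → ⊕-identityˡ (weights x i)))
        }
      ; inverse =
          (λ x → (λ _ → Perm.inverseˡ (perm x)) ,
                 (λ i → trans (cong (λ j → weights x i ⊕ (⊖ weights x j)) (Perm.inverseˡ (perm x)))
                              (⊕-inverseʳ (weights x i)))) ,
          (λ x → (λ _ → Perm.inverseʳ (perm x)) ,
                 (λ i → ⊕-inverseˡ (weights x (perm x ⟨$⟩ˡ i))))
      ; ⁻¹-cong = λ {x} {y} (e , f) →
          let e⁻¹ : ∀ j → perm x ⟨$⟩ˡ j ≡ perm y ⟨$⟩ˡ j
              e⁻¹ j = trans (sym (Perm.inverseˡ (perm y)))
                        (cong (perm y ⟨$⟩ˡ_)
                          (trans (sym (e (perm x ⟨$⟩ˡ j))) (Perm.inverseʳ (perm x))))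
          in e⁻¹ , (λ j → cong ⊖_ (trans (f _) (cong (weights y) (e⁻¹ j))))
      }
    }

  product : List (G m n) → G m n
  product = foldr _∙_ ε

  weightOf : G m n → Subset n → ZMod m
  weightOf w I = sumₘ (map (weights w) (filter (_∈? I) (allFin n)))

  wt : G m n → ZMod m
  wt w = sumₘ (map (weights w) (allFin n))

  infix 4 _∈G⟨_⟩

  -- For w in G(m,1,n), the statement w ∈ G(m,p,n).
  _∈G⟨_⟩ : G m n → ℕ → Set
  w ∈G⟨ p ⟩ = wt w ≡0[mod p ]

-- The set { i, u(i), …, u^{n-1}(i) }, which is the whole u-orbit of i
-- because orbits have at most n elements.
cycleOf : ∀ {n} → Permutation′ n → Fin n → Subset n
cycleOf {n} u i = ⋃ (map ⁅_⁆ (iterate (u ⟨$⟩ʳ_) i n))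

-- Each cycle, fixed points included, listed exactly once.
cycles : ∀ {m n} → G m n → List (Subset n)
cycles {n = n} w = deduplicate (Vec.≡-dec Bool._≟_) (map (cycleOf (perm w)) (allFin n))

unpair : ∀ {a} {A : Set a} → List (A × A) → List A
unpair = concatMap (λ (x , y) → x ∷ y ∷ [])

module _ {m n : ℕ} .{{_ : NonZero m}} where

  nonzeroWeights : ℕ → G m n → List (ZMod m)
  nonzeroWeights p w = filter (λ x → ¬? (x ≡0[mod p ]?)) (map (weightOf w) (cycles w))

  -- Lists up to permutation are multisets.
  NonzeroWeightsPairUp : ℕ → G m n → Set
  NonzeroWeightsPairUp p w =
    ∃[ pairs ] All (λ (x , y) → x ⊕ y ≡ 0ₘ) pairs × unpair pairs ↭ nonzeroWeights p w

  SplitsIntoSingletonsAndPairs : ℕ → G m n → List (Subset n) → Set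
  SplitsIntoSingletonsAndPairs p w S =
    ∃[ singles ] ∃[ pairs ]
      All (λ C → weightOf w C ≡0[mod p ]) singles ×
      All (λ (C , C′) → weightOf w C ⊕ weightOf w C′ ≡ 0ₘ) pairs ×
      singles ++ unpair pairs ↭ S

  -- A set of cycles is a duplicate-free list of cycles.
  NullCycleSetsSplit : ℕ → G m n → Set
  NullCycleSetsSplit p w =
    ∀ (S : List (Subset n)) → Unique S → All (List._∈ cycles w) S →
    sumₘ (map (weightOf w) S) ≡0[mod p ] →
    SplitsIntoSingletonsAndPairs p w S

-- The scalars are an arbitrary field K with a primitive m-th root of unity ζ;
-- K = ℂ and ζ = e^{2πi/m} are an instance.  The apartness _#_ plays the role
-- of ≠: x # y holds precisely when x - y is invertible.
module LinearAlgebra {c ℓ₁ ℓ₂ : Level} (K : HeytingField c ℓ₁ ℓ₂) where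

  open HeytingField K using (Carrier; _≈_; _#_; _*_; 0#; 1#)

  ring : CommutativeRing c ℓ₁
  ring = HeytingCommutativeRing.commutativeRing (HeytingField.heytingCommutativeRing K)

  open CommutativeRing ring using (semiring; +-commutativeMonoid)
  open SemiringExp semiring public using (_^_)
  open MonoidSum +-commutativeMonoid public using (sum; sum-syntax)

  IsPrimitiveRootOfUnity : ℕ → Carrier → Set (ℓ₁ ⊔ ℓ₂)
  IsPrimitiveRootOfUnity m ζ = ζ ^ m ≈ 1# × (∀ k → 0 < k → k < m → ζ ^ k # 1#)

  Matrix : ℕ → Set c
  Matrix n = Fin n → Fin n → Carrier

  _·ᵐ_ : ∀ {n} → Matrix n → Matrix n → Matrix n
  _·ᵐ_ {n} A B i j = ∑[ k < n ] (A i k * B k j)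

  _·ᵛ_ : ∀ {n} → Matrix n → Vector Carrier n → Vector Carrier n
  _·ᵛ_ {n} A v i = ∑[ j < n ] (A i j * v j)

  combination : ∀ {n d} → Vector Carrier d → (Fin d → Vector Carrier n) → Vector Carrier n
  combination {d = d} x b j = ∑[ i < d ] (x i * b i j)

  record IsBasis {ℓ} {n d : ℕ} (V : Pred (Vector Carrier n) ℓ)
                 (b : Fin d → Vector Carrier n) : Set (c ⊔ ℓ₁ ⊔ ℓ) where
    field
      inside      : ∀ i → V (b i)
      independent : ∀ (x : Vector Carrier d) →
                    (∀ j → combination x b j ≈ 0#) → ∀ i → x i ≈ 0#
      spanning    : ∀ v → V v → Σ[ x ∈ Vector Carrier d ] (∀ j → v j ≈ combination x b j)

  HasDimension : ∀ {ℓ} {n : ℕ} → Pred (Vector Carrier n) ℓ → ℕ → Set (c ⊔ ℓ₁ ⊔ ℓ)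
  HasDimension {n = n} V d = Σ[ b ∈ (Fin d → Vector Carrier n) ] IsBasis V b

-- The functions ℓ_R and codim fix are given by their graphs:
-- "ReflectionLength g k" says ℓ_R(g) = k, and "Codimfix g k" says
-- codim fix(g) = k.
module Representation {c ℓ₁ ℓ₂ : Level} (K : HeytingField c ℓ₁ ℓ₂)
                      (ζ : HeytingField.Carrier K)
                      (m p n : ℕ) .{{_ : NonZero m}} where

  open HeytingField K using (Carrier; _≈_; 0#)
  open LinearAlgebra K

  toMatrix : G m n → Matrix n
  toMatrix [ u ⨾ a ] j i = if does (j ≟ (u ⟨$⟩ʳ i)) then ζ ^ toℕ (a i) else 0#

  fix : G m n → Pred (Vector Carrier n) ℓ₁
  fix g v = ∀ i → (toMatrix g ·ᵛ v) i ≈ v i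

  Codimfix : G m n → ℕ → Set (c ⊔ ℓ₁)
  Codimfix g k = ∃[ d ] HasDimension (fix g) d × d ℕ.+ k ≡ n

  IsReflection : G m n → Set (c ⊔ ℓ₁)
  IsReflection g = g ∈G⟨ p ⟩ × Codimfix g 1

  IsProductOfReflections : G m n → ℕ → Set (c ⊔ ℓ₁)
  IsProductOfReflections g k =
    ∃[ rs ] All IsReflection rs × length rs ≡ k × product rs ≋ g

  ReflectionLength : G m n → ℕ → Set (c ⊔ ℓ₁)
  ReflectionLength g k =
    IsProductOfReflections g k × (∀ j → IsProductOfReflections g j → k ≤ j)

  infix 4 _≤[_]_

  _≤[_]_ : ∀ {ℓ} → G m n → (G m n → ℕ → Set ℓ) → G m n → Set ℓ
  x ≤[ f ] y =
    ∃[ i ] ∃[ j ] ∃[ k ] f x i × f (x ⁻¹ ∙ y) j × f y k × i ℕ.+ j ≡ k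

  [id,_]⟨_⟩ : ∀ {ℓ} → G m n → (G m n → ℕ → Set ℓ) → Pred (G m n) ℓ
  [id, w ]⟨ f ⟩ x = x ∈G⟨ p ⟩ × x ≤[ f ] w

  LengthEqualsCodim : G m n → Set (c ⊔ ℓ₁)
  LengthEqualsCodim w = ∃[ k ] ReflectionLength w k × Codimfix w k

  module _ (ζ^m≈1 : ζ ^ m ≈ HeytingField.1# K) where

    open CommutativeRing ring
      using (_+_; _*_; 1#; setoid; semiring; +-commutativeMonoid; *-cong; *-comm; *-congʳ; *-congˡ;
             zeroˡ; zeroʳ; *-identityʳ; +-congˡ; +-identityʳ; reflexive)
      renaming (refl to ≈-refl; sym to ≈-sym; trans to ≈-trans)
    open SemiringExp semiring using (^-homo-*; ^-assocʳ; ^-congˡ)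
    open MonoidSum +-commutativeMonoid using (sum-remove; sum-cong-≋; sum-replicate-zero)
    open import Relation.Binary.Reasoning.Setoid setoid

    private
      sum-only : ∀ {n} (j : Fin n) (t : Vector Carrier n) →
                 (∀ k → k ≢ j → t k ≈ 0#) → sum t ≈ t j
      sum-only {suc n} j t t≈0 = begin
        sum t                      ≈⟨ sum-remove t ⟩
        t j + sum (removeAt t j)   ≈⟨ +-congˡ (sum-cong-≋ (λ k → t≈0 _ (punchInᵢ≢i j k))) ⟩
        t j + sum {n} (λ _ → 0#)   ≈⟨ +-congˡ (sum-replicate-zero n) ⟩
        t j + 0#                   ≈⟨ +-identityʳ (t j) ⟩
        t j                        ∎

      1^ : ∀ k → 1# ^ k ≈ 1#
      1^ 0       = ≈-refl
      1^ (suc k) = ≈-trans (*-congˡ (1^ k)) (*-identityʳ 1#)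

      ζ^% : ∀ k → ζ ^ k ≈ ζ ^ (k % m)
      ζ^% k = begin
        ζ ^ k                               ≈⟨ reflexive (cong (ζ ^_) (m≡m%n+[m/n]*n k m)) ⟩
        ζ ^ (k % m ℕ.+ k / m ℕ.* m)         ≈⟨ ^-homo-* ζ (k % m) _ ⟩
        ζ ^ (k % m) * ζ ^ (k / m ℕ.* m)     ≈⟨ *-congˡ (reflexive (cong (ζ ^_) (ℕ.*-comm (k / m) m))) ⟩
        ζ ^ (k % m) * ζ ^ (m ℕ.* (k / m))   ≈⟨ *-congˡ (≈-sym (^-assocʳ ζ m (k / m))) ⟩
        ζ ^ (k % m) * (ζ ^ m) ^ (k / m)     ≈⟨ *-congˡ (^-congˡ (k / m) ζ^m≈1) ⟩
        ζ ^ (k % m) * 1# ^ (k / m)          ≈⟨ *-congˡ (1^ (k / m)) ⟩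
        ζ ^ (k % m) * 1#                    ≈⟨ *-identityʳ _ ⟩
        ζ ^ (k % m)                         ∎

      ζ^-⊕ : ∀ (x y : ZMod m) → ζ ^ toℕ (x ⊕ y) ≈ ζ ^ toℕ y * ζ ^ toℕ x
      ζ^-⊕ x y = begin
        ζ ^ toℕ (x ⊕ y)                     ≈⟨ reflexive (cong (ζ ^_) (toℕ-fromℕ< (m%n<n (toℕ x ℕ.+ toℕ y) m))) ⟩
        ζ ^ ((toℕ x ℕ.+ toℕ y) % m)         ≈⟨ ζ^% _ ⟨
        ζ ^ (toℕ x ℕ.+ toℕ y)               ≈⟨ ^-homo-* ζ (toℕ x) (toℕ y) ⟩
        ζ ^ toℕ x * ζ ^ toℕ y               ≈⟨ *-comm _ _ ⟩
        ζ ^ toℕ y * ζ ^ toℕ x               ∎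

      entry-≡ : ∀ (g : G m n) i → toMatrix g (perm g ⟨$⟩ʳ i) i ≈ ζ ^ toℕ (weights g i)
      entry-≡ g i with (perm g ⟨$⟩ʳ i) ≟ (perm g ⟨$⟩ʳ i)
      ... | yes _   = ≈-refl
      ... | no  i≢i = contradiction refl i≢i

      entry-≢ : ∀ (g : G m n) {j i} → j ≢ perm g ⟨$⟩ʳ i → toMatrix g j i ≈ 0#
      entry-≢ g {j} {i} j≢ with j ≟ (perm g ⟨$⟩ʳ i)
      ... | yes j≡ = contradiction j≡ j≢
      ... | no  _  = ≈-refl

    toMatrix-∙ : ∀ x y i j → toMatrix (x ∙ y) i j ≈ (toMatrix x ·ᵐ toMatrix y) i j
    toMatrix-∙ x y i j = ≈-sym (begin
      (toMatrix x ·ᵐ toMatrix y) i j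
        ≈⟨ sum-only (perm y ⟨$⟩ʳ j) _ (λ k k≢ → ≈-trans (*-congˡ (entry-≢ y k≢)) (zeroʳ _)) ⟩
      toMatrix x i (perm y ⟨$⟩ʳ j) * toMatrix y (perm y ⟨$⟩ʳ j) j
        ≈⟨ *-congˡ (entry-≡ y j) ⟩
      toMatrix x i (perm y ⟨$⟩ʳ j) * ζ ^ toℕ (weights y j)
        ≈⟨ step ⟩
      toMatrix (x ∙ y) i j
        ∎)
      where
      step : toMatrix x i (perm y ⟨$⟩ʳ j) * ζ ^ toℕ (weights y j) ≈ toMatrix (x ∙ y) i j
      step with i ≟ (perm x ⟨$⟩ʳ (perm y ⟨$⟩ʳ j))
      ... | yes _ = ≈-sym (ζ^-⊕ (weights y j) (weights x (perm y ⟨$⟩ʳ j)))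
      ... | no  _ = zeroˡ _

{-# OPTIONS --safe #-}

-- Let W be the multiset of cycle weights of w, and z(w) the number of its zeros.
-- Then fix(w) has a basis indexed by the cycles of weight 0, so codim fix(w) = n − z(w).
-- Up to inverses, multiplying w by a reflection merges two weights u, v into u + v, splits
-- a weight, or changes one weight by a multiple of p, and every merge and every such change
-- of one weight is realised by a reflection.  Hence ℓ_R(w) = n + |W| − k, where k is the
-- largest value of a partition of W into blocks whose sums are 0 mod p, a block counting
-- once, or twice if its sum is 0.  This equals n − z(w) exactly when all blocks of an
-- optimal partition are singletons or pairs of sum 0, which is condition (1).
--
-- If (2) holds for w, it passes to x and x⁻¹w for every x ≤ w in the codimension order,
-- because each step of a shortest factorization of w into reflections of G(m,1,n) creates
-- one zero weight and otherwise only discards weights; thus ℓ_R = codim fix on the whole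
-- interval.  Conversely, if the intervals agree, the reflection merging two weights of a
-- block of an optimal partition lies below w for ℓ_R, hence for codim fix, so the two
-- weights sum to 0; this gives (1).  For (2), let S be a set of cycles of weight sum 0 mod p
-- and write w = xy, where x is diagonal and y has the weights S on S and 0 elsewhere:
-- x lies below w, so ℓ_R(y) = codim fix(y), and (1) holds for y.

module Submission where

open import Algebra.Apartness.Bundles using (HeytingField)
import Algebra.Apartness.Properties.HeytingCommutativeRing as HeytingProperties
open import Algebra.Bundles using (AbelianGroup; CommutativeMonoid; CommutativeRing; Group)
import Algebra.Properties.AbelianGroup as AbelianGroupProperties
import Algebra.Properties.CommutativeSemigroup as CommutativeSemigroupProperties
import Algebra.Properties.Ring as RingProperties
import Algebra.Properties.Semiring.Exp as SemiringExp
import Algebra.Properties.Semiring.Sum as SemiringSum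
open import Data.Bool.Base using (if_then_else_)
import Data.Bool.Properties as Bool
open import Data.Empty using (⊥)
open import Data.Fin.Base using (Fin; zero; suc; toℕ; punchIn)
open import Data.Fin.Permutation as Perm using (Permutation′; transpose; _⟨$⟩ʳ_; _⟨$⟩ˡ_)
import Data.Fin.Permutation.Components as PC
open import Data.Fin.Permutation.Transposition.List using (TranspositionList; eval; decompose; eval-decompose)
open import Data.Fin.Properties using (_≟_; punchInᵢ≢i; toℕ<n; toℕ-fromℕ<; toℕ-injective)
open import Data.Fin.Subset as Subset using (Subset; ⁅_⁆; ⋃)
open import Data.Fin.Subset.Properties using (_∈?_; x∈⁅x⁆; x∈⁅y⁆⇒x≡y; x∈p∪q⁺; x∈p∪q⁻; ∉⊥; ⊆-antisym)
open import Data.List.Base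
  using (List; []; _∷_; _++_; allFin; concatMap; filter; iterate; length; map; replicate)
import Data.List.Membership.DecPropositional as DecMembership
open import Data.List.Membership.Propositional using (_∈_; _∉_; find; lose)
open import Data.List.Membership.Propositional.Properties
  using (∈-∃++; ∈-++⁻; ∈-++⁺ˡ; ∈-++⁺ʳ; ∈-map⁺; ∈-map⁻; ∈-allFin; ∈-concatMap⁺; ∈-concatMap⁻; ∈-deduplicate⁺;
         ∈-deduplicate⁻; ∈-filter⁺; ∈-filter⁻)
open import Data.List.Membership.Propositional.Properties.WithK using (unique∧set⇒bag)
open import Data.List.Properties
  using (++-assoc; ++-identityʳ; concatMap-map; concatMap-pure; filter-accept; filter-reject; length-++;
         length-map; length-replicate; length-tabulate; map-++; map-cong; map-cong-local; map-∘; ∷-injectiveˡ;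
         ∷-injectiveʳ)
open import Data.List.Relation.Binary.BagAndSetEquality using (∼bag⇒↭)
open import Data.List.Relation.Binary.Permutation.Propositional
  using (_↭_; refl; prep; swap; ↭-refl; ↭-reflexive; ↭-sym; ↭-trans; ↭-prep; ↭-swap; ↭⇒↭ₛ;
         module PermutationReasoning)
  renaming (trans to transitive)
open import Data.List.Relation.Binary.Permutation.Propositional.Properties
  using (++-comm; ++⁺ˡ; ++⁺ʳ; All-resp-↭; drop-∷; filter-↭; map⁺; shift; shifts; ∈-resp-↭; ↭-empty-inv;
         ↭-length; ↭-map-inv; ↭-singleton-inv)
import Data.List.Relation.Binary.Permutation.Setoid.Properties as SetoidPermutation
open import Data.List.Relation.Unary.All as All using (All; []; _∷_)
open import Data.List.Relation.Unary.All.Properties using (all-filter; ++⁻ˡ; ++⁻ʳ)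
  renaming (map⁺ to All-map⁺; ++⁺ to All-++⁺)
open import Data.List.Relation.Unary.AllPairs using ([]; _∷_)
open import Data.List.Relation.Unary.Any using (here; there)
open import Data.List.Relation.Unary.Unique.Propositional using (Unique)
import Data.List.Relation.Unary.Unique.DecPropositional.Properties as DecUnique
import Data.List.Relation.Unary.Unique.Propositional.Properties as Unique
open import Data.Nat.Base as ℕ using (ℕ; zero; suc; NonZero; _+_; _%_; _≤_; _<_; z≤n; s≤s; s≤s⁻¹)
open import Data.Nat.Divisibility using (_∣_; 1∣_; _∣0; %-presˡ-∣; ∣m∣n⇒∣m+n; ∣m+n∣m⇒∣n)
open import Data.Nat.DivMod using (_/_; m%n<n; m<n⇒m%n≡m; m≡m%n+[m/n]*n)
open import Data.Nat.ListAction using (sum)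
open import Data.Nat.ListAction.Properties using (sum-↭)
import Data.Nat.Properties as ℕ
open import Data.Nat.Tactic.RingSolver using (solve-∀)
open import Data.Product.Base using (∃-syntax; _×_; _,_; proj₁; proj₂)
open import Data.Sum.Base using (_⊎_; inj₁; inj₂)
open import Data.Unit.Base using (⊤; tt)
open import Data.Vec.Functional using (Vector; insertAt; removeAt; updateAt)
open import Data.Vec.Functional.Properties
  using (insertAt-lookup; insertAt-punchIn; updateAt-minimal; updateAt-updates)
import Data.Vec.Properties as Vec
open import Function.Base using (_∘_)
open import Function.Bundles using (_⇔_; mk⇔)
open import Level using (Level; 0ℓ)
open import Relation.Binary.PropositionalEquality
  using (_≡_; _≢_; refl; sym; trans; cong; cong₂; subst; setoid; isEquivalence; module ≡-Reasoning)
import Relation.Binary.Reasoning.Setoid as SetoidReasoning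
open import Relation.Nullary using (¬_; Dec; yes; no; does; contradiction)
open import Relation.Nullary.Decidable using (¬?; dec-true; dec-false)
open import Relation.Unary using (Decidable; Pred; _≐_)
open import Defs

-- Multisets of weights

-- The index of a partition comes from reducing w to the identity. Contracting a block of b weights
-- to a single zero takes b - 1 merges, and one further move if its sum is not 0; the r zeros so
-- obtained are then refined by n - r cuts into n fixed points of weight 0. The total is n + |W|
-- minus r minus the number of blocks of sum 0. Both length functions come out of this one count.
-- For p = 1 every weight is null, singletons are the best blocks, and the count becomes n - z(w).
-- So codim fix is the reflection length of G(m,1,n), which yields its subadditivity and the
-- shortest factorizations used in the codimension order. No maximum over partitions is taken and no
-- length is found by search: partitions are carried along factorizations, and a length is a
-- relation whose value has to be exhibited. When the intervals are assumed to agree, the value for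
-- w is extracted from w ≤ w in the codimension order. Only left multiplication is analysed; right
-- factors are conjugated to the left.

private variable
  A : Set

extract-∈ : ∀ {x : A} {xs} → x ∈ xs → ∃[ ys ] xs ↭ x ∷ ys
extract-∈ {x = x} x∈xs with ys , zs , refl ← ∈-∃++ x∈xs = ys ++ zs , shift x ys zs

pick : ∀ {x : A} {W : List A} B {C} → x ∷ W ↭ B ++ C →
       (∃[ B′ ] B ↭ x ∷ B′ × W ↭ B′ ++ C) ⊎ (∃[ C′ ] C ↭ x ∷ C′ × W ↭ B ++ C′)
pick {x = x} B {C} σ with ∈-++⁻ B (∈-resp-↭ σ (here refl))
... | inj₁ x∈B = let B′ , τ = extract-∈ x∈B in
      inj₁ (B′ , τ , drop-∷ (↭-trans σ (++⁺ʳ C τ)))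
... | inj₂ x∈C = let C′ , τ = extract-∈ x∈C in
      inj₂ (C′ , τ , drop-∷ (↭-trans σ (↭-trans (++⁺ˡ B τ) (shift x B C′))))

module _ {m : ℕ} .{{_ : NonZero m}} where

  ⊕-abelianGroup : AbelianGroup 0ℓ 0ℓ
  ⊕-abelianGroup = record
    { Carrier = ZMod m ; _≈_ = _≡_ ; _∙_ = _⊕_ ; ε = 0ₘ ; _⁻¹ = ⊖_
    ; isAbelianGroup = record
      { isGroup = record
        { isMonoid = record
          { isSemigroup = record
            { isMagma = record { isEquivalence = isEquivalence ; ∙-cong = cong₂ _⊕_ }
            ; assoc = ⊕-assoc }
          ; identity = ⊕-identityˡ , ⊕-identityʳ }
        ; inverse = ⊕-inverseˡ , ⊕-inverseʳ
        ; ⁻¹-cong = cong ⊖_ }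
      ; comm = ⊕-comm } }

  open AbelianGroup ⊕-abelianGroup public
    using () renaming (commutativeMonoid to ⊕-commutativeMonoid; isCommutativeMonoid to ⊕-isCommutativeMonoid)
  open AbelianGroupProperties ⊕-abelianGroup public using ()
    renaming (⁻¹-involutive to ⊖-involutive; ε⁻¹≈ε to ⊖0)
  open CommutativeSemigroupProperties (CommutativeMonoid.commutativeSemigroup ⊕-commutativeMonoid) public using ()
    renaming (interchange to ⊕-medial)

  sumₘ-↭ : ∀ {V W : List (ZMod m)} → V ↭ W → sumₘ V ≡ sumₘ W
  sumₘ-↭ σ = SetoidPermutation.foldr-commMonoid (setoid (ZMod m)) ⊕-isCommutativeMonoid (↭⇒↭ₛ σ)

  sumₘ-++ : ∀ (V W : List (ZMod m)) → sumₘ (V ++ W) ≡ sumₘ V ⊕ sumₘ W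
  sumₘ-++ []      W = sym (⊕-identityˡ _)
  sumₘ-++ (x ∷ V) W = trans (cong (x ⊕_) (sumₘ-++ V W)) (sym (⊕-assoc x _ _))

  ⊖-≢0 : ∀ {x : ZMod m} → x ≢ 0ₘ → ⊖ x ≢ 0ₘ
  ⊖-≢0 {x} x≢0 ⊖x≡0 = x≢0 (trans (sym (⊖-involutive x)) (trans (cong ⊖_ ⊖x≡0) ⊖0))

  toℕ-0ₘ : toℕ {m} 0ₘ ≡ 0
  toℕ-0ₘ = trans (toℕ-fromℕ< (m%n<n 0 m)) (m<n⇒m%n≡m (ℕ.>-nonZero⁻¹ m))

  δ : ZMod m → ℕ
  δ x = if does (x ≟ 0ₘ) then 1 else 0

  δ-0ₘ : δ 0ₘ ≡ 1
  δ-0ₘ with 0ₘ {m} ≟ 0ₘ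
  ... | yes _   = refl
  ... | no  0≢0 = contradiction refl 0≢0

  δ-≢0ₘ : ∀ {x} → x ≢ 0ₘ → δ x ≡ 0
  δ-≢0ₘ {x} x≢0 with x ≟ 0ₘ
  ... | yes x≡0 = contradiction x≡0 x≢0
  ... | no  _   = refl

  δ≢0⇒≡0ₘ : ∀ {x k} → δ x ≡ suc k → x ≡ 0ₘ
  δ≢0⇒≡0ₘ {x} eq with x ≟ 0ₘ
  ... | yes x≡0 = x≡0

  δ≤1 : ∀ x → δ x ≤ 1
  δ≤1 x with x ≟ 0ₘ
  ... | yes _ = ℕ.≤-refl
  ... | no  _ = z≤n

  -- Two zeros have a zero sum. Hence fusing two blocks lowers the index by at most 2: one for the
  -- lost block and one for a lost zero.
  δ-⊕ : ∀ x y → δ x + δ y ≤ suc (δ (x ⊕ y))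
  δ-⊕ x y with x ≟ 0ₘ
  ... | yes refl = ℕ.≤-reflexive (cong (λ z → suc (δ z)) (sym (⊕-identityˡ y)))
  ... | no  _    = ℕ.≤-trans (δ≤1 y) (s≤s z≤n)

  zeros : List (ZMod m) → ℕ
  zeros W = sum (map δ W)

  zeros≤length : ∀ (V : List (ZMod m)) → zeros V ≤ length V
  zeros≤length []      = z≤n
  zeros≤length (x ∷ V) = ℕ.+-mono-≤ (δ≤1 x) (zeros≤length V)

  all-zero : ∀ (V : List (ZMod m)) → length V ≤ zeros V → All (_≡ 0ₘ) V
  all-zero []      _ = []
  all-zero (x ∷ V) l≤ = go (x ≟ 0ₘ)
    where
    go : Dec (x ≡ 0ₘ) → All (_≡ 0ₘ) (x ∷ V)
    go (yes x≡0) = x≡0 ∷ all-zero V (s≤s⁻¹ (ℕ.≤-trans l≤ (ℕ.+-monoˡ-≤ (zeros V) (δ≤1 x))))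
    go (no x≢0)  = contradiction (ℕ.≤-trans l≤ (ℕ.≤-trans (ℕ.≤-reflexive (cong (_+ zeros V) (δ-≢0ₘ x≢0))) (zeros≤length V)))
                     (ℕ.<⇒≱ (ℕ.n<1+n (length V)))

  -- The index of the partition into singletons if every weight were null; by `partition-value` it
  -- bounds the index of every null partition.
  value : List (ZMod m) → ℕ
  value W = length W + zeros W

  value-∷ : ∀ x W → value (x ∷ W) ≡ suc (δ x) + value W
  value-∷ x W = rearrange (length W) (δ x) (zeros W)
    where
    rearrange : ∀ l d z → suc l + (d + z) ≡ suc d + (l + z)
    rearrange = solve-∀

  value-++ : ∀ V W → value (V ++ W) ≡ value V + value W
  value-++ []      W = refl
  value-++ (x ∷ V) W = begin
    value (x ∷ V ++ W)               ≡⟨ value-∷ x (V ++ W) ⟩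
    suc (δ x) + value (V ++ W)       ≡⟨ cong (suc (δ x) +_) (value-++ V W) ⟩
    suc (δ x) + (value V + value W)  ≡⟨ ℕ.+-assoc (suc (δ x)) (value V) (value W) ⟨
    suc (δ x) + value V + value W    ≡⟨ cong (_+ value W) (value-∷ x V) ⟨
    value (x ∷ V) + value W          ∎
    where open ≡-Reasoning

  zeros-↭ : ∀ {V W} → V ↭ W → zeros V ≡ zeros W
  zeros-↭ σ = sum-↭ (map⁺ δ σ)

  value-↭ : ∀ {V W} → V ↭ W → value V ≡ value W
  value-↭ σ = cong₂ _+_ (↭-length σ) (zeros-↭ σ)

  ⊕≡0⇒≡0 : ∀ {x y} → x ⊕ y ≡ 0ₘ → x ≡ 0ₘ → y ≡ 0ₘ
  ⊕≡0⇒≡0 {y = y} x+y≡0 refl = trans (sym (⊕-identityˡ y)) x+y≡0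

  module _ {p : ℕ} (p∣m : p ∣ m) where

    0-null : 0ₘ ≡0[mod p ]
    0-null = subst (p ∣_) (sym toℕ-0ₘ) (p ∣0)

    ⊕-null : ∀ {x y} → x ≡0[mod p ] → y ≡0[mod p ] → x ⊕ y ≡0[mod p ]
    ⊕-null {x} {y} p∣x p∣y =
      subst (p ∣_) (sym (toℕ-fromℕ< (m%n<n (toℕ x + toℕ y) m)))
        (%-presˡ-∣ (∣m∣n⇒∣m+n p∣x p∣y) p∣m)

    ⊖-null : ∀ {x} → x ≡0[mod p ] → ⊖ x ≡0[mod p ]
    ⊖-null {x} p∣x =
      subst (p ∣_) (sym (toℕ-fromℕ< (m%n<n (m ℕ.∸ toℕ x) m)))
        (%-presˡ-∣ (∣m∸n p∣m p∣x) p∣m)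
      where
      ∣m∸n : ∀ {d} → d ∣ m → d ∣ toℕ x → d ∣ m ℕ.∸ toℕ x
      ∣m∸n {d} d∣m d∣x =
        ∣m+n∣m⇒∣n (subst (d ∣_) (sym (ℕ.m+[n∸m]≡n (ℕ.<⇒≤ (toℕ<n x)))) d∣m) d∣x

    ⊕-nullʳ : ∀ {x y} → x ≡0[mod p ] → x ⊕ y ≡0[mod p ] → y ≡0[mod p ]
    ⊕-nullʳ {x} {y} x-null x+y-null = subst (_≡0[mod p ]) eq (⊕-null (⊖-null x-null) x+y-null)
      where
      eq : ⊖ x ⊕ (x ⊕ y) ≡ y
      eq = trans (sym (⊕-assoc (⊖ x) x y)) (trans (cong (_⊕ y) (⊕-inverseˡ x)) (⊕-identityˡ y))

    ⊕-nullˡ : ∀ {x y} → y ≡0[mod p ] → x ⊕ y ≡0[mod p ] → x ≡0[mod p ]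
    ⊕-nullˡ {x} {y} y-null x+y-null = ⊕-nullʳ y-null (subst (_≡0[mod p ]) (⊕-comm x y) x+y-null)

  -- Null partitions, splits and steps

  module _ (p : ℕ) where

    -- The index counts every block once, and the blocks of sum 0 twice.
    data NullPartition : List (ZMod m) → ℕ → Set where
      []    : NullPartition [] 0
      block : ∀ {u b V W k} → (u ⊕ sumₘ b) ≡0[mod p ] → NullPartition V k → W ↭ u ∷ b ++ V →
              NullPartition W (suc (δ (u ⊕ sumₘ b) + k))

    -- The common form of both conditions: (1) asks for a split of all cycle weights, with the null
    -- ones as singletons, and (2) for a split of every sub-multiset of null sum.
    data Split : List (ZMod m) → Set where
      []     : Split []
      single : ∀ {x V W} → x ≡0[mod p ] → Split V → W ↭ x ∷ V → Split W
      pair   : ∀ {x y V W} → x ⊕ y ≡ 0ₘ → Split V → W ↭ x ∷ y ∷ V → Split W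

    -- What left multiplication by a reflection can do to the cycle weights. For p = 1 the condition
    -- on `twist` always holds, so `Step 1` belongs to G(m,1,n).
    data Step (V W : List (ZMod m)) : Set where
      join  : ∀ {u v U} → V ↭ u ∷ v ∷ U → W ↭ (u ⊕ v) ∷ U → Step V W
      cut   : ∀ {u v U} → V ↭ (u ⊕ v) ∷ U → W ↭ u ∷ v ∷ U → Step V W
      twist : ∀ {u a U} → a ≡0[mod p ] → V ↭ u ∷ U → W ↭ (u ⊕ a) ∷ U → Step V W

  module _ {p : ℕ} where

    NullPartition-↭ : ∀ {V W k} → V ↭ W → NullPartition p V k → NullPartition p W k
    NullPartition-↭ σ [] rewrite ↭-empty-inv (↭-sym σ) = []
    NullPartition-↭ σ (block b-null P τ) = block b-null P (↭-trans (↭-sym σ) τ)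

    -- The block of u consists of u and B, and V is the union of the other blocks.
    record BlockOf (u : ZMod m) (W : List (ZMod m)) (k : ℕ) : Set where
      constructor blockOf
      field
        {B V}      : List (ZMod m)
        {j}        : ℕ
        sum-null   : u ⊕ sumₘ B ≡0[mod p ]
        rest       : NullPartition p V j
        decomposed : W ↭ B ++ V
        count      : k ≡ suc (δ (u ⊕ sumₘ B) + j)

    -- The block of `u` may lie below other blocks; these are then put back onto the rest, and their
    -- contributions to the index are commuted past that of the block found.
    find-block : ∀ {u W W′ k} → NullPartition p W′ k → W′ ↭ u ∷ W → BlockOf u W k
    find-block [] σ with () ← ↭-empty-inv (↭-sym σ)
    find-block {u} {W} (block {x} {b} {V} {k = k} b-null P τ) σ
      with pick (x ∷ b) (↭-trans (↭-sym σ) τ)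
    ... | inj₁ (b′ , ρ , W↭) =
      blockOf (subst (_≡0[mod p ]) (sumₘ-↭ ρ) b-null) P W↭ (cong (λ s → suc (δ s + k)) (sumₘ-↭ ρ))
    ... | inj₂ (V′ , V↭ , W↭) with find-block P V↭
    ... | blockOf {B} {U} {j} B-null Q V′↭ refl =
      blockOf B-null (block b-null Q ↭-refl) W↭B++xbU
        (exchange (δ (x ⊕ sumₘ b)) (δ (u ⊕ sumₘ B)) j)
      where
      exchange : ∀ a b j → 1 + (a + (1 + (b + j))) ≡ 1 + (b + (1 + (a + j)))
      exchange = solve-∀
      open PermutationReasoning
      W↭B++xbU : W ↭ B ++ x ∷ b ++ U
      W↭B++xbU = begin
        W                     ↭⟨ W↭ ⟩
        x ∷ b ++ V′           ↭⟨ ++⁺ˡ (x ∷ b) V′↭ ⟩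
        (x ∷ b) ++ B ++ U     ≡⟨ ++-assoc (x ∷ b) B U ⟨
        ((x ∷ b) ++ B) ++ U   ↭⟨ ++⁺ʳ U (++-comm (x ∷ b) B) ⟩
        (B ++ x ∷ b) ++ U     ≡⟨ ++-assoc B (x ∷ b) U ⟩
        B ++ x ∷ b ++ U       ∎

    -- If u and v share a block, its sum is unchanged and nothing is lost. Otherwise their two
    -- blocks are fused, and `δ-⊕` bounds the loss.
    merge-blocks : p ∣ m → ∀ {u v W k} → NullPartition p (u ∷ v ∷ W) k →
                   ∃[ j ] NullPartition p ((u ⊕ v) ∷ W) j × k ≤ 2 + j
    merge-blocks p∣m {u} {v} {W} P with find-block P ↭-refl
    ... | blockOf {B} {V} {j} B-null Q τ refl with pick B τ
    ... | inj₁ (B′ , B↭ , W↭) =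
      _ , block (subst (_≡0[mod p ]) same-sum B-null) Q (↭-prep _ W↭) ,
      ℕ.≤-trans (ℕ.≤-reflexive (cong (λ s → suc (δ s + j)) same-sum)) (ℕ.m≤n+m _ 2)
      where
      same-sum : u ⊕ sumₘ B ≡ (u ⊕ v) ⊕ sumₘ B′
      same-sum = trans (cong (u ⊕_) (sumₘ-↭ B↭)) (sym (⊕-assoc u v _))
    ... | inj₂ (V′ , V↭ , W↭) with find-block Q V↭
    ... | blockOf {C} {U} {i} C-null R V′↭ refl =
      _ , block (subst (_≡0[mod p ]) same-sum (⊕-null p∣m B-null C-null)) R (↭-prep _ W↭B++C++U) , bound
      where
      same-sum : (u ⊕ sumₘ B) ⊕ (v ⊕ sumₘ C) ≡ (u ⊕ v) ⊕ sumₘ (B ++ C)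
      same-sum = trans (⊕-medial u _ v _) (cong ((u ⊕ v) ⊕_) (sym (sumₘ-++ B C)))
      W↭B++C++U : W ↭ (B ++ C) ++ U
      W↭B++C++U = ↭-trans W↭ (↭-trans (++⁺ˡ B V′↭) (↭-reflexive (sym (++-assoc B C U))))
      exchange : ∀ a b i → 1 + (a + (1 + (b + i))) ≡ 2 + ((a + b) + i)
      exchange = solve-∀
      open ℕ.≤-Reasoning
      bound : suc (δ (u ⊕ sumₘ B) + suc (δ (v ⊕ sumₘ C) + i)) ≤ 2 + suc (δ ((u ⊕ v) ⊕ sumₘ (B ++ C)) + i)
      bound = begin
        suc (δ (u ⊕ sumₘ B) + suc (δ (v ⊕ sumₘ C) + i))       ≡⟨ exchange (δ (u ⊕ sumₘ B)) _ i ⟩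
        2 + ((δ (u ⊕ sumₘ B) + δ (v ⊕ sumₘ C)) + i)           ≤⟨ s≤s (s≤s (ℕ.+-monoˡ-≤ i (δ-⊕ (u ⊕ sumₘ B) _))) ⟩
        3 + (δ ((u ⊕ sumₘ B) ⊕ (v ⊕ sumₘ C)) + i)             ≡⟨ cong (λ s → 3 + (δ s + i)) same-sum ⟩
        3 + (δ ((u ⊕ v) ⊕ sumₘ (B ++ C)) + i)                 ∎

    split-block : ∀ {u v W k} → NullPartition p ((u ⊕ v) ∷ W) k → NullPartition p (u ∷ v ∷ W) k
    split-block {u} {v} P with find-block P ↭-refl
    ... | blockOf {B} {V} {j} B-null Q τ refl rewrite ⊕-assoc u v (sumₘ B) =
      block B-null Q (↭-prep u (↭-prep v τ))

    shift-block : p ∣ m → ∀ {u a W k} → a ≡0[mod p ] → NullPartition p (u ∷ W) k →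
                  ∃[ j ] NullPartition p ((u ⊕ a) ∷ W) j × k ≤ 1 + j
    shift-block p∣m {u} {a} a-null P with find-block P ↭-refl
    ... | blockOf {B} {V} {j} B-null Q τ refl =
      _ , block (subst (_≡0[mod p ]) same-sum (⊕-null p∣m a-null B-null)) Q (↭-prep _ τ) ,
      s≤s (ℕ.≤-trans (ℕ.+-monoˡ-≤ j (δ≤1 (u ⊕ sumₘ B))) (s≤s (ℕ.m≤n+m j _)))
      where
      same-sum : a ⊕ (u ⊕ sumₘ B) ≡ (u ⊕ a) ⊕ sumₘ B
      same-sum = trans (sym (⊕-assoc a u _)) (cong (_⊕ sumₘ B) (⊕-comm a u))

    -- A join removes one weight and costs at most 2 of the index, a cut adds one weight and costs
    -- nothing, a twist costs at most 1. So |W| - k grows by at most 1 per move, which is the lower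
    -- bound in the length formula.
    step-partition : p ∣ m → ∀ {V W k} → Step p V W → NullPartition p V k →
                     ∃[ j ] NullPartition p W j × k + length W ≤ suc j + length V
    step-partition p∣m {k = k} (join {U = U} σ τ) P
      with j , Q , k≤2+j ← merge-blocks p∣m (NullPartition-↭ σ P)
      rewrite ↭-length σ | ↭-length τ =
      j , NullPartition-↭ (↭-sym τ) Q ,
      ℕ.≤-trans (ℕ.+-monoˡ-≤ (suc (length U)) k≤2+j) (ℕ.≤-reflexive (rearrange j (length U)))
      where
      rearrange : ∀ j l → 2 + j + suc l ≡ suc j + suc (suc l)
      rearrange = solve-∀
    step-partition p∣m {k = k} (cut {U = U} σ τ) P rewrite ↭-length σ | ↭-length τ =
      k , NullPartition-↭ (↭-sym τ) (split-block (NullPartition-↭ σ P)) ,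
      ℕ.≤-reflexive (ℕ.+-suc k (suc (length U)))
    step-partition p∣m {k = k} (twist {U = U} a-null σ τ) P
      with j , Q , k≤1+j ← shift-block p∣m a-null (NullPartition-↭ σ P)
      rewrite ↭-length σ | ↭-length τ =
      j , NullPartition-↭ (↭-sym τ) Q , ℕ.+-monoˡ-≤ (suc (length U)) k≤1+j

    block-value : ∀ u b → suc (δ (u ⊕ sumₘ b)) ≤ value (u ∷ b)
    block-value u []      = ℕ.≤-reflexive (trans (cong (λ x → suc (δ x)) (⊕-identityʳ u))
                              (sym (trans (value-∷ u []) (ℕ.+-identityʳ _))))
    block-value u (v ∷ b) = s≤s (ℕ.≤-trans (δ≤1 (u ⊕ (v ⊕ sumₘ b))) (s≤s z≤n))

    partition-value : ∀ {W k} → NullPartition p W k → k ≤ value W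
    partition-value [] = z≤n
    partition-value {W} (block {u} {b} {V} {k = k} _ P σ) = begin
      suc (δ (u ⊕ sumₘ b)) + k      ≤⟨ ℕ.+-mono-≤ (block-value u b) (partition-value P) ⟩
      value (u ∷ b) + value V       ≡⟨ value-++ (u ∷ b) V ⟨
      value (u ∷ b ++ V)            ≡⟨ value-↭ σ ⟨
      value W                       ∎
      where open ℕ.≤-Reasoning

    -- The bound `block-value` holds block by block, so equality in total forces it in each block. A
    -- block of at least three weights has index at most 2 and cannot reach its value; a block of
    -- two reaches it only if its sum is 0.
    tight⇒Split : ∀ {W k} → NullPartition p W k → value W ≤ k → Split p W
    tight⇒Split [] _ = []
    tight⇒Split {W} (block {u} {b} {V} {k = k} null P σ) W≤ = go b null σ b-tight
      where
      open ℕ.≤-Reasoning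
      total : value (u ∷ b) + value V ≤ suc (δ (u ⊕ sumₘ b)) + k
      total = begin
        value (u ∷ b) + value V    ≡⟨ value-++ (u ∷ b) V ⟨
        value (u ∷ b ++ V)         ≡⟨ value-↭ σ ⟨
        value W                    ≤⟨ W≤ ⟩
        suc (δ (u ⊕ sumₘ b)) + k   ∎
      rest : Split p V
      rest = tight⇒Split P (ℕ.+-cancelˡ-≤ (value (u ∷ b)) _ _
               (ℕ.≤-trans total (ℕ.+-monoˡ-≤ k (block-value u b))))
      b-tight : value (u ∷ b) ≤ suc (δ (u ⊕ sumₘ b))
      b-tight = ℕ.+-cancelʳ-≤ (value V) _ _
               (ℕ.≤-trans total (ℕ.+-monoʳ-≤ (suc (δ (u ⊕ sumₘ b))) (partition-value P)))
      go : ∀ b → (u ⊕ sumₘ b) ≡0[mod p ] → W ↭ u ∷ b ++ V →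
           value (u ∷ b) ≤ suc (δ (u ⊕ sumₘ b)) → Split p W
      go []          null σ _ = single (subst (_≡0[mod p ]) (⊕-identityʳ u) null) rest σ
      go (v ∷ [])    null σ (s≤s ≤δ) = pair u+v≡0 rest σ
        where
        u+v≡0 : u ⊕ v ≡ 0ₘ
        u+v≡0 = trans (cong (u ⊕_) (sym (⊕-identityʳ v)))
                  (δ≢0⇒≡0ₘ (ℕ.≤-antisym (δ≤1 (u ⊕ (v ⊕ 0ₘ))) (ℕ.≤-trans (s≤s z≤n) ≤δ)))
      go (v ∷ x ∷ b) null σ (s≤s ≤δ) with s≤s () ← ℕ.≤-trans ≤δ (δ≤1 (u ⊕ (v ⊕ (x ⊕ sumₘ b))))

    Split-↭ : ∀ {V W} → V ↭ W → Split p V → Split p W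
    Split-↭ σ [] rewrite ↭-empty-inv (↭-sym σ) = []
    Split-↭ σ (single null s τ) = single null s (↭-trans (↭-sym σ) τ)
    Split-↭ σ (pair null s τ)   = pair null s (↭-trans (↭-sym σ) τ)

  module _ {p : ℕ} (p∣m : p ∣ m) where

    single-block : ∀ {x V W k} → x ≡0[mod p ] → NullPartition p V k → W ↭ x ∷ V →
                   NullPartition p W (suc (δ x) + k)
    single-block {x} {k = k} null P σ =
      subst (λ y → NullPartition p _ (suc (δ y + k))) (⊕-identityʳ x)
        (block {b = []} (subst (_≡0[mod p ]) (sym (⊕-identityʳ x)) null) P σ)

    pair-block : ∀ {x y V W k} → x ⊕ y ≡ 0ₘ → NullPartition p V k → W ↭ x ∷ y ∷ V →
                 NullPartition p W (2 + k)
    pair-block {x} {y} {k = k} x+y≡0 P σ =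
      subst (λ d → NullPartition p _ (suc (d + k))) (trans (cong δ s≡0) δ-0ₘ)
        (block {b = y ∷ []} (subst (_≡0[mod p ]) (sym s≡0) (0-null p∣m)) P σ)
      where
      s≡0 : x ⊕ (y ⊕ 0ₘ) ≡ 0ₘ
      s≡0 = trans (cong (x ⊕_) (⊕-identityʳ y)) x+y≡0

    Split⇒partition : ∀ {W} → Split p W → NullPartition p W (value W)
    Split⇒partition [] = []
    Split⇒partition {W} (single {x} {V} null s σ) =
      subst (NullPartition p W) (sym (trans (value-↭ σ) (value-∷ x V)))
        (single-block null (Split⇒partition s) σ)
    Split⇒partition {W} (pair {x} {y} {V} x+y≡0 s σ) with x ≟ 0ₘ
    -- A pair of zeros has value 4 but index only 2 as one block, so it is taken as two singletons.
    ... | yes refl = subst (NullPartition p W)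
          (sym (trans (value-↭ σ) (trans (value-∷ x (y ∷ V)) (cong (suc (δ x) +_) (value-∷ y V)))))
          (single-block (0-null p∣m)
            (single-block (subst (_≡0[mod p ]) (sym (⊕≡0⇒≡0 x+y≡0 refl)) (0-null p∣m))
              (Split⇒partition s) ↭-refl) σ)
    ... | no x≢0 = subst (NullPartition p W) (sym eq) (pair-block x+y≡0 (Split⇒partition s) σ)
      where
      eq : value W ≡ 2 + value V
      eq = trans (value-↭ σ) (trans (value-∷ x (y ∷ V)) (trans (cong₂ _+_ (cong suc (δ-≢0ₘ x≢0)) (value-∷ y V))
             (cong (λ d → 2 + (d + value V)) (δ-≢0ₘ (λ y≡0 → x≢0 (⊕≡0⇒≡0 (trans (⊕-comm y x) x+y≡0) y≡0))))))

    -- A block u, v, x, … with u + v = 0 could be cut into {u, v} and the rest,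
    -- so the blocks of an optimal partition of this kind have at most two elements.
    zero-sum-merges⇒Split : ∀ {W k} → NullPartition p W k →
      (∀ {j} → NullPartition p W j → j ≤ k) →
      (∀ {u v b V j} → W ↭ u ∷ v ∷ b ++ V → u ⊕ (v ⊕ sumₘ b) ≡0[mod p ] → NullPartition p V j →
         k ≡ suc (δ (u ⊕ (v ⊕ sumₘ b)) + j) → u ⊕ v ≡ 0ₘ) →
      Split p W
    zero-sum-merges⇒Split [] _ _ = []
    zero-sum-merges⇒Split {W} (block {u} {b} {V} {k = k} null P σ) optimal zero-sum =
      go b null σ optimal zero-sum
      where
      d : ℕ
      d = δ (u ⊕ sumₘ b)
      rest : Split p V
      rest = zero-sum-merges⇒Split P
        (λ Q → ℕ.+-cancelˡ-≤ (suc d) _ _ (optimal (block null Q σ)))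
        -- To apply the hypothesis to a block of the rest, that block is pulled to the front and
        -- `u ∷ b` joins the remaining blocks.
        (λ {u′} {v′} {b′} {V′} {j} τ null′ Q k≡ →
          zero-sum (↭-trans σ (↭-trans (++⁺ˡ (u ∷ b) τ) (shifts (u ∷ b) (u′ ∷ v′ ∷ b′)))) null′
            (block null Q ↭-refl)
            (trans (cong (λ k → suc (d + k)) k≡) (exchange d (δ (u′ ⊕ (v′ ⊕ sumₘ b′))) j)))
        where
        exchange : ∀ a b j → 1 + (a + (1 + (b + j))) ≡ 1 + (b + (1 + (a + j)))
        exchange = solve-∀
      go : ∀ b → (u ⊕ sumₘ b) ≡0[mod p ] → W ↭ u ∷ b ++ V →
           (∀ {j} → NullPartition p W j → j ≤ suc (δ (u ⊕ sumₘ b) + k)) →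
           (∀ {u′ v b′ V′ j} → W ↭ u′ ∷ v ∷ b′ ++ V′ → u′ ⊕ (v ⊕ sumₘ b′) ≡0[mod p ] → NullPartition p V′ j →
              suc (δ (u ⊕ sumₘ b) + k) ≡ suc (δ (u′ ⊕ (v ⊕ sumₘ b′)) + j) → u′ ⊕ v ≡ 0ₘ) →
           Split p W
      go []       null σ _ _ = single (subst (_≡0[mod p ]) (⊕-identityʳ u) null) rest σ
      go (v ∷ []) null σ _ zero-sum = pair (zero-sum σ null P refl) rest σ
      go (v ∷ x ∷ b) null σ optimal zero-sum = contradiction better (ℕ.<⇒≱ (ℕ.n<1+n _))
        where
        u+v≡0 : u ⊕ v ≡ 0ₘ
        u+v≡0 = zero-sum σ null P refl
        s≡ : u ⊕ (v ⊕ (x ⊕ sumₘ b)) ≡ x ⊕ sumₘ b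
        s≡ = trans (sym (⊕-assoc u v _)) (trans (cong (_⊕ (x ⊕ sumₘ b)) u+v≡0) (⊕-identityˡ _))
        better : 3 + (δ (x ⊕ sumₘ b) + k) ≤ 2 + (δ (x ⊕ sumₘ b) + k)
        better = ℕ.≤-trans
          (optimal (pair-block u+v≡0 (block (subst (_≡0[mod p ]) s≡ null) P ↭-refl) σ))
          (ℕ.≤-trans (ℕ.≤-reflexive (cong (λ s → suc (δ s + k)) s≡)) (ℕ.n≤1+n _))

    -- A zero that is a singleton is simply removed. A zero inside a pair has a partner equal to 0,
    -- which is null and survives as a singleton.
    Split-drop-0 : ∀ {V W} → Split p V → V ↭ 0ₘ ∷ W → Split p W
    Split-drop-0 [] σ with () ← ↭-empty-inv (↭-sym σ)
    Split-drop-0 (single {x} null s τ) σ with pick (x ∷ []) (↭-trans (↭-sym σ) τ)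
    ... | inj₁ (b , ρ , W↭) with refl ← ↭-singleton-inv (↭-sym ρ) = Split-↭ (↭-sym W↭) s
    ... | inj₂ (V′ , ρ , W↭) = single null (Split-drop-0 s ρ) W↭
    Split-drop-0 (pair {x} {y} x+y≡0 s τ) σ with pick (x ∷ y ∷ []) (↭-trans (↭-sym σ) τ)
    ... | inj₂ (V′ , ρ , W↭) = pair x+y≡0 (Split-drop-0 s ρ) W↭
    ... | inj₁ (b , ρ , W↭) with ↭-length ρ
    Split-drop-0 (pair {x} {y} x+y≡0 s τ) σ | inj₁ (z ∷ [] , ρ , W↭) | _ =
      single (subst (_≡0[mod p ]) (sym z≡0) (0-null p∣m)) s W↭
      where
      z≡0 : z ≡ 0ₘ
      z≡0 = begin
        z                     ≡⟨ ⊕-identityʳ z ⟨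
        z ⊕ 0ₘ                ≡⟨ ⊕-identityˡ _ ⟨
        0ₘ ⊕ (z ⊕ 0ₘ)         ≡⟨ sumₘ-↭ ρ ⟨
        x ⊕ (y ⊕ 0ₘ)          ≡⟨ cong (x ⊕_) (⊕-identityʳ y) ⟩
        x ⊕ y                 ≡⟨ x+y≡0 ⟩
        0ₘ                    ∎
        where open ≡-Reasoning

    Split-drop-zeros : ∀ k {W} → Split p (replicate k 0ₘ ++ W) → Split p W
    Split-drop-zeros zero    s = s
    Split-drop-zeros (suc k) s = Split-drop-zeros k (Split-drop-0 s ↭-refl)

    -- Condition (2) for weights in place of cycles: `S` is a sub-multiset and `T` its complement.
    NullSubsetsSplit : List (ZMod m) → Set
    NullSubsetsSplit W = ∀ {S T} → W ↭ S ++ T → sumₘ S ≡0[mod p ] → Split p S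

    -- Every weight of W other than the new zero already occurs in `U ++ V`. A null sub-multiset
    -- therefore comes from one of `U ++ V`, possibly with the zero added as a singleton.
    NullSubsetsSplit-step : ∀ {U V W} → NullSubsetsSplit (U ++ V) → W ↭ 0ₘ ∷ U → NullSubsetsSplit W
    NullSubsetsSplit-step {U} {V} splits σ {S} {T} τ S-null with pick S (↭-trans (↭-sym σ) τ)
    ... | inj₁ (S′ , S↭ , U↭) =
      single (0-null p∣m)
        (splits (↭-trans (++⁺ʳ V U↭) (↭-reflexive (++-assoc S′ T V)))
          (subst (_≡0[mod p ]) (trans (sumₘ-↭ S↭) (⊕-identityˡ _)) S-null)) S↭
    ... | inj₂ (T′ , T↭ , U↭) =
      splits (↭-trans (++⁺ʳ V U↭) (↭-reflexive (++-assoc S T′ V))) S-null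

-- Cycle decompositions

Unique-↭ : ∀ {xs ys : List A} → xs ↭ ys → Unique xs → Unique ys
Unique-↭ σ = SetoidPermutation.Unique-resp-↭ (setoid _) (↭⇒↭ₛ σ)

Unique-disjoint : ∀ (xs : List A) {ys z} → Unique (xs ++ ys) → z ∈ xs → z ∉ ys
Unique-disjoint (x ∷ xs) (x∉ ∷ _) (here refl) z∈ys = All.lookup x∉ (∈-++⁺ʳ xs z∈ys) refl
Unique-disjoint (x ∷ xs) (_ ∷ u)  (there z∈)  z∈ys = Unique-disjoint xs u z∈ z∈ys

Unique-++ˡ : ∀ (xs : List A) {ys} → Unique (xs ++ ys) → Unique xs
Unique-++ˡ []       _        = []
Unique-++ˡ (x ∷ xs) (x∉ ∷ u) = ++⁻ˡ xs x∉ ∷ Unique-++ˡ xs u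

Unique-++ʳ : ∀ (xs : List A) {ys} → Unique (xs ++ ys) → Unique ys
Unique-++ʳ []       u       = u
Unique-++ʳ (x ∷ xs) (_ ∷ u) = Unique-++ʳ xs u

unique-↭ : ∀ {xs ys : List A} → Unique xs → Unique ys →
           (∀ {z} → z ∈ xs → z ∈ ys) → (∀ {z} → z ∈ ys → z ∈ xs) → xs ↭ ys
unique-↭ u v to from = ∼bag⇒↭ (unique∧set⇒bag u v (mk⇔ to from))

concatMap-↭ : ∀ {A B : Set} (f : A → List B) {xs ys} → xs ↭ ys → concatMap f xs ↭ concatMap f ys
concatMap-↭ f refl         = ↭-refl
concatMap-↭ f (prep x σ)   = ++⁺ˡ (f x) (concatMap-↭ f σ)
concatMap-↭ f (swap {xs} x y σ) =
  ↭-trans (shifts (f x) (f y)) (++⁺ˡ (f y) (++⁺ˡ (f x) (concatMap-↭ f σ)))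
concatMap-↭ f (transitive σ τ) = ↭-trans (concatMap-↭ f σ) (concatMap-↭ f τ)

∈-⋃⁺ : ∀ {n} {i : Fin n} {xs} → i ∈ xs → i Subset.∈ ⋃ (map ⁅_⁆ xs)
∈-⋃⁺ {i = i} (here refl) = x∈p∪q⁺ (inj₁ (x∈⁅x⁆ i))
∈-⋃⁺ (there i∈) = x∈p∪q⁺ (inj₂ (∈-⋃⁺ i∈))

∈-⋃⁻ : ∀ {n} {i : Fin n} xs → i Subset.∈ ⋃ (map ⁅_⁆ xs) → i ∈ xs
∈-⋃⁻ []       i∈ = contradiction i∈ ∉⊥
∈-⋃⁻ (x ∷ xs) i∈ with x∈p∪q⁻ ⁅ x ⁆ _ i∈
... | inj₁ i∈x  = here (x∈⁅y⁆⇒x≡y x i∈x)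
... | inj₂ i∈xs = there (∈-⋃⁻ xs i∈xs)

-- The cycle (x , x₁ ∷ … ∷ xₖ ∷ []) maps x ↦ x₁ ↦ … ↦ xₖ ↦ x.
Cycle : ℕ → Set
Cycle n = Fin n × List (Fin n)

support : ∀ {n} → Cycle n → List (Fin n)
support (x , xs) = x ∷ xs

toSubset : ∀ {n} → Cycle n → Subset n
toSubset C = ⋃ (map ⁅_⁆ (support C))

data Path {m n} (g : G m n) : Fin n → List (Fin n) → Fin n → Set where
  last : ∀ {x y} → perm g ⟨$⟩ʳ x ≡ y → Path g x [] y
  _∷_  : ∀ {x y xs z} → perm g ⟨$⟩ʳ x ≡ y → Path g y xs z → Path g x (y ∷ xs) z

Closed : ∀ {m n} → G m n → Cycle n → Set
Closed g (x , xs) = Path g x xs x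

-- That `covers` is a permutation of `allFin n` says at once that the cycles exhaust the points, are
-- pairwise disjoint and repeat no point.
record Decomposition {m n} (g : G m n) (D : List (Cycle n)) : Set where
  field
    closed : All (Closed g) D
    covers : concatMap support D ↭ allFin n

open Decomposition public

module _ {m n : ℕ} {g : G m n} where

  private
    f : Fin n → Fin n
    f = perm g ⟨$⟩ʳ_

  image-on-path : ∀ {x xs y z} → Path g x xs y → z ∈ x ∷ xs → f z ≡ y ⊎ f z ∈ xs
  image-on-path (last fx≡y) (here refl) = inj₁ fx≡y
  image-on-path (fx≡ ∷ P)   (here refl) = inj₂ (here fx≡)
  image-on-path (fx≡ ∷ P)   (there z∈) with image-on-path P z∈
  ... | inj₁ fz≡y = inj₁ fz≡y
  ... | inj₂ fz∈  = inj₂ (there fz∈)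

  split-path : ∀ {x} xs {y ys z} → Path g x (xs ++ y ∷ ys) z → Path g x xs y × Path g y ys z
  split-path []       (e ∷ P) = last e , P
  split-path (_ ∷ xs) (e ∷ P) = let Q , R = split-path xs P in e ∷ Q , R

  _++ₚ_ : ∀ {x xs y ys z} → Path g x xs y → Path g y ys z → Path g x (xs ++ y ∷ ys) z
  last e  ++ₚ Q = e ∷ Q
  (e ∷ P) ++ₚ Q = e ∷ (P ++ₚ Q)

  rotate : ∀ {C y} → Closed g C → y ∈ support C → ∃[ ys ] Closed g (y , ys) × y ∷ ys ↭ support C
  rotate {x , xs} P y∈ with ∈-∃++ y∈
  ... | []     , zs , refl = xs , P , ↭-refl
  ... | x ∷ ws , zs , refl =
    let Q , R = split-path ws P in zs ++ x ∷ ws , R ++ₚ Q , ++-comm (_ ∷ zs) (x ∷ ws)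

  orbit⊆cycle : ∀ {C} → Closed g C → ∀ k {y z} → y ∈ support C → z ∈ iterate f y k → z ∈ support C
  orbit⊆cycle P (suc k) y∈ (here refl) = y∈
  orbit⊆cycle {x , xs} P (suc k) y∈ (there z∈) = orbit⊆cycle P k fy∈ z∈
    where
    fy∈ : f _ ∈ x ∷ xs
    fy∈ with image-on-path P y∈
    ... | inj₁ fy≡x = here fy≡x
    ... | inj₂ fy∈  = there fy∈

  path⊆orbit : ∀ {x xs y} → Path g x xs y → ∀ k → suc (length xs) ≤ k → ∀ {z} → z ∈ x ∷ xs → z ∈ iterate f x k
  path⊆orbit P          (suc k) _       (here refl) = here refl
  path⊆orbit (refl ∷ P) (suc k) (s≤s l) (there z∈)  = there (path⊆orbit P k l z∈)

  Decomposition-↭ : ∀ {D E} → D ↭ E → Decomposition g D → Decomposition g E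
  Decomposition-↭ σ dec = record
    { closed = All-resp-↭ σ (closed dec) ; covers = ↭-trans (concatMap-↭ support (↭-sym σ)) (covers dec) }

  module _ {D : List (Cycle n)} (dec : Decomposition g D) where

    unique-support : Unique (concatMap support D)
    unique-support = Unique-↭ (↭-sym (covers dec)) (Unique.allFin⁺ n)

    covered : ∀ i → ∃[ C ] C ∈ D × i ∈ support C
    covered i with concat∈ ← ∈-resp-↭ (↭-sym (covers dec)) (∈-allFin i) = find (∈-concatMap⁻ support concat∈)

    length-support : ∀ {C} → C ∈ D → length (support C) ≤ n
    length-support {C} C∈ with D′ , σ ← extract-∈ C∈ = begin
      length (support C)                            ≤⟨ ℕ.m≤m+n _ _ ⟩
      length (support C) + length (concatMap support D′)  ≡⟨ length-++ (support C) ⟨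
      length (support C ++ concatMap support D′)    ≡⟨ ↭-length (concatMap-↭ support σ) ⟨
      length (concatMap support D)                  ≡⟨ ↭-length (covers dec) ⟩
      length (allFin n)                             ≡⟨ length-tabulate {n = n} _ ⟩
      n                                             ∎
      where open ℕ.≤-Reasoning

    -- Iteration never leaves a closed path, and n iterations go all the way round because the
    -- support has at most n points; `rotate` lets them start at any `y` of the cycle.
    cycleOf≡toSubset : ∀ {C y} → C ∈ D → y ∈ support C → cycleOf (perm g) y ≡ toSubset C
    cycleOf≡toSubset {C} {y} C∈ y∈ = ⊆-antisym ⊆ ⊇
      where
      P : Closed g C
      P = All.lookup (closed dec) C∈
      ⊆ : ∀ {z} → z Subset.∈ cycleOf (perm g) y → z Subset.∈ toSubset C
      ⊆ z∈ = ∈-⋃⁺ (orbit⊆cycle P n y∈ (∈-⋃⁻ (iterate f y n) z∈))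
      ⊇ : ∀ {z} → z Subset.∈ toSubset C → z Subset.∈ cycleOf (perm g) y
      ⊇ z∈ = let ys , Q , σ = rotate P y∈ in
        ∈-⋃⁺ (path⊆orbit Q n (ℕ.≤-trans (ℕ.≤-reflexive (↭-length σ)) (length-support C∈))
          (∈-resp-↭ (↭-sym σ) (∈-⋃⁻ (support C) z∈)))

    unique-support-of : ∀ {C} → C ∈ D → Unique (support C)
    unique-support-of {C} C∈ with D′ , σ ← extract-∈ C∈ =
      Unique-++ˡ (support C) (Unique-↭ (concatMap-↭ support σ) unique-support)

  unique-toSubset : ∀ {D : List (Cycle n)} → Unique (concatMap support D) → Unique (map toSubset D)
  unique-toSubset {[]}    _ = []
  unique-toSubset {C ∷ D} u = All.tabulate fresh ∷ unique-toSubset (Unique-++ʳ (support C) u)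
    where
    fresh : ∀ {S} → S ∈ map toSubset D → toSubset C ≢ S
    fresh S∈ C≡S with C′ , C′∈ , refl ← ∈-map⁻ toSubset S∈ =
      Unique-disjoint (support C) u (here refl)
        (∈-concatMap⁺ support (lose C′∈ (∈-⋃⁻ (support C′) (subst (_ Subset.∈_) C≡S (∈-⋃⁺ {xs = support C} (here refl))))))

  cycles-↭ : ∀ {D} → Decomposition g D → cycles g ↭ map toSubset D
  cycles-↭ {D} dec = unique-↭ (DecUnique.deduplicate-! subset≟ _) (unique-toSubset (unique-support dec)) to from
    where
    subset≟ = Vec.≡-dec {n = n} Bool._≟_
    to : ∀ {S} → S ∈ cycles g → S ∈ map toSubset D
    to S∈ with i , _ , refl ← ∈-map⁻ (cycleOf (perm g)) (∈-deduplicate⁻ subset≟ _ S∈) =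
      let C , C∈ , i∈ = covered dec i in
      subst (_∈ map toSubset D) (sym (cycleOf≡toSubset dec C∈ i∈)) (∈-map⁺ toSubset C∈)
    from : ∀ {S} → S ∈ map toSubset D → S ∈ cycles g
    from S∈ with C , C∈ , refl ← ∈-map⁻ toSubset S∈ =
      ∈-deduplicate⁺ subset≟
        (subst (_∈ map (cycleOf (perm g)) (allFin n)) (cycleOf≡toSubset dec C∈ (here refl))
          (∈-map⁺ (cycleOf (perm g)) (∈-allFin (proj₁ C))))

module _ {m n : ℕ} .{{_ : NonZero m}} where

  cycleWeight : G m n → Cycle n → ZMod m
  cycleWeight g C = sumₘ (map (weights g) (support C))

  opaque
    -- Opaque, so that types keep the form `cycleWeights g` instead of unfolding to the deduplicated
    -- list of subsets; `cycleWeights≡` unfolds it on demand.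
    cycleWeights : G m n → List (ZMod m)
    cycleWeights g = map (weightOf g) (cycles g)

    cycleWeights≡ : ∀ g → cycleWeights g ≡ map (weightOf g) (cycles g)
    cycleWeights≡ g = refl

  module _ {g : G m n} {D : List (Cycle n)} (dec : Decomposition g D) where

    weightOf-toSubset : ∀ {C} → C ∈ D → weightOf g (toSubset C) ≡ cycleWeight g C
    weightOf-toSubset {C} C∈ = sumₘ-↭ (map⁺ (weights g)
      (unique-↭ (Unique.filter⁺ (_∈? toSubset C) (Unique.allFin⁺ n)) (unique-support-of dec C∈)
        (λ z∈ → ∈-⋃⁻ (support C) (proj₂ (∈-filter⁻ (_∈? toSubset C) {xs = allFin n} z∈)))
        (λ z∈ → ∈-filter⁺ (_∈? toSubset C) (∈-allFin _) (∈-⋃⁺ z∈))))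

    cycleWeights-↭ : cycleWeights g ↭ map (cycleWeight g) D
    cycleWeights-↭ = begin
      cycleWeights g                         ≡⟨ cycleWeights≡ g ⟩
      map (weightOf g) (cycles g)            ↭⟨ map⁺ (weightOf g) (cycles-↭ dec) ⟩
      map (weightOf g) (map toSubset D)      ≡⟨ map-∘ D ⟨
      map (weightOf g ∘ toSubset) D          ≡⟨ map-cong-local (All.tabulate weightOf-toSubset) ⟩
      map (cycleWeight g) D                  ∎
      where
      open PermutationReasoning

    -- This lets a move be aimed at weights chosen from the multiset: the cycles are permuted until
    -- their weights stand in the prescribed order.
    with-weights : ∀ {W} → cycleWeights g ↭ W → ∃[ E ] Decomposition g E × map (cycleWeight g) E ≡ W
    with-weights σ with ↭-map-inv (cycleWeight g) (↭-trans (↭-sym cycleWeights-↭) σ)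
    ... | E , W≡ , τ = E , Decomposition-↭ τ dec , sym W≡

    sum-cycleWeights : sumₘ (cycleWeights g) ≡ wt g
    sum-cycleWeights = begin
      sumₘ (cycleWeights g)                         ≡⟨ sumₘ-↭ cycleWeights-↭ ⟩
      sumₘ (map (cycleWeight g) D)                  ≡⟨ concat-sum D ⟩
      sumₘ (map (weights g) (concatMap support D))  ≡⟨ sumₘ-↭ (map⁺ (weights g) (covers dec)) ⟩
      wt g                                          ∎
      where
      open ≡-Reasoning
      concat-sum : ∀ E → sumₘ (map (cycleWeight g) E) ≡ sumₘ (map (weights g) (concatMap support E))
      concat-sum []      = refl
      concat-sum (C ∷ E) = trans (cong (cycleWeight g C ⊕_) (concat-sum E))
        (trans (sym (sumₘ-++ (map (weights g) (support C)) _))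
          (cong sumₘ (sym (map-++ (weights g) (support C) (concatMap support E)))))

    length-cycleWeights : length (cycleWeights g) ≡ length D
    length-cycleWeights = trans (↭-length cycleWeights-↭) (length-map (cycleWeight g) D)

-- The effect of a move on the cycle weights

perm-injective : ∀ {n} (π : Permutation′ n) {k l} → π ⟨$⟩ʳ k ≡ π ⟨$⟩ʳ l → k ≡ l
perm-injective π eq = trans (sym (Perm.inverseˡ π)) (trans (cong (π ⟨$⟩ˡ_) eq) (Perm.inverseˡ π))

transpose-left : ∀ {n} (i j : Fin n) → PC.transpose i j i ≡ j
transpose-left i j rewrite dec-true (i ≟ i) refl = refl

transpose-right : ∀ {n} (i j : Fin n) → PC.transpose i j j ≡ i
transpose-right i j with j ≟ i
... | yes refl = refl
... | no  _ rewrite dec-true (j ≟ j) refl = refl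

transpose-other : ∀ {n} {i j k : Fin n} → k ≢ i → k ≢ j → PC.transpose i j k ≡ k
transpose-other {i = i} {j} {k} k≢i k≢j rewrite dec-false (k ≟ i) k≢i | dec-false (k ≟ j) k≢j = refl

transpose-same : ∀ {n} (i k : Fin n) → PC.transpose i i k ≡ k
transpose-same i k with k ≟ i
... | yes k≡i = sym k≡i
... | no  k≢i rewrite dec-false (k ≟ i) k≢i = refl

module _ {m n : ℕ} .{{_ : NonZero m}} where

  -- The reflections of G(m,1,n): `exchange i j _ a` sends e_i to ζ^a e_j and e_j to ζ^(-a) e_i, and
  -- `scale i a _` multiplies e_i by ζ^a. That there are no others is proved in `reflection⇒move`.
  data Move : Set where
    exchange : (i j : Fin n) → i ≢ j → ZMod m → Move
    scale    : (i : Fin n) (a : ZMod m) → a ≢ 0ₘ → Move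

  exchangeWeights : Fin n → Fin n → ZMod m → Fin n → ZMod m
  exchangeWeights i j a = updateAt (updateAt (λ _ → 0ₘ) j (λ _ → ⊖ a)) i (λ _ → a)

  ⟦_⟧ : Move → G m n
  ⟦ exchange i j _ a ⟧ = [ transpose i j ⨾ exchangeWeights i j a ]
  ⟦ scale i a _ ⟧      = [ Perm.id ⨾ updateAt (λ _ → 0ₘ) i (λ _ → a) ]

  NullMove : ℕ → Move → Set
  NullMove p (exchange _ _ _ _) = ⊤
  NullMove p (scale _ a _)      = a ≡0[mod p ]

  exchangeWeights-left : ∀ i j a → exchangeWeights i j a i ≡ a
  exchangeWeights-left i j a = updateAt-updates i _

  exchangeWeights-right : ∀ {i j} a → i ≢ j → exchangeWeights i j a j ≡ ⊖ a
  exchangeWeights-right {i} {j} a i≢j =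
    trans (updateAt-minimal j i _ (λ j≡i → i≢j (sym j≡i))) (updateAt-updates j _)

  exchangeWeights-other : ∀ {i j k} a → k ≢ i → k ≢ j → exchangeWeights i j a k ≡ 0ₘ
  exchangeWeights-other {i} {j} {k} a k≢i k≢j =
    trans (updateAt-minimal k i _ k≢i) (updateAt-minimal k j _ k≢j)

  -- An exchange is an involution. Describing it from the other end gives the shape in which
  -- `PC.transpose-inverse` cancels the permutations.
  inverse : Move → Move
  inverse (exchange i j i≢j a) = exchange j i (λ j≡i → i≢j (sym j≡i)) (⊖ a)
  inverse (scale i a a≢0)      = scale i (⊖ a) (⊖-≢0 a≢0)

  inverse-null : ∀ {p} → p ∣ m → ∀ t → NullMove p t → NullMove p (inverse t)
  inverse-null p∣m (exchange _ _ _ _) _      = tt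
  inverse-null p∣m (scale _ _ _)      a-null = ⊖-null p∣m a-null

  data Position (i j k : Fin n) : Set where
    left  : k ≡ i → Position i j k
    right : k ≡ j → Position i j k
    other : k ≢ i → k ≢ j → Position i j k

  position : ∀ i j k → Position i j k
  position i j k with k ≟ i | k ≟ j
  ... | yes k≡i | _       = left k≡i
  ... | no  _   | yes k≡j = right k≡j
  ... | no  k≢i | no  k≢j = other k≢i k≢j

  inverse-∙ : ∀ t → ⟦ inverse t ⟧ ∙ ⟦ t ⟧ ≋ ε
  inverse-∙ (exchange i j i≢j a) = (λ _ → PC.transpose-inverse j i) , λ k → weight (position i j k)
    where
    j≢i : j ≢ i
    j≢i j≡i = i≢j (sym j≡i)
    weight : ∀ {k} → Position i j k → exchangeWeights i j a k ⊕ exchangeWeights j i (⊖ a) (PC.transpose i j k) ≡ 0ₘ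
    weight (left refl)
      rewrite transpose-left i j | exchangeWeights-left i j a | exchangeWeights-left j i (⊖ a) = ⊕-inverseʳ a
    weight (right refl)
      rewrite transpose-right i j | exchangeWeights-right a i≢j | exchangeWeights-right (⊖ a) j≢i = ⊕-inverseʳ (⊖ a)
    weight (other k≢i k≢j)
      rewrite transpose-other k≢i k≢j | exchangeWeights-other a k≢i k≢j | exchangeWeights-other (⊖ a) k≢j k≢i =
      ⊕-identityʳ 0ₘ
  inverse-∙ (scale i a _) = (λ _ → refl) , weight
    where
    weight : ∀ k → updateAt (λ _ → 0ₘ) i (λ _ → a) k ⊕ updateAt (λ _ → 0ₘ) i (λ _ → ⊖ a) k ≡ 0ₘ
    weight k with k ≟ i
    ... | yes refl = trans (cong₂ _⊕_ (updateAt-updates i _) (updateAt-updates i _)) (⊕-inverseʳ a)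
    ... | no  k≢i  = trans (cong₂ _⊕_ (updateAt-minimal k i _ k≢i) (updateAt-minimal k i _ k≢i)) (⊕-identityʳ 0ₘ)

  -- Here t′ is the conjugate of t by x: the indices are carried along by the permutation of x, and
  -- a scaling keeps its factor.
  move-past : ∀ x t → ∃[ t′ ] x ∙ ⟦ t ⟧ ≋ ⟦ t′ ⟧ ∙ x
  move-past x (exchange i j i≢j a) =
    exchange (u i) (u j) ui≢uj a′ , (λ k → images (position i j k)) , (λ k → weight (position i j k))
    where
    u : Fin n → Fin n
    u = perm x ⟨$⟩ʳ_
    b : Fin n → ZMod m
    b = weights x
    u-injective : ∀ {k l} → u k ≡ u l → k ≡ l
    u-injective = perm-injective (perm x)
    ui≢uj : u i ≢ u j
    ui≢uj eq = i≢j (u-injective eq)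
    -- Forced by the image of e_i: one side gives the exponent a + b_j, the other b_i + a′.
    a′ : ZMod m
    a′ = (a ⊕ b j) ⊕ ⊖ b i
    a′-eq : b i ⊕ a′ ≡ a ⊕ b j
    a′-eq = trans (⊕-comm (b i) a′)
      (trans (⊕-assoc _ _ _) (trans (cong ((a ⊕ b j) ⊕_) (⊕-inverseˡ (b i))) (⊕-identityʳ _)))
    a′-eq⁻ : ⊖ a ⊕ b i ≡ b j ⊕ ⊖ a′
    a′-eq⁻ = begin
      ⊖ a ⊕ b i                         ≡⟨ cong (⊖ a ⊕_) (⊕-identityʳ (b i)) ⟨
      ⊖ a ⊕ (b i ⊕ 0ₘ)                  ≡⟨ cong (λ z → ⊖ a ⊕ (b i ⊕ z)) (⊕-inverseʳ a′) ⟨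
      ⊖ a ⊕ (b i ⊕ (a′ ⊕ ⊖ a′))         ≡⟨ cong (⊖ a ⊕_) (⊕-assoc (b i) a′ (⊖ a′)) ⟨
      ⊖ a ⊕ ((b i ⊕ a′) ⊕ ⊖ a′)         ≡⟨ cong (λ z → ⊖ a ⊕ (z ⊕ ⊖ a′)) a′-eq ⟩
      ⊖ a ⊕ ((a ⊕ b j) ⊕ ⊖ a′)          ≡⟨ cong (⊖ a ⊕_) (⊕-assoc a (b j) (⊖ a′)) ⟩
      ⊖ a ⊕ (a ⊕ (b j ⊕ ⊖ a′))          ≡⟨ ⊕-assoc (⊖ a) a _ ⟨
      (⊖ a ⊕ a) ⊕ (b j ⊕ ⊖ a′)          ≡⟨ cong (_⊕ (b j ⊕ ⊖ a′)) (⊕-inverseˡ a) ⟩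
      0ₘ ⊕ (b j ⊕ ⊖ a′)                 ≡⟨ ⊕-identityˡ _ ⟩
      b j ⊕ ⊖ a′                        ∎
      where open ≡-Reasoning
    images : ∀ {k} → Position i j k → u (PC.transpose i j k) ≡ PC.transpose (u i) (u j) (u k)
    images (left refl)  = trans (cong u (transpose-left i j)) (sym (transpose-left (u i) (u j)))
    images (right refl) = trans (cong u (transpose-right i j)) (sym (transpose-right (u i) (u j)))
    images (other k≢i k≢j) = trans (cong u (transpose-other k≢i k≢j))
      (sym (transpose-other (λ eq → k≢i (u-injective eq)) (λ eq → k≢j (u-injective eq))))
    weight : ∀ {k} → Position i j k →
      exchangeWeights i j a k ⊕ b (PC.transpose i j k) ≡ b k ⊕ exchangeWeights (u i) (u j) a′ (u k)
    weight (left refl)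
      rewrite transpose-left i j | exchangeWeights-left i j a | exchangeWeights-left (u i) (u j) a′ = sym a′-eq
    weight (right refl)
      rewrite transpose-right i j | exchangeWeights-right a i≢j | exchangeWeights-right a′ ui≢uj = a′-eq⁻
    weight {k} (other k≢i k≢j)
      rewrite transpose-other k≢i k≢j | exchangeWeights-other a k≢i k≢j
            | exchangeWeights-other a′ (λ eq → k≢i (u-injective eq)) (λ eq → k≢j (u-injective eq)) =
      ⊕-comm 0ₘ (b k)
  move-past x (scale i a a≢0) = scale (u i) a a≢0 , (λ _ → refl) , weight
    where
    u : Fin n → Fin n
    u = perm x ⟨$⟩ʳ_
    u-injective : ∀ {k l} → u k ≡ u l → k ≡ l
    u-injective = perm-injective (perm x)
    weight : ∀ k → updateAt (λ _ → 0ₘ) i (λ _ → a) k ⊕ weights x k ≡ weights x k ⊕ updateAt (λ _ → 0ₘ) (u i) (λ _ → a) (u k)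
    weight k with k ≟ i
    ... | yes refl = trans (⊕-comm _ (weights x k))
          (cong (weights x k ⊕_) (trans (updateAt-updates k _) (sym (updateAt-updates (u k) _))))
    ... | no  k≢i  = trans (⊕-comm _ (weights x k))
          (cong (weights x k ⊕_) (trans (updateAt-minimal k i _ k≢i)
            (sym (updateAt-minimal (u k) (u i) _ (λ eq → k≢i (u-injective eq))))))

  Fixes : G m n → Fin n → Set
  Fixes t z = perm t ⟨$⟩ʳ z ≡ z × weights t z ≡ 0ₘ

  pathWeight : G m n → List (Fin n) → ZMod m
  pathWeight g xs = sumₘ (map (weights g) xs)

  module _ (t : G m n) {g : G m n} where

    -- Since t acts after g, it can only disturb the points at which the path arrives. The interior
    -- points are fixed, so only the endpoint moves, and by `∙-pathWeight` only the weight of t at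
    -- that endpoint is added.
    ∙-path : ∀ {x xs y} → Path g x xs y → All (Fixes t) xs → Path (t ∙ g) x xs (perm t ⟨$⟩ʳ y)
    ∙-path (last refl) []                    = last refl
    ∙-path (refl ∷ P)  ((fixed , _) ∷ fixes) = fixed ∷ ∙-path P fixes

    ∙-pathWeight : ∀ {x xs y} → Path g x xs y → All (Fixes t) xs →
                   pathWeight (t ∙ g) (x ∷ xs) ≡ pathWeight g (x ∷ xs) ⊕ weights t y
    ∙-pathWeight {x} (last refl) [] =
      trans (⊕-identityʳ _) (cong (_⊕ weights t _) (sym (⊕-identityʳ (weights g x))))
    ∙-pathWeight {x} (refl ∷ P) ((_ , weight≡0) ∷ fixes) =
      trans (cong₂ _⊕_ (trans (cong (weights g x ⊕_) weight≡0) (⊕-identityʳ _)) (∙-pathWeight P fixes))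
        (sym (⊕-assoc (weights g x) _ _))

    ∙-closed : ∀ {D} → All (Closed g) D → All (Fixes t) (concatMap support D) → All (Closed (t ∙ g)) D
    ∙-closed []            _ = []
    ∙-closed {(x , xs) ∷ D} (P ∷ Ps) (fx ∷ fixes) =
      subst (Path (t ∙ g) x xs) (proj₁ fx) (∙-path P (++⁻ˡ xs fixes)) ∷ ∙-closed Ps (++⁻ʳ xs fixes)

    ∙-cycleWeights : ∀ {D} → All (Closed g) D → All (Fixes t) (concatMap support D) →
                     map (cycleWeight (t ∙ g)) D ≡ map (cycleWeight g) D
    ∙-cycleWeights []             _ = refl
    ∙-cycleWeights {(x , xs) ∷ D} (P ∷ Ps) (fx ∷ fixes) =
      cong₂ _∷_ (trans (∙-pathWeight P (++⁻ˡ xs fixes))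
                  (trans (cong (cycleWeight g (x , xs) ⊕_) (proj₂ fx)) (⊕-identityʳ _)))
        (∙-cycleWeights Ps (++⁻ʳ xs fixes))

  distinct : ∀ {i j : Fin n} {L} → i ∷ j ∷ L ↭ allFin n → i ≢ j
  distinct σ refl with (i∉ ∷ _) ← Unique-↭ (↭-sym σ) (Unique.allFin⁺ n) = All.lookup i∉ (here refl) refl

  exchange-fixes : ∀ {i j i≢j a L} → i ∷ j ∷ L ↭ allFin n → All (Fixes ⟦ exchange i j i≢j a ⟧) L
  exchange-fixes {a = a} σ with (i∉ ∷ (j∉ ∷ _)) ← Unique-↭ (↭-sym σ) (Unique.allFin⁺ n) =
    All.tabulate λ z∈ →
      let z≢i = λ z≡i → All.lookup i∉ (there z∈) (sym z≡i)
          z≢j = λ z≡j → All.lookup j∉ z∈ (sym z≡j)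
      in transpose-other z≢i z≢j , exchangeWeights-other a z≢i z≢j

  scale-fixes : ∀ {i a a≢0 L} → i ∷ L ↭ allFin n → All (Fixes ⟦ scale i a a≢0 ⟧) L
  scale-fixes {i} σ with (i∉ ∷ _) ← Unique-↭ (↭-sym σ) (Unique.allFin⁺ n) =
    All.tabulate λ {z} z∈ → refl , updateAt-minimal z i _ (λ z≡i → All.lookup i∉ z∈ (sym z≡i))

  module _ {g : G m n} {i j : Fin n} (i≢j : i ≢ j) (a : ZMod m) {xs ys : List (Fin n)} {D : List (Cycle n)} where

    private
      t : G m n
      t = ⟦ exchange i j i≢j a ⟧
      R : List (Fin n)
      R = concatMap support D
      ti≡j : perm t ⟨$⟩ʳ i ≡ j
      ti≡j = transpose-left i j
      tj≡i : perm t ⟨$⟩ʳ j ≡ i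
      tj≡i = transpose-right i j

    -- The path returning to i is redirected to j and the one returning to j to i, so the cycles are
    -- traversed one after the other. They pick up a and ⊖ a, which cancel: the new weight is the
    -- sum for every choice of a.
    join-cycles : Decomposition g ((i , xs) ∷ (j , ys) ∷ D) →
      Decomposition (t ∙ g) ((i , xs ++ j ∷ ys) ∷ D) ×
      map (cycleWeight (t ∙ g)) ((i , xs ++ j ∷ ys) ∷ D) ≡
        (cycleWeight g (i , xs) ⊕ cycleWeight g (j , ys)) ∷ map (cycleWeight g) D
    join-cycles dec with P ∷ Q ∷ Ps ← closed dec =
      record { closed = (P′ ++ₚ Q′) ∷ ∙-closed t Ps fix-R
             ; covers = ↭-trans (↭-reflexive (cong (i ∷_) (++-assoc xs (j ∷ ys) R))) (covers dec) } ,
      cong₂ _∷_ weight (∙-cycleWeights t Ps fix-R)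
      where
      fixes : All (Fixes t) (xs ++ ys ++ R)
      fixes = exchange-fixes {i≢j = i≢j} {a} (↭-trans (↭-prep i (↭-sym (shift j xs (ys ++ R)))) (covers dec))
      fix-R = ++⁻ʳ ys (++⁻ʳ xs fixes)
      fix-xs = ++⁻ˡ xs fixes
      fix-ys = ++⁻ˡ ys (++⁻ʳ xs fixes)
      P′ : Path (t ∙ g) i xs j
      P′ = subst (Path (t ∙ g) i xs) ti≡j (∙-path t P fix-xs)
      Q′ : Path (t ∙ g) j ys i
      Q′ = subst (Path (t ∙ g) j ys) tj≡i (∙-path t Q fix-ys)
      open ≡-Reasoning
      weight : cycleWeight (t ∙ g) (i , xs ++ j ∷ ys) ≡ cycleWeight g (i , xs) ⊕ cycleWeight g (j , ys)
      weight = begin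
        pathWeight (t ∙ g) ((i ∷ xs) ++ j ∷ ys)
          ≡⟨ trans (cong sumₘ (map-++ (weights (t ∙ g)) (i ∷ xs) (j ∷ ys))) (sumₘ-++ (map (weights (t ∙ g)) (i ∷ xs)) _) ⟩
        pathWeight (t ∙ g) (i ∷ xs) ⊕ pathWeight (t ∙ g) (j ∷ ys)
          ≡⟨ cong₂ _⊕_ (∙-pathWeight t P fix-xs) (∙-pathWeight t Q fix-ys) ⟩
        (pathWeight g (i ∷ xs) ⊕ weights t i) ⊕ (pathWeight g (j ∷ ys) ⊕ weights t j)
          ≡⟨ ⊕-medial (pathWeight g (i ∷ xs)) (weights t i) (pathWeight g (j ∷ ys)) (weights t j) ⟩
        (pathWeight g (i ∷ xs) ⊕ pathWeight g (j ∷ ys)) ⊕ (weights t i ⊕ weights t j)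
          ≡⟨ cong ((pathWeight g (i ∷ xs) ⊕ pathWeight g (j ∷ ys)) ⊕_)
               (trans (cong₂ _⊕_ (exchangeWeights-left i j a) (exchangeWeights-right a i≢j)) (⊕-inverseʳ a)) ⟩
        (pathWeight g (i ∷ xs) ⊕ pathWeight g (j ∷ ys)) ⊕ 0ₘ
          ≡⟨ ⊕-identityʳ _ ⟩
        pathWeight g (i ∷ xs) ⊕ pathWeight g (j ∷ ys) ∎

    -- The arrival at j is redirected to i, with weight ⊖ a, and the arrival at i to j, with weight
    -- a. Unlike in a join, a decides how the weight is shared between the pieces.
    cut-cycle : Decomposition g ((i , xs ++ j ∷ ys) ∷ D) →
      Decomposition (t ∙ g) ((i , xs) ∷ (j , ys) ∷ D) ×
      map (cycleWeight (t ∙ g)) ((i , xs) ∷ (j , ys) ∷ D) ≡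
        (cycleWeight g (i , xs) ⊕ ⊖ a) ∷ (cycleWeight g (j , ys) ⊕ a) ∷ map (cycleWeight g) D
    cut-cycle dec with PQ ∷ Ps ← closed dec with P , Q ← split-path xs PQ =
      record { closed = P′ ∷ Q′ ∷ ∙-closed t Ps fix-R
             ; covers = ↭-trans (↭-reflexive (cong (i ∷_) (sym (++-assoc xs (j ∷ ys) R)))) (covers dec) } ,
      cong₂ _∷_ (trans (∙-pathWeight t P fix-xs) (cong (pathWeight g (i ∷ xs) ⊕_) (exchangeWeights-right a i≢j)))
        (cong₂ _∷_ (trans (∙-pathWeight t Q fix-ys) (cong (pathWeight g (j ∷ ys) ⊕_) (exchangeWeights-left i j a)))
          (∙-cycleWeights t Ps fix-R))
      where
      σ : i ∷ j ∷ xs ++ ys ++ R ↭ allFin n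
      σ = ↭-trans (↭-prep i (↭-trans (↭-sym (shift j xs (ys ++ R))) (↭-reflexive (sym (++-assoc xs (j ∷ ys) R)))))
            (covers dec)
      fixes : All (Fixes t) (xs ++ ys ++ R)
      fixes = exchange-fixes {i≢j = i≢j} {a} σ
      fix-R = ++⁻ʳ ys (++⁻ʳ xs fixes)
      fix-xs = ++⁻ˡ xs fixes
      fix-ys = ++⁻ˡ ys (++⁻ʳ xs fixes)
      P′ : Path (t ∙ g) i xs i
      P′ = subst (Path (t ∙ g) i xs) tj≡i (∙-path t P fix-xs)
      Q′ : Path (t ∙ g) j ys j
      Q′ = subst (Path (t ∙ g) j ys) ti≡j (∙-path t Q fix-ys)

  scale-cycle : ∀ {g i a xs D} (a≢0 : a ≢ 0ₘ) → Decomposition g ((i , xs) ∷ D) →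
    let t = ⟦ scale i a a≢0 ⟧ in
    Decomposition (t ∙ g) ((i , xs) ∷ D) ×
    map (cycleWeight (t ∙ g)) ((i , xs) ∷ D) ≡ (cycleWeight g (i , xs) ⊕ a) ∷ map (cycleWeight g) D
  scale-cycle {g} {i} {a} {xs} {D} a≢0 dec with P ∷ Ps ← closed dec =
    record { closed = ∙-path t P (++⁻ˡ xs fixes) ∷ ∙-closed t Ps (++⁻ʳ xs fixes) ; covers = covers dec } ,
    cong₂ _∷_ (trans (∙-pathWeight t P (++⁻ˡ xs fixes)) (cong (pathWeight g (i ∷ xs) ⊕_) (updateAt-updates i _)))
      (∙-cycleWeights t Ps (++⁻ʳ xs fixes))
    where
    t : G m n
    t = ⟦ scale i a a≢0 ⟧
    fixes : All (Fixes t) (xs ++ concatMap support D)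
    fixes = scale-fixes {a≢0 = a≢0} (covers dec)

  to-front : ∀ {g : G m n} {D : List (Cycle n)} {i} → All (Closed g) D → i ∈ concatMap support D →
             ∃[ xs ] ∃[ E ] All (Closed g) ((i , xs) ∷ E) × concatMap support D ↭ i ∷ xs ++ concatMap support E
  to-front {D = C ∷ D} (P ∷ Ps) i∈ with ∈-++⁻ (support C) i∈
  ... | inj₁ i∈C = let xs , Q , σ = rotate P i∈C in xs , D , Q ∷ Ps , ++⁺ʳ (concatMap support D) (↭-sym σ)
  ... | inj₂ i∈D with xs , E , Q ∷ Qs , σ ← to-front {D = D} Ps i∈D =
    xs , C ∷ E , Q ∷ P ∷ Qs , ↭-trans (++⁺ˡ (support C) σ) (shifts (support C) (_ ∷ xs))

  headed-by : ∀ {g : G m n} {D} → Decomposition g D → ∀ i → ∃[ xs ] ∃[ E ] Decomposition g ((i , xs) ∷ E)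
  headed-by dec i =
    let xs , E , Ps , σ = to-front (closed dec) (∈-resp-↭ (↭-sym (covers dec)) (∈-allFin i)) in
    xs , E , record { closed = Ps ; covers = ↭-trans (↭-sym σ) (covers dec) }

  pathWeight-++ : ∀ g xs ys → pathWeight g (xs ++ ys) ≡ pathWeight g xs ⊕ pathWeight g ys
  pathWeight-++ g xs ys = trans (cong sumₘ (map-++ (weights g) xs ys)) (sumₘ-++ (map (weights g) xs) _)

  -- The place of j decides: on the cycle of i the move cuts that cycle at j, elsewhere it joins the
  -- two cycles. After a cut the changes ⊖ a and a cancel, so the pieces sum to the old weight.
  exchange-effect : ∀ p {i j} (i≢j : i ≢ j) a {g xs E} → Decomposition g ((i , xs) ∷ E) → let t = ⟦ exchange i j i≢j a ⟧ in
                    ∃[ D ] Decomposition (t ∙ g) D × Step p (cycleWeights g) (cycleWeights (t ∙ g))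
  exchange-effect p {i} {j} i≢j a {g} {xs} {E} dec₁
    with ∈-++⁻ (i ∷ xs) (∈-resp-↭ (↭-sym (covers dec₁)) (∈-allFin j))
  ... | inj₁ (here j≡i) = contradiction (sym j≡i) i≢j
  ... | inj₁ (there j∈) with ws , ys , refl ← ∈-∃++ j∈ with dec₂ , W≡ ← cut-cycle i≢j a {ws} {ys} {E} dec₁ =
    _ , dec₂ , cut (↭-trans (cycleWeights-↭ dec₁) (↭-reflexive (cong (_∷ map (cycleWeight g) E) same)))
                 (↭-trans (cycleWeights-↭ dec₂) (↭-reflexive W≡))
    where
    open ≡-Reasoning
    same : cycleWeight g (i , ws ++ j ∷ ys) ≡ (pathWeight g (i ∷ ws) ⊕ ⊖ a) ⊕ (pathWeight g (j ∷ ys) ⊕ a)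
    same = begin
      cycleWeight g (i , ws ++ j ∷ ys)                                  ≡⟨ pathWeight-++ g (i ∷ ws) (j ∷ ys) ⟩
      pathWeight g (i ∷ ws) ⊕ pathWeight g (j ∷ ys)                     ≡⟨ ⊕-identityʳ _ ⟨
      (pathWeight g (i ∷ ws) ⊕ pathWeight g (j ∷ ys)) ⊕ 0ₘ              ≡⟨ cong ((pathWeight g (i ∷ ws) ⊕ _) ⊕_) (⊕-inverseˡ a) ⟨
      (pathWeight g (i ∷ ws) ⊕ pathWeight g (j ∷ ys)) ⊕ (⊖ a ⊕ a)       ≡⟨ ⊕-medial (pathWeight g (i ∷ ws)) (pathWeight g (j ∷ ys)) (⊖ a) a ⟩
      (pathWeight g (i ∷ ws) ⊕ ⊖ a) ⊕ (pathWeight g (j ∷ ys) ⊕ a)       ∎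
  ... | inj₂ j∈E =
    let ys , F , Qs , σ = to-front {g = g} {D = E} (All.tail (closed dec₁)) j∈E
        dec₂ = record { closed = All.head (closed dec₁) ∷ Qs ; covers = ↭-trans (++⁺ˡ (i ∷ xs) (↭-sym σ)) (covers dec₁) }
        dec₃ , W≡ = join-cycles i≢j a {xs} {ys} {F} dec₂
    in _ , dec₃ , join (cycleWeights-↭ dec₂) (↭-trans (cycleWeights-↭ dec₃) (↭-reflexive W≡))

  effect : ∀ p t → NullMove p t → ∀ {g D} → Decomposition g D →
           ∃[ E ] Decomposition (⟦ t ⟧ ∙ g) E × Step p (cycleWeights g) (cycleWeights (⟦ t ⟧ ∙ g))
  effect p (scale i a a≢0) a-null {g} dec =
    let xs , E , dec₁ = headed-by dec i
        dec₂ , W≡ = scale-cycle {g = g} a≢0 dec₁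
    in _ , dec₂ , twist a-null (cycleWeights-↭ dec₁) (↭-trans (cycleWeights-↭ dec₂) (↭-reflexive W≡))
  effect p (exchange i j i≢j a) _ {g} dec =
    let xs , E , dec₁ = headed-by dec i in exchange-effect p i≢j a dec₁

  -- Existence of decompositions, and moves with a prescribed effect

  path-resp : ∀ {g h : G m n} → (∀ i → perm g ⟨$⟩ʳ i ≡ perm h ⟨$⟩ʳ i) → ∀ {x xs y} → Path g x xs y → Path h x xs y
  path-resp eq (last refl) = last (sym (eq _))
  path-resp eq (refl ∷ P)  = sym (eq _) ∷ path-resp eq P

  Decomposition-resp : ∀ {g h : G m n} → (∀ i → perm g ⟨$⟩ʳ i ≡ perm h ⟨$⟩ʳ i) → ∀ {D} →
                       Decomposition g D → Decomposition h D
  Decomposition-resp eq dec = record { closed = All.map (path-resp eq) (closed dec) ; covers = covers dec }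

  singletons : Decomposition ε (map (_, []) (allFin n))
  singletons = record
    { closed = All-map⁺ (All.universal (λ _ → last refl) (allFin n))
    ; covers = ↭-reflexive (trans (concatMap-map support (_, []) (allFin n)) (concatMap-pure (allFin n))) }

  -- The decomposition is built up instead of being read off the orbits. Starting from the fixed
  -- points of ε, each transposition in a factorization of the permutation joins or cuts cycles by
  -- `effect`. The weights of the element built are irrelevant, as a decomposition depends on the
  -- permutation alone.
  decomposition : ∀ (g : G m n) → ∃[ D ] Decomposition g D
  decomposition g =
    let h , D , dec , h≗ = build (decompose (perm g)) ε singletons in
    D , Decomposition-resp (λ i → trans (h≗ i) (eval-decompose (perm g) i)) dec
    where
    build : ∀ (ts : TranspositionList n) (h : G m n) {D} → Decomposition h D →
            ∃[ h′ ] ∃[ E ] Decomposition {m} {n} h′ E × (∀ i → perm h′ ⟨$⟩ʳ i ≡ eval ts ⟨$⟩ʳ (perm h ⟨$⟩ʳ i))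
    build [] h dec = h , _ , dec , λ _ → refl
    build ((i , j) ∷ ts) h dec with i ≟ j
    ... | yes refl = let h′ , E , dec′ , eq = build ts h dec in
          h′ , E , dec′ , λ k → trans (eq k) (cong (eval ts ⟨$⟩ʳ_) (sym (transpose-same i _)))
    ... | no i≢j = let _ , dec₁ , _ = effect 1 (exchange i j i≢j 0ₘ) tt dec in
          build ts (⟦ exchange i j i≢j 0ₘ ⟧ ∙ h) dec₁

  cycleWeights-≋ : ∀ {g h : G m n} → g ≋ h → cycleWeights g ↭ cycleWeights h
  cycleWeights-≋ {g} {h} (perm≡ , weights≡) with D , dec ← decomposition g = begin
    cycleWeights g            ↭⟨ cycleWeights-↭ dec ⟩
    map (cycleWeight g) D     ≡⟨ map-cong (λ C → cong sumₘ (map-cong weights≡ (support C))) D ⟩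
    map (cycleWeight h) D     ↭⟨ cycleWeights-↭ {g = h} (Decomposition-resp {g = g} perm≡ dec) ⟨
    cycleWeights h            ∎
    where
    open PermutationReasoning

  move-step : ∀ p t → NullMove p t → ∀ g → Step p (cycleWeights g) (cycleWeights (⟦ t ⟧ ∙ g))
  move-step p t t-null g = proj₂ (proj₂ (effect p t t-null (proj₂ (decomposition g))))

  wt-cycleWeights : ∀ g → sumₘ (cycleWeights g) ≡ wt g
  wt-cycleWeights g = sum-cycleWeights (proj₂ (decomposition g))

  merge-move : ∀ g {u v V} → cycleWeights g ↭ u ∷ v ∷ V →
    ∃[ i ] ∃[ j ] ∃[ i≢j ] cycleWeights (⟦ exchange i j i≢j 0ₘ ⟧ ∙ g) ↭ (u ⊕ v) ∷ V
  merge-move g σ with with-weights (proj₂ (decomposition g)) σ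
  ... | (i , xs) ∷ (j , ys) ∷ D , dec , refl =
    let i≢j = distinct (↭-trans (↭-prep i (↭-sym (shift j xs _))) (covers dec))
        dec′ , W≡ = join-cycles i≢j 0ₘ {xs} {ys} {D} dec
    in i , j , i≢j , ↭-trans (cycleWeights-↭ dec′) (↭-reflexive W≡)

  twist-move : ∀ g {u a V} (a≢0 : a ≢ 0ₘ) → cycleWeights g ↭ u ∷ V →
    ∃[ i ] cycleWeights (⟦ scale i a a≢0 ⟧ ∙ g) ↭ (u ⊕ a) ∷ V
  twist-move g a≢0 σ with with-weights (proj₂ (decomposition g)) σ
  ... | (i , xs) ∷ D , dec , refl =
    let dec′ , W≡ = scale-cycle {xs = xs} {D} a≢0 dec in i , ↭-trans (cycleWeights-↭ dec′) (↭-reflexive W≡)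

  long-cycle : ∀ (D : List (Cycle n)) → (∃[ i ] ∃[ j ] ∃[ xs ] ∃[ E ] D ↭ (i , j ∷ xs) ∷ E) ⊎
                     (All (λ C → proj₂ C ≡ []) D × length (concatMap support D) ≡ length D)
  long-cycle [] = inj₂ ([] , refl)
  long-cycle ((i , j ∷ xs) ∷ D) = inj₁ (i , j , xs , D , ↭-refl)
  long-cycle ((i , []) ∷ D) with long-cycle D
  ... | inj₁ (k , j , xs , E , σ) = inj₁ (k , j , xs , (i , []) ∷ E , ↭-trans (↭-prep _ σ) (↭-swap _ _ ↭-refl))
  ... | inj₂ (all , eq)           = inj₂ (refl ∷ all , cong suc eq)

  length-covers : ∀ {g D} → Decomposition {m} {n} g D → length (concatMap support D) ≡ n
  length-covers dec = trans (↭-length (covers dec)) (length-tabulate {n = n} _)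

  -- Fewer than n cycles leave some cycle with at least two points, whose first point can be cut
  -- off.
  cut-move : ∀ g → length (cycleWeights g) ≢ n →
    ∃[ i ] ∃[ j ] ∃[ i≢j ] ∃[ a ] cycleWeights (⟦ exchange i j i≢j a ⟧ ∙ g) ↭ 0ₘ ∷ cycleWeights g
  cut-move g length≢n with D , dec ← decomposition g with long-cycle D
  ... | inj₂ (_ , eq) = contradiction (trans (length-cycleWeights dec) (trans (sym eq) (length-covers dec))) length≢n
  ... | inj₁ (i , j , ys , E , τ) =
    let dec₁ = Decomposition-↭ τ dec
        i≢j = distinct (covers dec₁)
        dec₂ , W≡ = cut-cycle i≢j a {[]} {ys} {E} dec₁
    in i , j , i≢j , a , (begin
      cycleWeights (⟦ exchange i j i≢j a ⟧ ∙ g)              ↭⟨ cycleWeights-↭ dec₂ ⟩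
      _                                                      ≡⟨ W≡ ⟩
      (a ⊕ ⊖ a) ∷ (s ⊕ a) ∷ map (cycleWeight g) E            ≡⟨ cong₂ (λ x y → x ∷ y ∷ map (cycleWeight g) E) (⊕-inverseʳ a) same ⟩
      0ₘ ∷ map (cycleWeight g) ((i , j ∷ ys) ∷ E)            ↭⟨ ↭-prep 0ₘ (cycleWeights-↭ dec₁) ⟨
      0ₘ ∷ cycleWeights g                                    ∎)
    where
    open PermutationReasoning
    -- With `a` the weight at i, the piece consisting of i gets weight 0 and the other piece
    -- inherits the whole weight of the cycle.
    a s : ZMod m
    a = pathWeight g (i ∷ [])
    s = pathWeight g (j ∷ ys)
    same : s ⊕ a ≡ cycleWeight g (i , j ∷ ys)
    same = trans (⊕-comm s a) (cong (_⊕ s) (⊕-identityʳ (weights g i)))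

  length≤length-support : ∀ (D : List (Cycle n)) → length D ≤ length (concatMap support D)
  length≤length-support []      = z≤n
  length≤length-support (C ∷ D) = s≤s (ℕ.≤-trans (length≤length-support D)
    (ℕ.≤-trans (ℕ.m≤n+m _ (length (proj₂ C))) (ℕ.≤-reflexive (sym (length-++ (proj₂ C))))))

  length-cycleWeights≤n : ∀ g → length (cycleWeights g) ≤ n
  length-cycleWeights≤n g with D , dec ← decomposition g = begin
    length (cycleWeights g)          ≡⟨ length-cycleWeights dec ⟩
    length D                         ≤⟨ length≤length-support D ⟩
    length (concatMap support D)     ≡⟨ length-covers dec ⟩
    n                                ∎
    where
    open ℕ.≤-Reasoning

  zeros-ε : zeros (cycleWeights {n = n} ε) ≡ n
  zeros-ε = begin
    zeros (cycleWeights {n = n} ε)                                      ≡⟨ zeros-↭ (cycleWeights-↭ singletons) ⟩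
    zeros (map (cycleWeight ε) (map (_, []) (allFin n)))        ≡⟨ all-zeros (allFin n) ⟩
    length (allFin n)                                           ≡⟨ length-tabulate {n = n} _ ⟩
    n                                                           ∎
    where
    open ≡-Reasoning
    all-zeros : ∀ (xs : List (Fin n)) → zeros (map (cycleWeight ε) (map (_, []) xs)) ≡ length xs
    all-zeros []       = refl
    all-zeros (x ∷ xs) = cong₂ _+_ (trans (cong δ (⊕-identityʳ 0ₘ)) δ-0ₘ) (all-zeros xs)

  -- With n zero weights there are n cycles on n points, so every cycle is a single fixed point, of
  -- weight 0.
  zeros≡n⇒ε : ∀ g → n ≤ zeros (cycleWeights g) → g ≋ ε
  zeros≡n⇒ε g n≤z with D , dec ← decomposition g with long-cycle D
  ... | inj₁ (i , j , xs , E , τ) = contradiction n≤z (ℕ.<⇒≱ (begin-strict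
    zeros (cycleWeights g)              ≤⟨ zeros≤length (cycleWeights g) ⟩
    length (cycleWeights g)             ≡⟨ length-cycleWeights dec₁ ⟩
    suc (length E)                      <⟨ s≤s (s≤s (length≤length-support E)) ⟩
    2 + length (concatMap support E)    ≤⟨ s≤s (s≤s (ℕ.≤-trans (ℕ.m≤n+m _ (length xs)) (ℕ.≤-reflexive (sym (length-++ xs))))) ⟩
    length (concatMap support ((i , j ∷ xs) ∷ E))    ≡⟨ length-covers dec₁ ⟩
    n                                   ∎))
    where
    open ℕ.≤-Reasoning
    dec₁ = Decomposition-↭ τ dec
  ... | inj₂ (tails , _) = (λ i → proj₁ (fixed i)) , (λ i → proj₂ (fixed i))
    where
    weights≡0 : All (_≡ 0ₘ) (map (cycleWeight g) D)
    weights≡0 = All-resp-↭ (cycleWeights-↭ dec)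
      (all-zero (cycleWeights g) (ℕ.≤-trans (length-cycleWeights≤n g) n≤z))
    fixed : ∀ i → perm g ⟨$⟩ʳ i ≡ i × weights g i ≡ 0ₘ
    fixed i = let C , C∈ , i∈ = covered dec i in
      fixed-point i∈ (All.lookup tails C∈) (All.lookup (closed dec) C∈)
        (All.lookup weights≡0 (∈-map⁺ (cycleWeight g) C∈))
      where
      fixed-point : ∀ {C} → i ∈ support C → proj₂ C ≡ [] → Closed g C → cycleWeight g C ≡ 0ₘ →
                    perm g ⟨$⟩ʳ i ≡ i × weights g i ≡ 0ₘ
      fixed-point (here refl) refl (last e) w≡0 = e , trans (sym (⊕-identityʳ _)) w≡0

-- Dimension over a Heyting field

module Dimension {c ℓ₁ ℓ₂} (K : HeytingField c ℓ₁ ℓ₂) where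

  open HeytingField K
    using (Carrier; _≈_; _#_; 0#; 1#; tight; #⇒invertible; heytingCommutativeRing)
  open LinearAlgebra K renaming (sum to sumᴷ)
  open CommutativeRing ring
    using (_*_; semiring; *-congʳ; *-congˡ; *-assoc; +-cong; +-congˡ; +-congʳ; *-identityʳ; zeroˡ; zeroʳ;
           distribˡ; -‿inverseʳ; reflexive)
    renaming (setoid to setoidᴷ; _+_ to _+ᴷ_; -_ to -ᴷ_; refl to ≈-refl; sym to ≈-sym; trans to ≈-trans)
  open RingProperties (CommutativeRing.ring ring) using (-‿distribˡ-*)
  open SemiringSum semiring using (sum-remove; sum-cong-≋; sum-replicate-zero; ∑-distrib-+; ∑-comm;
           *-distribˡ-sum; *-distribʳ-sum)
  open HeytingProperties heytingCommutativeRing using (1#0; x-0≈x)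
  open SetoidReasoning setoidᴷ

  sum-zero : ∀ {d} (t : Vector Carrier d) → (∀ i → t i ≈ 0#) → sumᴷ t ≈ 0#
  sum-zero {d} t t≈0 = ≈-trans (sum-cong-≋ t≈0) (sum-replicate-zero d)

  Independent : ∀ {n d} → (Fin d → Vector Carrier n) → Set _
  Independent {d = d} b = ∀ (x : Vector Carrier d) → (∀ j → combination x b j ≈ 0#) → ∀ i → x i ≈ 0#

  left-inverse : ∀ {x y} → x # y → ∃[ z ] z * (x +ᴷ -ᴷ y) ≈ 1#
  left-inverse x#y = let z , zx≈1 , _ = #⇒invertible x#y in z , zx≈1

  module _ {e d : ℕ} (M : Fin (suc d) → Vector Carrier (suc e)) (r : Fin (suc d)) (pivot : M r zero # 0#) where

    private
      z : Carrier
      z = proj₁ (left-inverse pivot)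

      z-inverse : z * M r zero ≈ 1#
      z-inverse = ≈-trans (*-congˡ (≈-sym (x-0≈x (M r zero)))) (proj₂ (left-inverse pivot))

      factor : Fin d → Carrier
      factor k = -ᴷ (M (punchIn r k) zero * z)

    eliminated : Fin d → Vector Carrier (suc e)
    eliminated k j = M (punchIn r k) j +ᴷ factor k * M r j

    eliminated-zero : ∀ k → eliminated k zero ≈ 0#
    eliminated-zero k = begin
      a +ᴷ factor k * M r zero          ≈⟨ +-congˡ (≈-sym (-‿distribˡ-* (a * z) (M r zero))) ⟩
      a +ᴷ -ᴷ (a * z * M r zero)        ≈⟨ +-congˡ (-‿cong (≈-trans (*-assoc a z _) (≈-trans (*-congˡ z-inverse) (*-identityʳ a)))) ⟩
      a +ᴷ -ᴷ a                         ≈⟨ -‿inverseʳ a ⟩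
      0#                                ∎
      where
      open CommutativeRing ring using (-‿cong)
      a : Carrier
      a = M (punchIn r k) zero

    eliminated-independent : Independent M → Independent (λ k j → eliminated k (suc j))
    eliminated-independent independent y y-zero k =
      ≈-trans (reflexive (sym (insertAt-punchIn y r s k))) (independent x x-zero (punchIn r k))
      where
      -- The coefficient of the pivot row: the eliminated row k contains that row `factor k` times.
      s : Carrier
      s = ∑[ k < d ] (y k * factor k)
      x : Vector Carrier (suc d)
      x = insertAt y r s
      combination-x : ∀ j → combination x M j ≈ combination y eliminated j
      combination-x j = begin
        combination x M j
          ≈⟨ sum-remove {i = r} (λ i → x i * M i j) ⟩
        x r * M r j +ᴷ (∑[ k < d ] (x (punchIn r k) * M (punchIn r k) j))
          ≈⟨ +-cong (*-congʳ (reflexive (insertAt-lookup y r s)))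
               (sum-cong-≋ (λ k → *-congʳ (reflexive (insertAt-punchIn y r s k)))) ⟩
        s * M r j +ᴷ (∑[ k < d ] (y k * M (punchIn r k) j))
          ≈⟨ +-congʳ (*-distribʳ-sum (M r j) (λ k → y k * factor k)) ⟩
        (∑[ k < d ] (y k * factor k * M r j)) +ᴷ (∑[ k < d ] (y k * M (punchIn r k) j))
          ≈⟨ ∑-distrib-+ (λ k → y k * factor k * M r j) (λ k → y k * M (punchIn r k) j) ⟨
        (∑[ k < d ] (y k * factor k * M r j +ᴷ y k * M (punchIn r k) j))
          ≈⟨ sum-cong-≋ (λ k → ≈-trans (+-comm _ _) (≈-trans (+-congˡ (*-assoc _ _ _)) (≈-sym (distribˡ (y k) _ _)))) ⟩
        combination y eliminated j ∎
        where open CommutativeRing ring using (+-comm)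
      x-zero : ∀ j → combination x M j ≈ 0#
      x-zero zero    = ≈-trans (combination-x zero)
        (sum-zero _ (λ k → ≈-trans (*-congˡ (eliminated-zero k)) (zeroʳ (y k))))
      x-zero (suc j) = ≈-trans (combination-x (suc j)) (y-zero j)

  -- Gaussian elimination, although apartness from 0 need not be decidable. The goal is a negation,
  -- and any pivot in the first column leads to the contradiction; hence there is none, the column
  -- is 0 by tightness, and it can be deleted.
  independent⇒≤ : ∀ e {d} (M : Fin d → Vector Carrier e) → Independent M → ¬ e < d
  independent⇒≤ zero {suc d} M independent _ =
    proj₂ (tight 1# 0#) (independent (λ _ → 1#) (λ ()) zero) 1#0
  independent⇒≤ (suc e) {suc d} M independent (s≤s e<d) = no-pivot λ r pivot →
    independent⇒≤ e (λ k j → eliminated M r pivot k (suc j)) (eliminated-independent M r pivot independent) e<d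
    where
    no-pivot : ¬ (∀ r → ¬ M r zero # 0#)
    no-pivot none = independent⇒≤ e (λ i j → M i (suc j)) independent′ (ℕ.m<n⇒m<1+n e<d)
      where
      independent′ : Independent (λ i j → M i (suc j))
      independent′ x x-zero = independent x λ
        { zero    → sum-zero _ (λ i → ≈-trans (*-congˡ (proj₁ (tight _ _) (none i))) (zeroʳ (x i)))
        ; (suc j) → x-zero j }

  -- Expanding one basis in the other gives d independent coefficient vectors of length e.
  dimension-≤ : ∀ {ℓ n d e} {V : Pred (Vector Carrier n) ℓ} → HasDimension V d → HasDimension V e → d ≤ e
  dimension-≤ {n = n} {d} {e} (b , b-basis) (b′ , b′-basis) = ℕ.≮⇒≥ (independent⇒≤ e C C-independent)
    where
    module b  = IsBasis b-basis
    module b′ = IsBasis b′-basis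
    C : Fin d → Vector Carrier e
    C i = proj₁ (b′.spanning (b i) (b.inside i))
    C-independent : Independent C
    C-independent x x-zero = b.independent x λ j → begin
      (∑[ i < d ] (x i * b i j))
        ≈⟨ sum-cong-≋ (λ i → *-congˡ {x i} (proj₂ (b′.spanning (b i) (b.inside i)) j)) ⟩
      (∑[ i < d ] (x i * (∑[ k < e ] (C i k * b′ k j))))
        ≈⟨ sum-cong-≋ (λ i → *-distribˡ-sum (x i) (λ k → C i k * b′ k j)) ⟩
      (∑[ i < d ] ∑[ k < e ] (x i * (C i k * b′ k j)))
        ≈⟨ ∑-comm (λ i k → x i * (C i k * b′ k j)) ⟩
      (∑[ k < e ] ∑[ i < d ] (x i * (C i k * b′ k j)))
        ≈⟨ sum-cong-≋ (λ k → ≈-trans (sum-cong-≋ (λ i → ≈-sym (*-assoc (x i) (C i k) (b′ k j))))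
             (≈-sym (*-distribʳ-sum (b′ k j) (λ i → x i * C i k)))) ⟩
      (∑[ k < e ] (combination x C k * b′ k j))
        ≈⟨ sum-zero _ (λ k → ≈-trans (*-congʳ (x-zero k)) (zeroˡ (b′ k j))) ⟩
      0# ∎

  dimension-unique : ∀ {ℓ n d e} {V : Pred (Vector Carrier n) ℓ} → HasDimension V d → HasDimension V e → d ≡ e
  dimension-unique p q = ℕ.≤-antisym (dimension-≤ p q) (dimension-≤ q p)

-- The fixed space

module FixedSpace {c ℓ₁ ℓ₂} (K : HeytingField c ℓ₁ ℓ₂) (ζ : HeytingField.Carrier K)
  (m p n : ℕ) .{{_ : NonZero m}} (root : LinearAlgebra.IsPrimitiveRootOfUnity K m ζ) where

  open HeytingField K using (Carrier; _≈_; _#_; 0#; 1#)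
  open LinearAlgebra K renaming (sum to sumᴷ)
  open Representation K ζ m p n
  open Dimension K
  open CommutativeRing ring
    using (_*_; semiring; *-congʳ; *-congˡ; *-comm; *-assoc; +-cong; +-congˡ; +-congʳ; -‿cong; *-identityʳ;
           *-identityˡ; +-identityʳ; +-identityˡ; zeroˡ; zeroʳ; distribʳ; -‿inverseʳ; reflexive)
    renaming (setoid to setoidᴷ; _+_ to _+ᴷ_; -_ to -ᴷ_; refl to ≈-refl; sym to ≈-sym; trans to ≈-trans)
  open RingProperties (CommutativeRing.ring ring) using (-‿distribˡ-*)
  open SemiringSum semiring using (sum-remove)
  open SemiringExp semiring using (^-homo-*; ^-assocʳ; ^-congˡ)
  open SetoidReasoning setoidᴷ

  power : ZMod m → Carrier
  power x = ζ ^ toℕ x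

  private
    1^ : ∀ k → 1# ^ k ≈ 1#
    1^ zero    = ≈-refl
    1^ (suc k) = ≈-trans (*-congˡ (1^ k)) (*-identityʳ 1#)

    ζ^% : ∀ k → ζ ^ k ≈ ζ ^ (k % m)
    ζ^% k = begin
      ζ ^ k                               ≈⟨ reflexive (cong (ζ ^_) (m≡m%n+[m/n]*n k m)) ⟩
      ζ ^ (k % m + k / m ℕ.* m)           ≈⟨ ^-homo-* ζ (k % m) _ ⟩
      ζ ^ (k % m) * ζ ^ (k / m ℕ.* m)     ≈⟨ *-congˡ (reflexive (cong (ζ ^_) (ℕ.*-comm (k / m) m))) ⟩
      ζ ^ (k % m) * ζ ^ (m ℕ.* (k / m))   ≈⟨ *-congˡ (≈-sym (^-assocʳ ζ m (k / m))) ⟩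
      ζ ^ (k % m) * (ζ ^ m) ^ (k / m)     ≈⟨ *-congˡ (^-congˡ (k / m) (proj₁ root)) ⟩
      ζ ^ (k % m) * 1# ^ (k / m)          ≈⟨ *-congˡ (1^ (k / m)) ⟩
      ζ ^ (k % m) * 1#                    ≈⟨ *-identityʳ _ ⟩
      ζ ^ (k % m)                         ∎

  power-⊕ : ∀ x y → power (x ⊕ y) ≈ power y * power x
  power-⊕ x y = begin
    power (x ⊕ y)                   ≈⟨ reflexive (cong (ζ ^_) (toℕ-fromℕ< (m%n<n (toℕ x + toℕ y) m))) ⟩
    ζ ^ ((toℕ x + toℕ y) % m)       ≈⟨ ζ^% (toℕ x + toℕ y) ⟨
    ζ ^ (toℕ x + toℕ y)             ≈⟨ ^-homo-* ζ (toℕ x) (toℕ y) ⟩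
    power x * power y               ≈⟨ *-comm _ _ ⟩
    power y * power x               ∎

  power-0 : power 0ₘ ≈ 1#
  power-0 = reflexive (cong (ζ ^_) toℕ-0ₘ)

  -- Primitivity makes ζ^x - 1 invertible for a nonzero class x, so it can be cancelled from (ζ^x -
  -- 1) v = 0.
  power-≢0 : ∀ {x v} → x ≢ 0ₘ → v ≈ power x * v → v ≈ 0#
  power-≢0 {x} {v} x≢0 v≈xv = begin
    v                                     ≈⟨ *-identityˡ v ⟨
    1# * v                                ≈⟨ *-congʳ z-inverse ⟨
    z * (power x +ᴷ -ᴷ 1#) * v            ≈⟨ *-assoc z _ v ⟩
    z * ((power x +ᴷ -ᴷ 1#) * v)          ≈⟨ *-congˡ (distribʳ v _ _) ⟩
    z * (power x * v +ᴷ (-ᴷ 1#) * v)      ≈⟨ *-congˡ (+-cong (≈-sym v≈xv) (≈-trans (≈-sym (-‿distribˡ-* 1# v)) (-‿cong (*-identityˡ v)))) ⟩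
    z * (v +ᴷ -ᴷ v)                       ≈⟨ *-congˡ (-‿inverseʳ v) ⟩
    z * 0#                                ≈⟨ zeroʳ z ⟩
    0#                                    ∎
    where
    0<x : 0 < toℕ x
    0<x = ℕ.n≢0⇒n>0 (λ x≡0 → x≢0 (toℕ-injective (trans x≡0 (sym toℕ-0ₘ))))
    inverse-of : ∃[ z ] z * (power x +ᴷ -ᴷ 1#) ≈ 1#
    inverse-of = left-inverse (proj₂ root (toℕ x) 0<x (toℕ<n x))
    z = proj₁ inverse-of
    z-inverse = proj₂ inverse-of

  sum-only : ∀ {d} (j : Fin d) (t : Vector Carrier d) → (∀ k → k ≢ j → t k ≈ 0#) → sumᴷ t ≈ t j
  sum-only {suc d} j t t≈0 = begin
    sumᴷ t                       ≈⟨ sum-remove t ⟩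
    t j +ᴷ sumᴷ (removeAt t j)   ≈⟨ +-congˡ (sum-zero _ (λ k → t≈0 _ (punchInᵢ≢i j k))) ⟩
    t j +ᴷ 0#                    ≈⟨ +-identityʳ (t j) ⟩
    t j                          ∎

  if-yes : ∀ {P : Set} (P? : Dec P) {x y : Carrier} → P → (if does P? then x else y) ≈ x
  if-yes (yes _)  _ = ≈-refl
  if-yes (no ¬p) pr = contradiction pr ¬p

  if-no : ∀ {P : Set} (P? : Dec P) {x y : Carrier} → ¬ P → (if does P? then x else y) ≈ y
  if-no (yes pr) ¬p = contradiction pr ¬p
  if-no (no _)   _  = ≈-refl

  module _ (g : G m n) where

    private
      u : Fin n → Fin n
      u = perm g ⟨$⟩ʳ_

    Invariant : Vector Carrier n → Fin n → Set ℓ₁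
    Invariant v i = v (u i) ≈ power (weights g i) * v i

    apply : ∀ v i → (toMatrix g ·ᵛ v) (u i) ≈ power (weights g i) * v i
    apply v i = ≈-trans (sum-only i _ off-diagonal) on-diagonal
      where
      off-diagonal : ∀ k → k ≢ i → toMatrix g (u i) k * v k ≈ 0#
      off-diagonal k k≢i with u i ≟ u k
      ... | yes eq = contradiction (sym (perm-injective (perm g) eq)) k≢i
      ... | no  _  = zeroˡ (v k)
      on-diagonal : toMatrix g (u i) i * v i ≈ power (weights g i) * v i
      on-diagonal with u i ≟ u i
      ... | yes _  = ≈-refl
      ... | no  ne = contradiction refl ne

    fix⇒Invariant : ∀ {v} → fix g v → ∀ i → Invariant v i
    fix⇒Invariant {v} fixed i = ≈-trans (≈-sym (fixed (u i))) (apply v i)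

    Invariant⇒fix : ∀ {v} → (∀ i → Invariant v i) → fix g v
    Invariant⇒fix {v} invariant k = subst (λ k → (toMatrix g ·ᵛ v) k ≈ v k) (Perm.inverseʳ (perm g))
      (≈-trans (apply v (perm g ⟨$⟩ˡ k)) (≈-sym (invariant (perm g ⟨$⟩ˡ k))))

    -- Along a path starting with the coordinate ζ^s, the coordinates of an invariant
    -- vector are forced; off the path this vector is 0.
    profile : ZMod m → List (Fin n) → Vector Carrier n
    profile s []       j = 0#
    profile s (x ∷ xs) j = if does (j ≟ x) then power s else profile (s ⊕ weights g x) xs j

    profile-head : ∀ s x xs → profile s (x ∷ xs) x ≈ power s
    profile-head s x xs with x ≟ x
    ... | yes _  = ≈-refl
    ... | no  ne = contradiction refl ne

    profile-tail : ∀ s {x xs j} → j ≢ x → profile s (x ∷ xs) j ≈ profile (s ⊕ weights g x) xs j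
    profile-tail s {x} {xs} {j} j≢x with j ≟ x
    ... | yes j≡x = contradiction j≡x j≢x
    ... | no  _   = ≈-refl

    profile-off : ∀ s xs {j} → j ∉ xs → profile s xs j ≈ 0#
    profile-off s []       j∉ = ≈-refl
    profile-off s (x ∷ xs) j∉ = ≈-trans (profile-tail s {x} {xs} (λ j≡x → j∉ (here j≡x)))
      (profile-off (s ⊕ weights g x) xs (λ j∈ → j∉ (there j∈)))

    private
      sum-∷ : ∀ s x xs → s ⊕ pathWeight g (x ∷ xs) ≡ (s ⊕ weights g x) ⊕ pathWeight g xs
      sum-∷ s x xs = sym (⊕-assoc s (weights g x) _)

    profile-invariant : ∀ s {x xs y z} → Path g x xs y → Unique (x ∷ xs) → z ∈ x ∷ xs →
      (u z ∈ xs × Invariant (profile s (x ∷ xs)) z) ⊎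
      (u z ≡ y × power (s ⊕ pathWeight g (x ∷ xs)) ≈ power (weights g z) * profile s (x ∷ xs) z)
    profile-invariant s {x} (last ux≡y) _ (here refl) = inj₂ (ux≡y , (begin
      power (s ⊕ (weights g x ⊕ 0ₘ))              ≈⟨ reflexive (cong (λ t → power (s ⊕ t)) (⊕-identityʳ (weights g x))) ⟩
      power (s ⊕ weights g x)                     ≈⟨ power-⊕ s (weights g x) ⟩
      power (weights g x) * power s               ≈⟨ *-congˡ (≈-sym (profile-head s x [])) ⟩
      power (weights g x) * profile s (x ∷ []) x  ∎))
    profile-invariant s {x} {y ∷ xs} (refl ∷ P) (x∉ ∷ _) (here refl) = inj₁ (here refl , (begin
      profile s (x ∷ y ∷ xs) y                    ≈⟨ profile-tail s {x} {y ∷ xs} (λ y≡x → All.lookup x∉ (here refl) (sym y≡x)) ⟩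
      profile (s ⊕ weights g x) (y ∷ xs) y        ≈⟨ profile-head _ y xs ⟩
      power (s ⊕ weights g x)                     ≈⟨ power-⊕ s (weights g x) ⟩
      power (weights g x) * power s               ≈⟨ *-congˡ (≈-sym (profile-head s x (y ∷ xs))) ⟩
      power (weights g x) * profile s (x ∷ y ∷ xs) x  ∎))
    profile-invariant s {x} {y ∷ xs} {z = z} (_ ∷ P) (x∉ ∷ unique) (there z∈)
      with profile-invariant (s ⊕ weights g x) P unique z∈
    ... | inj₁ (uz∈ , invariant) = inj₁ (there uz∈ , (begin
      profile s (x ∷ y ∷ xs) (u z)                          ≈⟨ profile-tail s {x} {y ∷ xs} (∉-head (there uz∈)) ⟩
      profile (s ⊕ weights g x) (y ∷ xs) (u z)              ≈⟨ invariant ⟩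
      power (weights g z) * profile (s ⊕ weights g x) (y ∷ xs) z    ≈⟨ *-congˡ (≈-sym (profile-tail s {x} {y ∷ xs} (∉-head z∈))) ⟩
      power (weights g z) * profile s (x ∷ y ∷ xs) z        ∎))
      where
      ∉-head : ∀ {w} → w ∈ y ∷ xs → w ≢ x
      ∉-head w∈ w≡x = All.lookup x∉ w∈ (sym w≡x)
    ... | inj₂ (uz≡ , closing) = inj₂ (uz≡ , (begin
      power (s ⊕ pathWeight g (x ∷ y ∷ xs))                 ≈⟨ reflexive (cong power (sum-∷ s x (y ∷ xs))) ⟩
      power ((s ⊕ weights g x) ⊕ pathWeight g (y ∷ xs))     ≈⟨ closing ⟩
      power (weights g z) * profile (s ⊕ weights g x) (y ∷ xs) z    ≈⟨ *-congˡ (≈-sym (profile-tail s {x} {y ∷ xs} (λ z≡x → All.lookup x∉ z∈ (sym z≡x)))) ⟩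
      power (weights g z) * profile s (x ∷ y ∷ xs) z        ∎))

    -- Invariance determines each coordinate from the previous one, so only the scalar t is free. On
    -- a closed path the first component compares v at the head with itself after one full turn.
    invariant-profile : ∀ s {v t x xs y} → Path g x xs y → Unique (x ∷ xs) → (∀ {z} → z ∈ x ∷ xs → Invariant v z) →
      v x ≈ power s * t →
      v y ≈ power (s ⊕ pathWeight g (x ∷ xs)) * t × (∀ {z} → z ∈ x ∷ xs → v z ≈ profile s (x ∷ xs) z * t)
    invariant-profile s {v} {t} {x} P unique invariant vx = go P unique invariant
      where
      next : Invariant v x → v (u x) ≈ power (s ⊕ weights g x) * t
      next invariant-x = begin
        v (u x)                                ≈⟨ invariant-x ⟩
        power (weights g x) * v x              ≈⟨ *-congˡ vx ⟩
        power (weights g x) * (power s * t)    ≈⟨ *-assoc _ _ _ ⟨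
        power (weights g x) * power s * t      ≈⟨ *-congʳ (power-⊕ s (weights g x)) ⟨
        power (s ⊕ weights g x) * t            ∎
      at-head : ∀ xs → v x ≈ profile s (x ∷ xs) x * t
      at-head xs = ≈-trans vx (*-congʳ (≈-sym (profile-head s x xs)))
      go : ∀ {xs y} → Path g x xs y → Unique (x ∷ xs) → (∀ {z} → z ∈ x ∷ xs → Invariant v z) →
        v y ≈ power (s ⊕ pathWeight g (x ∷ xs)) * t × (∀ {z} → z ∈ x ∷ xs → v z ≈ profile s (x ∷ xs) z * t)
      go (last refl) _ invariant =
        ≈-trans (next (invariant (here refl)))
          (*-congʳ (reflexive (cong (λ r → power (s ⊕ r)) (sym (⊕-identityʳ (weights g x)))))) ,
        λ { (here refl) → at-head [] }
      go {y ∷ xs} (refl ∷ P) (x∉ ∷ unique) invariant =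
        let end , on-path = invariant-profile (s ⊕ weights g x) P unique (λ z∈ → invariant (there z∈)) (next (invariant (here refl))) in
        ≈-trans end (*-congʳ (reflexive (cong power (sym (sum-∷ s x (y ∷ xs)))))) ,
        λ { (here refl) → at-head (y ∷ xs)
          ; (there z∈)  → ≈-trans (on-path z∈)
              (*-congʳ (≈-sym (profile-tail s {x} {y ∷ xs} (λ z≡x → All.lookup x∉ z∈ (sym z≡x))))) }

    -- The vectors supported on the cycles of `D` and invariant there; this filtration lets a basis
    -- of the fixed space grow cycle by cycle.
    record FixedOn (D : List (Cycle n)) (v : Vector Carrier n) : Set ℓ₁ where
      field
        on  : ∀ {i} → i ∈ concatMap support D → Invariant v i
        off : ∀ {i} → i ∉ concatMap support D → v i ≈ 0#

    open FixedOn

    image-in-cycle : ∀ {C z} → Closed g C → z ∈ support C → u z ∈ support C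
    image-in-cycle P z∈ with image-on-path P z∈
    ... | inj₁ uz≡x = here uz≡x
    ... | inj₂ uz∈  = there uz∈

    image-in-cycles : ∀ {D z} → All (Closed g) D → z ∈ concatMap support D → u z ∈ concatMap support D
    image-in-cycles {C ∷ D} (P ∷ Ps) z∈ with ∈-++⁻ (support C) z∈
    ... | inj₁ z∈C = ∈-++⁺ˡ (image-in-cycle P z∈C)
    ... | inj₂ z∈D = ∈-++⁺ʳ (support C) (image-in-cycles Ps z∈D)

    module _ {C : Cycle n} {D : List (Cycle n)} (P : Closed g C) (Ps : All (Closed g) D)
             (unique : Unique (support C ++ concatMap support D)) where

      private
        L R : List (Fin n)
        L = support C
        R = concatMap support D
        disjoint : ∀ {z} → z ∈ L → z ∉ R
        disjoint = Unique-disjoint L unique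
        unique-C : Unique L
        unique-C = Unique-++ˡ L unique
        open DecMembership {A = Fin n} _≟_ using () renaming (_∈?_ to _∈ₗ?_)

      extend : ∀ {v} → FixedOn D v → FixedOn (C ∷ D) v
      extend {v} fixed = record { on = on′ ; off = λ i∉ → off fixed (λ i∈ → i∉ (∈-++⁺ʳ L i∈)) }
        where
        on′ : ∀ {i} → i ∈ L ++ R → Invariant v i
        on′ {i} i∈ with ∈-++⁻ L i∈
        ... | inj₂ i∈R = on fixed i∈R
        ... | inj₁ i∈L = ≈-trans (off fixed (disjoint (image-in-cycle P i∈L)))
              (≈-sym (≈-trans (*-congˡ (off fixed (disjoint i∈L))) (zeroʳ _)))

      restrict : ∀ {v w} → FixedOn (C ∷ D) v → (∀ {i} → i ∈ L → w i ≈ 0#) → (∀ {i} → i ∉ L → w i ≈ v i) → FixedOn D w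
      restrict {v} {w} fixed w-on w-off = record
        { on = λ i∈ → ≈-trans (w-off (λ ui∈ → disjoint ui∈ (image-in-cycles Ps i∈)))
            (≈-trans (on fixed (∈-++⁺ʳ L i∈)) (*-congˡ (≈-sym (w-off (λ i∈L → disjoint i∈L i∈)))))
        ; off = off′ }
        where
        off′ : ∀ {i} → i ∉ R → w i ≈ 0#
        off′ {i} i∉R with i ∈ₗ? L
        ... | yes i∈L = w-on i∈L
        ... | no  i∉L = ≈-trans (w-off i∉L) (off fixed (λ i∈ → go (∈-++⁻ L i∈)))
          where
          go : i ∈ L ⊎ i ∈ R → ⊥
          go (inj₁ i∈L) = i∉L i∈L
          go (inj₂ i∈R) = i∉R i∈R

      multiple-of-profile : ∀ {v} → FixedOn (C ∷ D) v →
        v (proj₁ C) ≈ power (cycleWeight g C) * v (proj₁ C) × (∀ {z} → z ∈ L → v z ≈ profile 0ₘ L z * v (proj₁ C))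
      multiple-of-profile {v} fixed =
        let end , on-path = invariant-profile 0ₘ {v} {v (proj₁ C)} P unique-C (λ z∈ → on fixed (∈-++⁺ˡ z∈))
                              (≈-sym (≈-trans (*-congʳ power-0) (*-identityˡ _)))
        in ≈-trans end (*-congʳ (reflexive (cong power (⊕-identityˡ (cycleWeight g C))))) , on-path

      -- One turn round the cycle multiplies an invariant vector by ζ to the power of its weight, so
      -- the vector vanishes on the cycle and the old basis still spans.
      nonzero-cycle : cycleWeight g C ≢ 0ₘ → ∀ {d} → HasDimension (FixedOn D) d → HasDimension (FixedOn (C ∷ D)) d
      nonzero-cycle weight≢0 (b , b-basis) = b , record
        { inside      = λ i → extend (inside i)
        ; independent = independent
        ; spanning    = λ v fixed → spanning v (restrict fixed (vanishes fixed) (λ _ → ≈-refl)) }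
        where
        open IsBasis b-basis
        vanishes : ∀ {v} → FixedOn (C ∷ D) v → ∀ {i} → i ∈ L → v i ≈ 0#
        vanishes fixed i∈ = let head , on-path = multiple-of-profile fixed in
          ≈-trans (on-path i∈) (≈-trans (*-congˡ (power-≢0 weight≢0 head)) (zeroʳ _))

      -- The invariance equations close up, so the profile is a new basis vector. It is 1 at the
      -- head, where all the old basis vectors vanish.
      zero-cycle : cycleWeight g C ≡ 0ₘ → ∀ {d} → HasDimension (FixedOn D) d → HasDimension (FixedOn (C ∷ D)) (suc d)
      zero-cycle weight≡0 {d} (b , b-basis) = b′ , record
        { inside = inside′ ; independent = independent′ ; spanning = spanning′ }
        where
        open IsBasis b-basis
        h : Fin n
        h = proj₁ C
        e : Vector Carrier n
        e = profile 0ₘ L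
        b′ : Fin (suc d) → Vector Carrier n
        b′ zero    = e
        b′ (suc i) = b i
        e-head : e h ≈ 1#
        e-head = ≈-trans (profile-head 0ₘ h (proj₂ C)) power-0
        e-invariant : ∀ {i} → i ∈ L → Invariant e i
        e-invariant {i} i∈ with profile-invariant 0ₘ P unique-C i∈
        ... | inj₁ (_ , invariant) = invariant
        ... | inj₂ (ui≡h , closing) = begin
          e (u i)                               ≈⟨ reflexive (cong e ui≡h) ⟩
          e h                                   ≈⟨ profile-head 0ₘ h (proj₂ C) ⟩
          power 0ₘ                              ≈⟨ reflexive (cong power (trans (⊕-identityˡ _) weight≡0)) ⟨
          power (0ₘ ⊕ cycleWeight g C)          ≈⟨ closing ⟩
          power (weights g i) * e i             ∎
        e-off : ∀ {i} → i ∉ L → e i ≈ 0#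
        e-off = profile-off 0ₘ L
        inside′ : ∀ i → FixedOn (C ∷ D) (b′ i)
        inside′ (suc i) = extend (inside i)
        inside′ zero    = record { on = e-on ; off = λ i∉ → e-off (λ i∈ → i∉ (∈-++⁺ˡ i∈)) }
          where
          e-on : ∀ {i} → i ∈ L ++ R → Invariant e i
          e-on {i} i∈ with ∈-++⁻ L i∈
          ... | inj₁ i∈L = e-invariant i∈L
          ... | inj₂ i∈R = ≈-trans (e-off (λ ui∈L → disjoint ui∈L (image-in-cycles Ps i∈R)))
                (≈-sym (≈-trans (*-congˡ (e-off (λ i∈L → disjoint i∈L i∈R))) (zeroʳ _)))
        combination-on : ∀ (x : Vector Carrier d) {i} → i ∈ L → combination x b i ≈ 0#
        combination-on x i∈ = sum-zero _ (λ k → ≈-trans (*-congˡ (off (inside k) (disjoint i∈))) (zeroʳ (x k)))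
        independent′ : Independent b′
        independent′ x x-zero = λ { zero → x₀≈0 ; (suc i) → independent (λ i → x (suc i)) tail-zero i }
          where
          x₀≈0 : x zero ≈ 0#
          x₀≈0 = begin
            x zero                                                  ≈⟨ *-identityʳ (x zero) ⟨
            x zero * 1#                                             ≈⟨ *-congˡ e-head ⟨
            x zero * e h                                            ≈⟨ +-identityʳ _ ⟨
            x zero * e h +ᴷ 0#                                      ≈⟨ +-congˡ (combination-on (λ i → x (suc i)) (here refl)) ⟨
            x zero * e h +ᴷ combination (λ i → x (suc i)) b h       ≈⟨ x-zero h ⟩
            0#                                                      ∎
          tail-zero : ∀ j → combination (λ i → x (suc i)) b j ≈ 0#
          tail-zero j = begin
            combination (λ i → x (suc i)) b j                       ≈⟨ +-identityˡ _ ⟨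
            0# +ᴷ combination (λ i → x (suc i)) b j                 ≈⟨ +-congʳ (≈-trans (*-congʳ x₀≈0) (zeroˡ (e j))) ⟨
            x zero * e j +ᴷ combination (λ i → x (suc i)) b j       ≈⟨ x-zero j ⟩
            0#                                                      ∎
        spanning′ : ∀ v → FixedOn (C ∷ D) v → ∃[ x ] (∀ j → v j ≈ combination x b′ j)
        spanning′ v fixed = (λ { zero → v h ; (suc i) → x i }) , v≈
          where
          -- This is v - v_h e: on the cycle v is v_h times e, and off the cycle e is 0.
          w : Vector Carrier n
          w i = if does (i ∈ₗ? L) then 0# else v i
          w-on : ∀ {i} → i ∈ L → w i ≈ 0#
          w-on {i} i∈ = if-yes (i ∈ₗ? L) i∈
          w-off : ∀ {i} → i ∉ L → w i ≈ v i
          w-off {i} i∉ = if-no (i ∈ₗ? L) i∉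
          span = spanning w (restrict fixed w-on w-off)
          x : Vector Carrier d
          x = proj₁ span
          v≈ : ∀ j → v j ≈ v h * e j +ᴷ combination x b j
          v≈ j with j ∈ₗ? L
          ... | yes j∈ = begin
            v j                                ≈⟨ proj₂ (multiple-of-profile fixed) j∈ ⟩
            e j * v h                          ≈⟨ *-comm (e j) (v h) ⟩
            v h * e j                          ≈⟨ +-identityʳ _ ⟨
            v h * e j +ᴷ 0#                    ≈⟨ +-congˡ (combination-on x j∈) ⟨
            v h * e j +ᴷ combination x b j     ∎
          ... | no j∉ = begin
            v j                                ≈⟨ w-off j∉ ⟨
            w j                                ≈⟨ proj₂ span j ⟩
            combination x b j                  ≈⟨ +-identityˡ _ ⟨
            0# +ᴷ combination x b j            ≈⟨ +-congʳ (≈-trans (*-congˡ (e-off j∉)) (zeroʳ (v h))) ⟨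
            v h * e j +ᴷ combination x b j     ∎

    dimension-FixedOn : ∀ {D} → All (Closed g) D → Unique (concatMap support D) →
                        HasDimension (FixedOn D) (zeros (map (cycleWeight g) D))
    dimension-FixedOn [] _ = (λ ()) , record
      { inside = λ () ; independent = λ _ _ () ; spanning = λ v fixed → (λ ()) , λ j → off fixed (λ ()) }
    dimension-FixedOn {C ∷ D} (P ∷ Ps) unique with cycleWeight g C ≟ 0ₘ
    ... | yes ≡0 = zero-cycle P Ps unique ≡0 (dimension-FixedOn Ps (Unique-++ʳ (support C) unique))
    ... | no  ≢0 = nonzero-cycle P Ps unique ≢0 (dimension-FixedOn Ps (Unique-++ʳ (support C) unique))

    dimension-fix : HasDimension (fix g) (zeros (cycleWeights g))
    dimension-fix = subst (HasDimension (fix g)) (sym (zeros-↭ (cycleWeights-↭ dec))) (b , record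
      { inside      = λ i → Invariant⇒fix (λ j → on (inside i) (everywhere j))
      ; independent = independent
      ; spanning    = λ v fixed → spanning v
          (record { on = λ {i} _ → fix⇒Invariant fixed i ; off = λ {i} i∉ → contradiction (everywhere i) i∉ }) })
      where
      D = proj₁ (decomposition g)
      dec = proj₂ (decomposition g)
      fixed-dimension = dimension-FixedOn (closed dec) (unique-support dec)
      b = proj₁ fixed-dimension
      open IsBasis (proj₂ fixed-dimension)
      everywhere : ∀ i → i ∈ concatMap support D
      everywhere i = ∈-resp-↭ (↭-sym (covers dec)) (∈-allFin i)

  -- `Codimfix` speaks of some basis of some size; uniqueness of dimension identifies that size with
  -- the number of cycles of weight 0.
  Codimfix⇒zeros : ∀ {g k} → Codimfix g k → zeros (cycleWeights g) + k ≡ n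
  Codimfix⇒zeros {g} {k} (d , dim , d+k≡n) = trans (cong (_+ k) (dimension-unique (dimension-fix g) dim)) d+k≡n

  zeros⇒Codimfix : ∀ {g k} → zeros (cycleWeights g) + k ≡ n → Codimfix g k
  zeros⇒Codimfix {g} z+k≡n = zeros (cycleWeights g) , dimension-fix g , z+k≡n

-- Products of moves

module _ {m n : ℕ} .{{_ : NonZero m}} where

  infix 4 _≃_

  -- The same relation as _≋_, but as a record, so that both sides can be inferred.
  record _≃_ (g h : G m n) : Set where
    constructor ≃-intro
    field
      ≃⇒≋ : g ≋ h

  open _≃_ public

  ≃-group : Group 0ℓ 0ℓ
  ≃-group = record
    { Carrier = G m n ; _≈_ = _≃_ ; _∙_ = _∙_ ; ε = ε ; _⁻¹ = _⁻¹
    ; isGroup = record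
      { isMonoid = record
        { isSemigroup = record
          { isMagma = record
            { isEquivalence = record
              { refl  = λ {g} → ≃-intro (𝔾.refl {g})
              ; sym   = λ {g} {h} (≃-intro e) → ≃-intro (𝔾.sym {g} {h} e)
              ; trans = λ {g} {h} {k} (≃-intro e) (≃-intro f) → ≃-intro (𝔾.trans {g} {h} {k} e f) }
            ; ∙-cong = λ {g} {g′} {h} {h′} (≃-intro e) (≃-intro f) → ≃-intro (𝔾.∙-cong {g} {g′} {h} {h′} e f) }
          ; assoc = λ g h k → ≃-intro (𝔾.assoc g h k) }
        ; identity = (λ g → ≃-intro (𝔾.identityˡ g)) , (λ g → ≃-intro (𝔾.identityʳ g)) }
      ; inverse = (λ g → ≃-intro (𝔾.inverseˡ g)) , (λ g → ≃-intro (𝔾.inverseʳ g))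
      ; ⁻¹-cong = λ {g} {h} (≃-intro e) → ≃-intro (𝔾.⁻¹-cong {g} {h} e) } }
    where module 𝔾 = Group (group {m} {n})

  module ≃ = Group ≃-group

  fixedDim : G m n → ℕ
  fixedDim g = zeros (cycleWeights g)

  fixedDim-≃ : ∀ {g h} → g ≃ h → fixedDim g ≡ fixedDim h
  fixedDim-≃ {g} {h} (≃-intro e) = zeros-↭ (cycleWeights-≋ {g = g} {h} e)

  fixedDim≤n : ∀ g → fixedDim g ≤ n
  fixedDim≤n g = ℕ.≤-trans (zeros≤length (cycleWeights g)) (length-cycleWeights≤n g)

  ∙-congˡ : ∀ g {h h′} → h ≃ h′ → g ∙ h ≃ g ∙ h′
  ∙-congˡ g {h} {h′} e = ≃.∙-cong {g} {g} {h} {h′} (≃.refl {g}) e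

  ∙-congʳ : ∀ g {h h′} → h ≃ h′ → h ∙ g ≃ h′ ∙ g
  ∙-congʳ g {h} {h′} e = ≃.∙-cong {h} {h′} {g} {g} e (≃.refl {g})

  inverse-≃ : ∀ t → ⟦ inverse t ⟧ ∙ ⟦ t ⟧ ≃ ε
  inverse-≃ t = ≃-intro (inverse-∙ t)

  inverse-cancel : ∀ t g → ⟦ inverse t ⟧ ∙ (⟦ t ⟧ ∙ g) ≃ g
  inverse-cancel t g = begin
    ⟦ inverse t ⟧ ∙ (⟦ t ⟧ ∙ g)    ≈⟨ ≃.assoc ⟦ inverse t ⟧ ⟦ t ⟧ g ⟨
    (⟦ inverse t ⟧ ∙ ⟦ t ⟧) ∙ g    ≈⟨ ∙-congʳ g (inverse-≃ t) ⟩
    ε ∙ g                          ≈⟨ ≃.identityˡ g ⟩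
    g                              ∎
    where open SetoidReasoning ≃.setoid

  act : List (Move {m} {n}) → G m n → G m n
  act []       g = g
  act (t ∷ ts) g = ⟦ t ⟧ ∙ act ts g

  act-cong : ∀ ts {g h} → g ≃ h → act ts g ≃ act ts h
  act-cong []       e = e
  act-cong (t ∷ ts) e = ∙-congˡ ⟦ t ⟧ (act-cong ts e)

  act-∙ : ∀ ts g h → act ts (g ∙ h) ≃ act ts g ∙ h
  act-∙ []       g h = ≃.refl {g ∙ h}
  act-∙ (t ∷ ts) g h = begin
    ⟦ t ⟧ ∙ act ts (g ∙ h)         ≈⟨ ∙-congˡ ⟦ t ⟧ (act-∙ ts g h) ⟩
    ⟦ t ⟧ ∙ (act ts g ∙ h)         ≈⟨ ≃.assoc ⟦ t ⟧ (act ts g) h ⟨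
    (⟦ t ⟧ ∙ act ts g) ∙ h         ∎
    where open SetoidReasoning ≃.setoid

  act-ε-∙ : ∀ ts g → act ts ε ∙ g ≃ act ts g
  act-ε-∙ ts g = ≃.trans (≃.sym (act-∙ ts ε g)) (act-cong ts (≃.identityˡ g))

  act-++ : ∀ ts ss g → act (ts ++ ss) g ≡ act ts (act ss g)
  act-++ []       ss g = refl
  act-++ (t ∷ ts) ss g = cong (⟦ t ⟧ ∙_) (act-++ ts ss g)

  move-past-≃ : ∀ x t → ∃[ t′ ] x ∙ ⟦ t ⟧ ≃ ⟦ t′ ⟧ ∙ x
  move-past-≃ x t = let t′ , e = move-past x t in t′ , ≃-intro e

  -- Each right factor is conjugated past x in turn. The number of factors is kept, which is all
  -- that the codimension order needs.
  move-right-factors : ∀ x ss → ∃[ ts ] length ts ≡ length ss × x ∙ act ss ε ≃ act ts x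
  move-right-factors x []       = [] , refl , ≃.identityʳ x
  move-right-factors x (s ∷ ss) =
    let t , xs≃tx = move-past-≃ x s
        ts , length≡ , e = move-right-factors x ss
    in t ∷ ts , cong suc length≡ , (begin
      x ∙ (⟦ s ⟧ ∙ act ss ε)    ≈⟨ ≃.assoc x ⟦ s ⟧ (act ss ε) ⟨
      (x ∙ ⟦ s ⟧) ∙ act ss ε    ≈⟨ ∙-congʳ (act ss ε) xs≃tx ⟩
      (⟦ t ⟧ ∙ x) ∙ act ss ε    ≈⟨ ≃.assoc ⟦ t ⟧ x (act ss ε) ⟩
      ⟦ t ⟧ ∙ (x ∙ act ss ε)    ≈⟨ ∙-congˡ ⟦ t ⟧ e ⟩
      ⟦ t ⟧ ∙ act ts x          ∎)
    where open SetoidReasoning ≃.setoid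

  null-1 : ∀ (t : Move {m} {n}) → NullMove 1 t
  null-1 (exchange _ _ _ _) = tt
  null-1 (scale _ a _)      = 1∣ toℕ a

  Step-↭ : ∀ {p} {V V′ W W′ : List (ZMod m)} → V ↭ V′ → W ↭ W′ → Step p V W → Step p V′ W′
  Step-↭ α β (join σ τ)    = join (↭-trans (↭-sym α) σ) (↭-trans (↭-sym β) τ)
  Step-↭ α β (cut σ τ)     = cut (↭-trans (↭-sym α) σ) (↭-trans (↭-sym β) τ)
  Step-↭ α β (twist a σ τ) = twist a (↭-trans (↭-sym α) σ) (↭-trans (↭-sym β) τ)

  cycleWeights-≃ : ∀ {g h} → g ≃ h → cycleWeights g ↭ cycleWeights h
  cycleWeights-≃ {g} {h} (≃-intro e) = cycleWeights-≋ {g = g} {h} e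

  back-step : ∀ t g → Step 1 (cycleWeights (⟦ t ⟧ ∙ g)) (cycleWeights g)
  back-step t g = Step-↭ ↭-refl (cycleWeights-≃ (inverse-cancel t g))
    (move-step 1 (inverse t) (null-1 (inverse t)) (⟦ t ⟧ ∙ g))

  zeros-step : ∀ {p} {V W : List (ZMod m)} → Step p V W → zeros V ≤ suc (zeros W)
  zeros-step (join {u} {v} {U} σ τ) rewrite zeros-↭ σ | zeros-↭ τ = begin
    δ u + (δ v + zeros U)         ≡⟨ ℕ.+-assoc (δ u) (δ v) (zeros U) ⟨
    δ u + δ v + zeros U           ≤⟨ ℕ.+-monoˡ-≤ (zeros U) (δ-⊕ u v) ⟩
    suc (δ (u ⊕ v) + zeros U)     ∎
    where open ℕ.≤-Reasoning
  zeros-step (cut {u} {v} {U} σ τ) rewrite zeros-↭ σ | zeros-↭ τ =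
    ℕ.+-mono-≤ {δ (u ⊕ v)} {1} {zeros U} (δ≤1 (u ⊕ v)) (ℕ.≤-trans (ℕ.m≤n+m (zeros U) (δ v)) (ℕ.m≤n+m (δ v + zeros U) (δ u)))
  zeros-step (twist {u} {a} {U} _ σ τ) rewrite zeros-↭ σ | zeros-↭ τ =
    ℕ.+-mono-≤ {δ u} {1} {zeros U} (δ≤1 u) (ℕ.m≤n+m (zeros U) (δ (u ⊕ a)))

  fixedDim-act : ∀ ts g → fixedDim g ≤ length ts + fixedDim (act ts g)
  fixedDim-act []       g = ℕ.≤-refl
  fixedDim-act (t ∷ ts) g = ℕ.≤-trans (fixedDim-act ts g)
    (ℕ.≤-trans (ℕ.+-monoʳ-≤ (length ts) (zeros-step (move-step 1 t (null-1 t) (act ts g))))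
      (ℕ.≤-reflexive (ℕ.+-suc (length ts) _)))

  -- A join or twist that gains a zero must produce it as the new weight, and the weights it used
  -- disappear. A cut gains a zero only if one piece is 0, and then the other piece is the weight
  -- that was cut. In every case what remains besides the new zero was there before.
  raising-step : ∀ {p} {V W : List (ZMod m)} → Step p V W → zeros V < zeros W →
                 ∃[ U ] ∃[ T ] V ↭ U ++ T × W ↭ 0ₘ ∷ U
  raising-step {V = V} {W} (join {u} {v} {U} σ τ) z< rewrite zeros-↭ σ | zeros-↭ τ =
    U , u ∷ v ∷ [] , ↭-trans σ (++-comm (u ∷ v ∷ []) U) , subst (λ x → W ↭ x ∷ U) u+v≡0 τ
    where
    u+v≡0 : u ⊕ v ≡ 0ₘ
    u+v≡0 with δ (u ⊕ v) in eq
    ... | suc _ = δ≢0⇒≡0ₘ eq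
    ... | zero  = contradiction (ℕ.≤-trans (ℕ.m≤n+m (zeros U) (δ v)) (ℕ.m≤n+m (δ v + zeros U) (δ u))) (ℕ.<⇒≱ z<)
  raising-step {V = V} {W} (twist {u} {a} {U} _ σ τ) z< rewrite zeros-↭ σ | zeros-↭ τ =
    U , u ∷ [] , ↭-trans σ (++-comm (u ∷ []) U) , subst (λ x → W ↭ x ∷ U) u+a≡0 τ
    where
    u+a≡0 : u ⊕ a ≡ 0ₘ
    u+a≡0 with δ (u ⊕ a) in eq
    ... | suc _ = δ≢0⇒≡0ₘ eq
    ... | zero  = contradiction (ℕ.m≤n+m (zeros U) (δ u)) (ℕ.<⇒≱ z<)
  raising-step {V = V} {W} (cut {u} {v} {U} σ τ) z< rewrite zeros-↭ σ | zeros-↭ τ = go (u ≟ 0ₘ) (v ≟ 0ₘ)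
    where
    go : Dec (u ≡ 0ₘ) → Dec (v ≡ 0ₘ) → ∃[ U′ ] ∃[ T ] V ↭ U′ ++ T × W ↭ 0ₘ ∷ U′
    go (yes refl) _ = v ∷ U , [] ,
      ↭-trans σ (↭-reflexive (trans (cong (_∷ U) (⊕-identityˡ v)) (sym (++-identityʳ (v ∷ U))))) , τ
    go (no _) (yes refl) = u ∷ U , [] ,
      ↭-trans σ (↭-reflexive (trans (cong (_∷ U) (⊕-identityʳ u)) (sym (++-identityʳ (u ∷ U))))) ,
      ↭-trans τ (↭-swap u 0ₘ ↭-refl)
    go (no u≢0) (no v≢0) = contradiction (ℕ.m≤n+m (zeros U) (δ (u ⊕ v)))
      (ℕ.<⇒≱ (subst (λ d → δ (u ⊕ v) + zeros U < d + zeros U) (cong₂ _+_ (δ-≢0ₘ u≢0) (δ-≢0ₘ v≢0))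
        (subst (δ (u ⊕ v) + zeros U <_) (sym (ℕ.+-assoc (δ u) (δ v) (zeros U))) z<)))

  -- The numerical hypothesis forces every move to lower the fixed dimension by exactly 1. Undoing
  -- the moves one at a time therefore gives raising steps, along which condition (2) is inherited.
  NullSubsetsSplit-act : ∀ {p} (p∣m : p ∣ m) ts x → length ts + fixedDim (act ts x) ≤ fixedDim x →
    NullSubsetsSplit p∣m (cycleWeights (act ts x)) → NullSubsetsSplit p∣m (cycleWeights x)
  NullSubsetsSplit-act p∣m []       x _  splits = splits
  NullSubsetsSplit-act p∣m (t ∷ ts) x z≤ splits =
    NullSubsetsSplit-act p∣m ts x
      (ℕ.≤-trans (ℕ.+-monoʳ-≤ (length ts) fixedDim-y)
        (ℕ.≤-trans (ℕ.≤-reflexive (ℕ.+-suc (length ts) (fixedDim (⟦ t ⟧ ∙ y)))) z≤)) splits′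
    where
    y : G m n
    y = act ts x
    back : Step 1 (cycleWeights (⟦ t ⟧ ∙ y)) (cycleWeights y)
    back = back-step t y
    fixedDim-y : fixedDim y ≤ suc (fixedDim (⟦ t ⟧ ∙ y))
    fixedDim-y = zeros-step (move-step 1 t (null-1 t) y)
    -- The moves of `ts` lower the fixed dimension by at most their number, so the last unit has to
    -- come from `t`.
    z< : fixedDim (⟦ t ⟧ ∙ y) < fixedDim y
    z< = ℕ.+-cancelˡ-≤ (length ts) _ _ (ℕ.≤-trans (ℕ.≤-reflexive (ℕ.+-suc (length ts) _)) (ℕ.≤-trans z≤ (fixedDim-act ts x)))
    splits′ : NullSubsetsSplit p∣m (cycleWeights y)
    splits′ with U , T , σ , τ ← raising-step back z< =
      NullSubsetsSplit-step p∣m {U} {T} (λ ρ → splits (↭-trans σ ρ)) τ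

module _ {m n p : ℕ} .{{_ : NonZero m}} (p∣m : p ∣ m) where

  Step-sum-null : ∀ {V W : List (ZMod m)} → Step p V W → sumₘ V ≡0[mod p ] → sumₘ W ≡0[mod p ]
  Step-sum-null (join {u} {v} {U} σ τ) V-null =
    subst (_≡0[mod p ]) (trans (sumₘ-↭ σ) (trans (sym (⊕-assoc u v (sumₘ U))) (sym (sumₘ-↭ τ)))) V-null
  Step-sum-null (cut {u} {v} {U} σ τ) V-null =
    subst (_≡0[mod p ]) (trans (sumₘ-↭ σ) (trans (⊕-assoc u v (sumₘ U)) (sym (sumₘ-↭ τ)))) V-null
  Step-sum-null {V} {W} (twist {u} {a} {U} a-null σ τ) V-null =
    subst (_≡0[mod p ]) eq (⊕-null p∣m a-null V-null)
    where
    eq : a ⊕ sumₘ V ≡ sumₘ W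
    eq = trans (cong (a ⊕_) (sumₘ-↭ σ))
      (trans (sym (⊕-assoc a u (sumₘ U))) (trans (cong (_⊕ sumₘ U) (⊕-comm a u)) (sym (sumₘ-↭ τ))))

  wt-∙ : ∀ (x y : G m n) → wt (x ∙ y) ≡ wt y ⊕ wt x
  wt-∙ x y = trans (sum-⊕ (allFin n)) (cong (wt y ⊕_)
    (trans (cong sumₘ (map-∘ (allFin n))) (sumₘ-↭ (map⁺ (weights x) permuted))))
    where
    v : Fin n → Fin n
    v = perm y ⟨$⟩ʳ_
    sum-⊕ : ∀ is → sumₘ (map (λ i → weights y i ⊕ weights x (v i)) is) ≡
                   sumₘ (map (weights y) is) ⊕ sumₘ (map (weights x ∘ v) is)
    sum-⊕ []       = sym (⊕-identityˡ 0ₘ)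
    sum-⊕ (i ∷ is) = trans (cong ((weights y i ⊕ weights x (v i)) ⊕_) (sum-⊕ is))
      (⊕-medial (weights y i) (weights x (v i)) (sumₘ (map (weights y) is)) (sumₘ (map (weights x ∘ v) is)))
    permuted : map v (allFin n) ↭ allFin n
    permuted = unique-↭ (Unique.map⁺ (perm-injective (perm y)) (Unique.allFin⁺ n)) (Unique.allFin⁺ n)
      (λ {z} _ → ∈-allFin z)
      (λ {z} _ → subst (_∈ map v (allFin n)) (Perm.inverseʳ (perm y))
        (∈-map⁺ v (∈-allFin (perm y ⟨$⟩ˡ z))))

  wt-≃ : ∀ {g h : G m n} → g ≃ h → wt g ≡ wt h
  wt-≃ (≃-intro (_ , weights≡)) = cong sumₘ (map-cong weights≡ (allFin n))

  cycleWeights-null : ∀ (g : G m n) → g ∈G⟨ p ⟩ → sumₘ (cycleWeights g) ≡0[mod p ]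
  cycleWeights-null g = subst (_≡0[mod p ]) (sym (wt-cycleWeights g))

  wt-ε : wt {m} {n} ε ≡ 0ₘ
  wt-ε = sum-0 (allFin n)
    where
    sum-0 : ∀ (is : List (Fin n)) → sumₘ (map (λ _ → 0ₘ) is) ≡ 0ₘ
    sum-0 []       = refl
    sum-0 (i ∷ is) = trans (⊕-identityˡ _) (sum-0 is)

  ε-null : ε {m} {n} ∈G⟨ p ⟩
  ε-null = subst (_≡0[mod p ]) (sym wt-ε) (0-null p∣m)

  NullMove⇒null : ∀ (t : Move {m} {n}) → NullMove p t → ⟦ t ⟧ ∈G⟨ p ⟩
  NullMove⇒null t t-null = subst (_≡0[mod p ]) (trans (wt-cycleWeights (⟦ t ⟧ ∙ ε)) (wt-≃ {⟦ t ⟧ ∙ ε} {⟦ t ⟧} (≃.identityʳ ⟦ t ⟧)))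
    (Step-sum-null {cycleWeights {n = n} ε} (move-step p t t-null ε) (cycleWeights-null ε ε-null))

  -- For a scaling the total weight is computed from its effect on the cycles of ε, whose weights
  -- sum to 0; what remains is `a`.
  null⇒NullMove : ∀ (t : Move {m} {n}) → ⟦ t ⟧ ∈G⟨ p ⟩ → NullMove p t
  null⇒NullMove (exchange _ _ _ _) _    = tt
  null⇒NullMove t@(scale i a a≢0)  null = subst (_≡0[mod p ]) wt-t null
    where
    open ≡-Reasoning
    headed = headed-by (proj₂ (decomposition ε)) i
    D = proj₁ (proj₂ headed)
    dec : Decomposition (ε {m} {n}) ((i , proj₁ headed) ∷ D)
    dec = proj₂ (proj₂ headed)
    scaled = scale-cycle {g = ε} a≢0 dec
    s r : ZMod m
    s = cycleWeight ε (i , proj₁ headed)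
    r = sumₘ (map (cycleWeight ε) D)
    wt-t : wt ⟦ t ⟧ ≡ a
    wt-t = begin
      wt ⟦ t ⟧                                     ≡⟨ wt-≃ (≃.identityʳ ⟦ t ⟧) ⟨
      wt (⟦ t ⟧ ∙ ε)                               ≡⟨ sum-cycleWeights (proj₁ scaled) ⟨
      sumₘ (cycleWeights (⟦ t ⟧ ∙ ε))              ≡⟨ sumₘ-↭ (cycleWeights-↭ (proj₁ scaled)) ⟩
      sumₘ (map (cycleWeight (⟦ t ⟧ ∙ ε)) ((i , proj₁ headed) ∷ D))   ≡⟨ cong sumₘ (proj₂ scaled) ⟩
      (s ⊕ a) ⊕ r                                  ≡⟨ cong (_⊕ r) (⊕-comm s a) ⟩
      (a ⊕ s) ⊕ r                                  ≡⟨ ⊕-assoc a s r ⟩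
      a ⊕ (s ⊕ r)                                  ≡⟨ cong (a ⊕_) (sumₘ-↭ (cycleWeights-↭ dec)) ⟨
      a ⊕ sumₘ (cycleWeights {n = n} ε)            ≡⟨ cong (a ⊕_) (trans (sum-cycleWeights dec) wt-ε) ⟩
      a ⊕ 0ₘ                                       ≡⟨ ⊕-identityʳ a ⟩
      a                                            ∎

-- Factorizations into moves and the length formula

module _ {m n : ℕ} .{{_ : NonZero m}} where

  move≄ε : ∀ (t : Move {m} {n}) → ¬ ⟦ t ⟧ ≃ ε
  move≄ε (exchange i j i≢j a) (≃-intro (perm≡ , _)) = i≢j (trans (sym (perm≡ i)) (transpose-left i j))
  move≄ε (scale i a a≢0) (≃-intro (_ , weights≡))   = a≢0 (trans (sym (updateAt-updates i (λ _ → 0ₘ))) (weights≡ i))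

  fixedDim-ε : fixedDim {m} {n} ε ≡ n
  fixedDim-ε = zeros-ε {m} {n}

  fixedDim≡n⇒≃ε : ∀ (g : G m n) → n ≤ fixedDim g → g ≃ ε
  fixedDim≡n⇒≃ε g n≤ = ≃-intro (zeros≡n⇒ε g n≤)

  -- One move lowers the fixed dimension by at most 1, and only the identity, which no move equals,
  -- has fixed dimension n.
  fixedDim-move : ∀ (t : Move {m} {n}) → fixedDim ⟦ t ⟧ + 1 ≡ n
  fixedDim-move t = ℕ.≤-antisym
    (ℕ.≤-trans (ℕ.≤-reflexive (ℕ.+-comm (fixedDim ⟦ t ⟧) 1))
      (ℕ.≤∧≢⇒< (fixedDim≤n ⟦ t ⟧) (λ ≡n → move≄ε t (fixedDim≡n⇒≃ε ⟦ t ⟧ (ℕ.≤-reflexive (sym ≡n))))))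
    (begin
      n                               ≡⟨ fixedDim-ε ⟨
      fixedDim {m} {n} ε                      ≤⟨ fixedDim-act (t ∷ []) ε ⟩
      1 + fixedDim (⟦ t ⟧ ∙ ε)        ≡⟨ cong suc (fixedDim-≃ {g = ⟦ t ⟧ ∙ ε} (≃.identityʳ ⟦ t ⟧)) ⟩
      1 + fixedDim ⟦ t ⟧              ≡⟨ ℕ.+-comm 1 (fixedDim ⟦ t ⟧) ⟩
      fixedDim ⟦ t ⟧ + 1              ∎)
    where open ℕ.≤-Reasoning

  -- For p = 1 all moves are allowed, so `Factors 1` concerns factorizations in G(m,1,n).
  Factors : ℕ → G m n → ℕ → Set
  Factors p g j = ∃[ ts ] All (NullMove p) ts × length ts ≡ j × act ts ε ≃ g

  Factors-≃ : ∀ {p g h j} → g ≃ h → Factors p g j → Factors p h j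
  Factors-≃ e (ts , nulls , length≡ , f) = ts , nulls , length≡ , ≃.trans f e

  single-factor : ∀ {p g} → Factors p g 1 → ∃[ t ] ⟦ t ⟧ ≃ g
  single-factor (t ∷ [] , _ , _ , e) = t , ≃.trans (≃.sym (≃.identityʳ ⟦ t ⟧)) e

  Factors-move : ∀ {p t g j} → NullMove p t → Factors p g j → Factors p (⟦ t ⟧ ∙ g) (suc j)
  Factors-move {t = t} t-null (ts , nulls , length≡ , e) =
    t ∷ ts , t-null ∷ nulls , cong suc length≡ , ∙-congˡ ⟦ t ⟧ e

  Factors-unmove : ∀ {p} → p ∣ m → ∀ t g {j} → NullMove p t → Factors p (⟦ t ⟧ ∙ g) j → Factors p g (suc j)
  Factors-unmove p∣m t g t-null fs =
    Factors-≃ (inverse-cancel t g) (Factors-move {t = inverse t} (inverse-null p∣m t t-null) fs)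

  Factors-∙ : ∀ {p g h i j} → Factors p g i → Factors p h j → Factors p (g ∙ h) (i + j)
  Factors-∙ {g = g} {h} (ts , ts-null , refl , e) (ss , ss-null , refl , f) =
    ts ++ ss , All-++⁺ ts-null ss-null , length-++ ts , (begin
      act (ts ++ ss) ε           ≡⟨ act-++ ts ss ε ⟩
      act ts (act ss ε)          ≈⟨ act-ε-∙ ts (act ss ε) ⟨
      act ts ε ∙ act ss ε        ≈⟨ ∙-congʳ (act ss ε) e ⟩
      g ∙ act ss ε               ≈⟨ ∙-congˡ g f ⟩
      g ∙ h                      ∎)
    where
    open SetoidReasoning ≃.setoid

  Factors⇒fixedDim : ∀ {p g j} → Factors p g j → n ≤ j + fixedDim g
  Factors⇒fixedDim {g = g} (ts , _ , refl , e) = begin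
    n                                  ≡⟨ fixedDim-ε ⟨
    fixedDim {m} {n} ε                         ≤⟨ fixedDim-act ts ε ⟩
    length ts + fixedDim (act ts ε)    ≡⟨ cong (length ts +_) (fixedDim-≃ e) ⟩
    length ts + fixedDim g             ∎
    where open ℕ.≤-Reasoning

  module _ {p : ℕ} (p∣m : p ∣ m) where

    zeros⇒Split : ∀ {V : List (ZMod m)} → All (_≡ 0ₘ) V → Split p V
    zeros⇒Split []           = []
    zeros⇒Split (refl ∷ ≡0s) = single (0-null p∣m) (zeros⇒Split ≡0s) ↭-refl

    -- At the identity there are n zero weights, and as singletons they have index 2n, so n + |W| -
    -- k starts at 0. By `step-partition` it grows by at most 1 with each factor.
    Factors⇒partition : ∀ {g j} → Factors p g j →
      ∃[ k ] NullPartition p (cycleWeights g) k × n + length (cycleWeights g) ≤ j + k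
    Factors⇒partition {g} (ts , nulls , refl , e) =
      let k , P , ≤k = from-act ts nulls in
      k , NullPartition-↭ (cycleWeights-≃ e) P ,
      ℕ.≤-trans (ℕ.≤-reflexive (cong (n +_) (↭-length (cycleWeights-≃ (≃.sym e))))) ≤k
      where
      from-act : ∀ ts → All (NullMove p) ts →
        ∃[ k ] NullPartition p (cycleWeights (act ts ε)) k × n + length (cycleWeights (act ts ε)) ≤ length ts + k
      from-act [] [] = value W₀ , Split⇒partition p∣m (zeros⇒Split (all-zero W₀ length≤zeros)) ,
        ℕ.≤-reflexive (trans (ℕ.+-comm n (length W₀)) (cong (length W₀ +_) (sym fixedDim-ε)))
        where
        W₀ : List (ZMod m)
        W₀ = cycleWeights {n = n} ε
        length≤zeros : length W₀ ≤ zeros W₀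
        length≤zeros = ℕ.≤-trans (length-cycleWeights≤n {m} {n} ε) (ℕ.≤-reflexive (sym fixedDim-ε))
      from-act (t ∷ ts) (t-null ∷ nulls) =
        let k , P , ≤k = from-act ts nulls
            j , Q , ≤j = step-partition p∣m (move-step p t t-null (act ts ε)) P
        in j , Q , bound {length (cycleWeights (act ts ε))} ≤k ≤j
        where
        bound : ∀ {w w′ k j} → n + w ≤ length ts + k → k + w′ ≤ suc j + w → n + w′ ≤ suc (length ts) + j
        bound {w} {w′} {k} {j} ≤k ≤j = ℕ.+-cancelʳ-≤ w _ _ (begin
          n + w′ + w                   ≡⟨ swap-last n w′ w ⟩
          n + w + w′                   ≤⟨ ℕ.+-monoˡ-≤ w′ ≤k ⟩
          length ts + k + w′           ≡⟨ ℕ.+-assoc (length ts) k w′ ⟩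
          length ts + (k + w′)         ≤⟨ ℕ.+-monoʳ-≤ (length ts) ≤j ⟩
          length ts + (suc j + w)      ≡⟨ regroup (length ts) j w ⟩
          suc (length ts) + j + w      ∎)
          where
          open ℕ.≤-Reasoning
          swap-last : ∀ a b c → a + b + c ≡ a + c + b
          swap-last = solve-∀
          regroup : ∀ l j w → l + (suc j + w) ≡ suc l + j + w
          regroup = solve-∀

    -- The length formula j = n + |W| - k, with the subtraction cleared.
    Factorization : G m n → ℕ → Set
    Factorization g k = ∃[ j ] Factors p g j × j + k ≡ n + length (cycleWeights g)

    -- Here `l` is the number of weights that the move removes: 1 for a merge, 0 for a scaling.
    Factorization-unmove : ∀ t g {k l} → NullMove p t → length (cycleWeights g) ≡ l + length (cycleWeights (⟦ t ⟧ ∙ g)) →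
      ∀ {k′} → suc k′ ≡ l + k → Factorization (⟦ t ⟧ ∙ g) k → Factorization g k′
    Factorization-unmove t g {k} {l} t-null length≡ {k′} k≡ (j , fs , eq) =
      suc j , Factors-unmove p∣m t g t-null fs , (begin
        suc j + k′          ≡⟨ ℕ.+-suc j k′ ⟨
        j + suc k′          ≡⟨ cong (j +_) k≡ ⟩
        j + (l + k)         ≡⟨ left-comm j l k ⟩
        l + (j + k)         ≡⟨ cong (l +_) eq ⟩
        l + (n + length (cycleWeights (⟦ t ⟧ ∙ g)))  ≡⟨ left-comm l n _ ⟩
        n + (l + length (cycleWeights (⟦ t ⟧ ∙ g)))  ≡⟨ cong (n +_) length≡ ⟨
        n + length (cycleWeights g)  ∎)
      where
      open ≡-Reasoning
      left-comm : ∀ a b c → a + (b + c) ≡ b + (a + c)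
      left-comm = solve-∀

    all-zero-factorization : ∀ d g {r} → d + r ≡ n → cycleWeights g ↭ replicate r 0ₘ → Factors p g d
    all-zero-factorization d g {r} d+r≡n σ with length (cycleWeights g) ℕ.≟ n
    all-zero-factorization zero g {r} refl σ | yes _ = [] , [] , refl , ≃.sym (fixedDim≡n⇒≃ε g (ℕ.≤-reflexive (begin
      r                            ≡⟨ zeros-replicate r ⟨
      zeros (replicate r 0ₘ)       ≡⟨ zeros-↭ σ ⟨
      fixedDim g                   ∎)))
      where
      open ≡-Reasoning
      zeros-replicate : ∀ r → zeros (replicate r 0ₘ) ≡ r
      zeros-replicate zero    = refl
      zeros-replicate (suc r) = cong₂ _+_ δ-0ₘ (zeros-replicate r)
    all-zero-factorization (suc d) g {r} d+r≡n σ | yes length≡n =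
      contradiction (sym (trans d+r≡n (trans (sym length≡n) (trans (↭-length σ) (length-replicate r))))) (ℕ.m≢1+n+m r)
    all-zero-factorization zero g {r} d+r≡n σ | no length≢n =
      contradiction (trans (↭-length σ) (trans (length-replicate r) d+r≡n)) length≢n
    all-zero-factorization (suc d) g {r} d+r≡n σ | no length≢n =
      let i , j , i≢j , a , τ = cut-move g length≢n
          t = exchange i j i≢j a
      in Factors-unmove p∣m t g tt
           (all-zero-factorization d (⟦ t ⟧ ∙ g) {suc r} (trans (ℕ.+-suc d r) d+r≡n) (↭-trans τ (↭-prep 0ₘ σ)))

    -- The `r` zeros are the blocks already contracted; each is a block of sum 0 and counts twice,
    -- whence `r + r`. When no block is left, n - r cuts finish.
    partition⇒Factors : ∀ {V k} → NullPartition p V k → ∀ r g → cycleWeights g ↭ replicate r 0ₘ ++ V →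
                        Factorization g (r + r + k)
    -- The members are merged into `u` one by one. The resulting sum joins the zeros, after one
    -- scaling if it is not 0; that scaling is a null move because the sum of the block is null.
    block⇒Factors : ∀ {V k} → NullPartition p V k → ∀ b {u} → u ⊕ sumₘ b ≡0[mod p ] → ∀ r g →
                    cycleWeights g ↭ u ∷ b ++ replicate r 0ₘ ++ V →
                    Factorization g (r + r + suc (δ (u ⊕ sumₘ b) + k))

    partition⇒Factors [] r g σ =
      n ℕ.∸ r , all-zero-factorization (n ℕ.∸ r) g {r} (ℕ.m∸n+n≡m r≤n) σ′ , (begin
        n ℕ.∸ r + (r + r + 0)          ≡⟨ regroup (n ℕ.∸ r) r ⟩
        n ℕ.∸ r + r + r                ≡⟨ cong (_+ r) (ℕ.m∸n+n≡m r≤n) ⟩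
        n + r                          ≡⟨ cong (n +_) length≡r ⟨
        n + length (cycleWeights g)    ∎)
      where
      open ≡-Reasoning
      σ′ : cycleWeights g ↭ replicate r 0ₘ
      σ′ = ↭-trans σ (↭-reflexive (++-identityʳ (replicate r 0ₘ)))
      length≡r : length (cycleWeights g) ≡ r
      length≡r = trans (↭-length σ′) (length-replicate r)
      r≤n : r ≤ n
      r≤n = subst (_≤ n) length≡r (length-cycleWeights≤n g)
      regroup : ∀ d r → d + (r + r + 0) ≡ d + r + r
      regroup = solve-∀
    partition⇒Factors (block {u} {b} {V} null P τ) r g σ =
      block⇒Factors P b null r g (↭-trans σ (↭-trans (++⁺ˡ (replicate r 0ₘ) τ) (shifts (replicate r 0ₘ) (u ∷ b))))

    block⇒Factors {V} {k} P (v ∷ b) {u} null r g σ =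
      let i , j , i≢j , τ = merge-move g σ
          t = exchange i j i≢j 0ₘ
      in Factorization-unmove t g {l = 1} tt (trans (↭-length σ) (cong suc (sym (↭-length τ))))
           (cong (λ s → suc (r + r + suc (δ s + k))) (sym (⊕-assoc u v (sumₘ b))))
           (block⇒Factors P b (subst (_≡0[mod p ]) (sym (⊕-assoc u v (sumₘ b))) null) r (⟦ t ⟧ ∙ g) τ)
    block⇒Factors {V} {k} P [] {u} null r g σ with u ≟ 0ₘ
    ... | yes refl = subst (Factorization g)
          (trans (regroup r k) (cong (λ d → r + r + suc (d + k)) (sym (trans (cong δ (⊕-identityʳ 0ₘ)) δ-0ₘ))))
          (partition⇒Factors P (suc r) g σ)
      where
      regroup : ∀ r k → suc r + suc r + k ≡ r + r + suc (1 + k)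
      regroup = solve-∀
    ... | no u≢0 =
      let i , τ = twist-move g ⊖u≢0 σ
          t = scale i (⊖ u) ⊖u≢0
      in Factorization-unmove t g {l = 0} (⊖-null p∣m u-null) (trans (↭-length σ) (sym (↭-length τ)))
           (trans (cong (λ d → suc (r + r + suc (d + k))) (trans (cong δ (⊕-identityʳ u)) (δ-≢0ₘ u≢0))) (regroup r k))
           (partition⇒Factors P (suc r) (⟦ t ⟧ ∙ g)
             (↭-trans τ (↭-reflexive (cong (_∷ replicate r 0ₘ ++ V) (⊕-inverseʳ u)))))
      where
      regroup : ∀ r k → suc (r + r + suc k) ≡ suc r + suc r + k
      regroup = solve-∀
      u-null : u ≡0[mod p ]
      u-null = subst (_≡0[mod p ]) (⊕-identityʳ u) null
      ⊖u≢0 : ⊖ u ≢ 0ₘ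
      ⊖u≢0 = ⊖-≢0 u≢0

    factorize : ∀ g {k} → NullPartition p (cycleWeights g) k → Factorization g k
    factorize g P = partition⇒Factors P 0 g ↭-refl

  -- For p = 1 the singletons form a null partition of index |W| + z, and the length formula becomes
  -- n - z.
  codim-factorize : ∀ (g : G m n) → ∃[ j ] Factors 1 g j × j + fixedDim g ≡ n
  codim-factorize g =
    let j , fs , eq = factorize (1∣ m) g (Split⇒partition (1∣ m) (all-singles W)) in
    j , fs , ℕ.+-cancelʳ-≡ (length W) (j + fixedDim g) n (trans (regroup j (zeros W) (length W)) eq)
    where
    W : List (ZMod m)
    W = cycleWeights g
    all-singles : ∀ V → Split 1 V
    all-singles []      = []
    all-singles (x ∷ V) = single (1∣ toℕ x) (all-singles V) ↭-refl
    regroup : ∀ j z l → j + z + l ≡ j + (l + z)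
    regroup = solve-∀

-- The two intervals

module _ {m n p : ℕ} .{{_ : NonZero m}} (p∣m : p ∣ m) where

  Length : G m n → ℕ → Set
  Length g k = Factors p g k × (∀ j → Factors p g j → k ≤ j)

  Codim : G m n → ℕ → Set
  Codim g k = fixedDim g + k ≡ n

  -- The order `_≤[_]_` for lengths and codimensions given by moves and zero weights, free of
  -- matrices.
  Below : (G m n → ℕ → Set) → G m n → G m n → Set
  Below f x w = ∃[ i ] ∃[ j ] ∃[ k ] f x i × f (x ⁻¹ ∙ w) j × f w k × i + j ≡ k

  Length-unique : ∀ {g j k} → Length g j → Length g k → j ≡ k
  Length-unique (fs , min) (fs′ , min′) = ℕ.≤-antisym (min _ fs′) (min′ _ fs)

  Length-≃ : ∀ {g h k} → g ≃ h → Length g k → Length h k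
  Length-≃ e (fs , min) = Factors-≃ e fs , λ j fs′ → min j (Factors-≃ (≃.sym e) fs′)

  codim-exists : ∀ g → ∃[ k ] Codim g k
  codim-exists g = n ℕ.∸ fixedDim g , ℕ.m+[n∸m]≡n (fixedDim≤n g)

  Codim-≃ : ∀ {g h k} → g ≃ h → Codim g k → Codim h k
  Codim-≃ e g+k≡n = trans (cong (_+ _) (fixedDim-≃ (≃.sym e))) g+k≡n

  Codim-unique : ∀ {g j k} → Codim g j → Codim g k → j ≡ k
  Codim-unique {g} g+j≡n g+k≡n = ℕ.+-cancelˡ-≡ (fixedDim g) _ _ (trans g+j≡n (sym g+k≡n))

  Codim≤Factors : ∀ {q g j k} → Codim g k → Factors q g j → k ≤ j
  Codim≤Factors {q} {g} {j} {k} g+k≡n fs = ℕ.+-cancelˡ-≤ (fixedDim g) k j (begin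
    fixedDim g + k    ≡⟨ g+k≡n ⟩
    n                 ≤⟨ Factors⇒fixedDim fs ⟩
    j + fixedDim g    ≡⟨ ℕ.+-comm j (fixedDim g) ⟩
    fixedDim g + j    ∎)
    where open ℕ.≤-Reasoning

  Codim⇒Factors : ∀ {g k} → Codim g k → Factors 1 g k
  Codim⇒Factors {g} {k} g+k≡n =
    let j , fs , j+g≡n = codim-factorize g in
    subst (Factors 1 g) (Codim-unique {g} (trans (ℕ.+-comm (fixedDim g) j) j+g≡n) g+k≡n) fs

  left-divide : ∀ (x w : G m n) → x ∙ (x ⁻¹ ∙ w) ≃ w
  left-divide x w = begin
    x ∙ (x ⁻¹ ∙ w)    ≈⟨ ≃.assoc x (x ⁻¹) w ⟨
    (x ∙ x ⁻¹) ∙ w    ≈⟨ ∙-congʳ w (≃.inverseʳ x) ⟩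
    ε ∙ w             ≈⟨ ≃.identityˡ w ⟩
    w                 ∎
    where open SetoidReasoning ≃.setoid

  divide-left : ∀ (x y w : G m n) → w ≃ x ∙ y → x ⁻¹ ∙ w ≃ y
  divide-left x y w e = begin
    x ⁻¹ ∙ w          ≈⟨ ∙-congˡ (x ⁻¹) e ⟩
    x ⁻¹ ∙ (x ∙ y)    ≈⟨ ≃.assoc (x ⁻¹) x y ⟨
    (x ⁻¹ ∙ x) ∙ y    ≈⟨ ∙-congʳ y (≃.inverseˡ x) ⟩
    ε ∙ y             ≈⟨ ≃.identityˡ y ⟩
    y                 ∎
    where open SetoidReasoning ≃.setoid

  -- Shortest factorizations of x and x⁻¹w in G(m,1,n) concatenate to a factorization of w.
  Codim-subadditive : ∀ x w {i j k} → Codim x i → Codim (x ⁻¹ ∙ w) j → Codim w k → k ≤ i + j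
  Codim-subadditive x w x-i y-j w-k =
    Codim≤Factors {1} {w} w-k
      (Factors-≃ (left-divide x w) (Factors-∙ {g = x} {x ⁻¹ ∙ w} (Codim⇒Factors {x} x-i) (Codim⇒Factors {x ⁻¹ ∙ w} y-j)))

  -- A split gives a partition whose index is `value`, so the length formula yields a factorization
  -- of length n - z; no factorization is shorter than the codimension.
  Split⇒length≡codim : ∀ {g} → Split p (cycleWeights g) → ∃[ k ] Length g k × Codim g k
  Split⇒length≡codim {g} s =
    let j , fs , eq = factorize p∣m g (Split⇒partition p∣m s)
        j-codim : Codim g j
        j-codim = ℕ.+-cancelʳ-≡ (length (cycleWeights g)) (fixedDim g + j) n
                    (trans (regroup (fixedDim g) j (length (cycleWeights g))) eq)
    in j , (fs , λ i fs′ → Codim≤Factors {p} {g} j-codim fs′) , j-codim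
    where
    regroup : ∀ z j l → z + j + l ≡ j + (l + z)
    regroup = solve-∀

  length≡codim⇒Split : ∀ {g k} → Length g k → Codim g k → Split p (cycleWeights g)
  length≡codim⇒Split {g} {k} (fs , _) g+k≡n =
    let K , P , n+l≤k+K = Factors⇒partition p∣m fs in
    tight⇒Split P (ℕ.+-cancelˡ-≤ k _ _ (ℕ.≤-trans (ℕ.≤-reflexive (begin
      k + (l + fixedDim g)      ≡⟨ regroup k l (fixedDim g) ⟩
      (fixedDim g + k) + l      ≡⟨ cong (_+ l) g+k≡n ⟩
      n + l                     ∎)) n+l≤k+K))
    where
    open ≡-Reasoning
    l : ℕ
    l = length (cycleWeights g)
    regroup : ∀ k l z → k + (l + z) ≡ (z + k) + l
    regroup = solve-∀

  -- Apply the condition to all the weights at once; their sum is the total weight of g, which is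
  -- null.
  NullSubsetsSplit⇒Split : ∀ {g : G m n} → NullSubsetsSplit p∣m (cycleWeights g) → g ∈G⟨ p ⟩ → Split p (cycleWeights g)
  NullSubsetsSplit⇒Split {g} splits g-null =
    splits {T = []} (↭-reflexive (sym (++-identityʳ (cycleWeights g)))) (cycleWeights-null p∣m g g-null)

  NullSubsetsSplit-≃ : ∀ {g h : G m n} → g ≃ h → NullSubsetsSplit p∣m (cycleWeights g) → NullSubsetsSplit p∣m (cycleWeights h)
  NullSubsetsSplit-≃ e splits σ = splits (↭-trans (cycleWeights-≃ e) σ)

  cofactor-null : ∀ (x w : G m n) → x ∈G⟨ p ⟩ → w ∈G⟨ p ⟩ → (x ⁻¹ ∙ w) ∈G⟨ p ⟩
  cofactor-null x w x-null w-null =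
    ⊕-nullˡ p∣m x-null (subst (_≡0[mod p ]) (trans (sym (wt-≃ p∣m (left-divide x w))) (wt-∙ p∣m x (x ⁻¹ ∙ w))) w-null)

  -- Each nonzero weight of T is scaled to 0, so the number of moves is |T| minus the zeros of T;
  -- `r` counts the zeros already in place.
  kill-weights : ∀ (S T : List (ZMod m)) r (g : G m n) → cycleWeights g ↭ replicate r 0ₘ ++ T ++ S →
    ∃[ ts ] ∃[ y ] g ≃ act ts y × cycleWeights y ↭ replicate (length T + r) 0ₘ ++ S × length ts + zeros T ≡ length T
  kill-weights S []      r g σ = [] , g , ≃.refl {x = g} , σ , refl
  kill-weights S (x ∷ T) r g σ with x ≟ 0ₘ
  ... | yes refl =
    let ts , y , e , τ , eq = kill-weights S T (suc r) g
          (↭-trans σ (shift 0ₘ (replicate r 0ₘ) (T ++ S)))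
    in ts , y , e , subst (λ a → cycleWeights y ↭ replicate a 0ₘ ++ S) (ℕ.+-suc (length T) r) τ ,
       trans (ℕ.+-suc (length ts) (zeros T)) (cong suc eq)
  ... | no x≢0 =
    let ⊖x≢0 = ⊖-≢0 x≢0
        i , σ′ = twist-move g ⊖x≢0 (↭-trans σ (shift x (replicate r 0ₘ) (T ++ S)))
        t = scale i (⊖ x) ⊖x≢0
        ts , y , e , τ , eq = kill-weights S T (suc r) (⟦ t ⟧ ∙ g)
          (↭-trans σ′ (↭-reflexive (cong (_∷ replicate r 0ₘ ++ T ++ S) (⊕-inverseʳ x))))
    in inverse t ∷ ts , y , ≃.trans (≃.sym (inverse-cancel t g)) (∙-congˡ ⟦ inverse t ⟧ e) ,
       subst (λ a → cycleWeights y ↭ replicate a 0ₘ ++ S) (ℕ.+-suc (length T) r) τ , cong suc eq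

  module _ {w : G m n} (w-null : w ∈G⟨ p ⟩) where

    -- Condition (2) passes from w to x and to x⁻¹w. All three elements then split, and their
    -- lengths agree with their codimensions.
    codim-interval⊆ : NullSubsetsSplit p∣m (cycleWeights w) → ∀ {x} → x ∈G⟨ p ⟩ → Below Codim x w → Below Length x w
    codim-interval⊆ splits {x} x-null (i , j , k , x-i , y-j , w-k , i+j≡k) =
      i , j , k , length-of {x} x-null x-splits x-i , length-of {y} (cofactor-null x w x-null w-null) y-splits y-j ,
      length-of {w} w-null splits w-k , i+j≡k
      where
      y : G m n
      y = x ⁻¹ ∙ w
      length-of : ∀ {g k} → g ∈G⟨ p ⟩ → NullSubsetsSplit p∣m (cycleWeights g) → Codim g k → Length g k
      length-of {g} g-null g-splits g-k =
        let k′ , g-length , g-k′ = Split⇒length≡codim {g} (NullSubsetsSplit⇒Split {g} g-splits g-null) in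
        subst (Length g) (Codim-unique {g} g-k′ g-k) g-length
      -- The codimensions add up, so passing from `h` to w loses exactly `length ts` fixed
      -- dimensions, as `NullSubsetsSplit-act` requires.
      inherit : ∀ h ts {l} → w ≃ act ts h → length ts + l ≡ k → Codim h l → NullSubsetsSplit p∣m (cycleWeights h)
      inherit h ts {l} e ts+l≡k h-l = NullSubsetsSplit-act p∣m ts h
        (ℕ.+-cancelʳ-≤ l _ _ (ℕ.≤-reflexive (begin
          length ts + fixedDim (act ts h) + l    ≡⟨ cong (λ z → length ts + z + l) (fixedDim-≃ e) ⟨
          length ts + fixedDim w + l             ≡⟨ regroup (length ts) (fixedDim w) l ⟩
          fixedDim w + (length ts + l)           ≡⟨ cong (fixedDim w +_) ts+l≡k ⟩
          fixedDim w + k                         ≡⟨ trans w-k (sym h-l) ⟩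
          fixedDim h + l                         ∎)))
        (NullSubsetsSplit-≃ e splits)
        where
        open ≡-Reasoning
        regroup : ∀ a b c → a + b + c ≡ b + (a + c)
        regroup = solve-∀
      y-splits : NullSubsetsSplit p∣m (cycleWeights y)
      y-splits with ts , _ , refl , e ← Codim⇒Factors {x} x-i = inherit y ts w≃ i+j≡k y-j
        where
        open SetoidReasoning ≃.setoid
        w≃ : w ≃ act ts y
        w≃ = begin
          w               ≈⟨ left-divide x w ⟨
          x ∙ y           ≈⟨ ∙-congʳ y e ⟨
          act ts ε ∙ y    ≈⟨ act-ε-∙ ts y ⟩
          act ts y        ∎
      -- The factors of y stand to the right of x and are first conjugated to its left.
      x-splits : NullSubsetsSplit p∣m (cycleWeights x)
      x-splits with ss , _ , refl , e ← Codim⇒Factors {y} y-j with ts , length≡ , f ← move-right-factors x ss =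
        inherit x ts w≃ (trans (cong (_+ i) length≡) (trans (ℕ.+-comm (length ss) i) i+j≡k)) x-i
        where
        open SetoidReasoning ≃.setoid
        w≃ : w ≃ act ts x
        w≃ = begin
          w               ≈⟨ left-divide x w ⟨
          x ∙ y           ≈⟨ ∙-congˡ x e ⟨
          x ∙ act ss ε    ≈⟨ f ⟩
          act ts x        ∎

    -- Length is at least codimension on both x and x⁻¹w, while i + j = codim w is at most the sum
    -- of their codimensions. The squeeze gives equality in each.
    length-interval⊆ : ∀ {l} → Length w l → Codim w l → ∀ {x} → Below Length x w →
      ∃[ i ] ∃[ j ] Length x i × Codim x i × Length (x ⁻¹ ∙ w) j × Codim (x ⁻¹ ∙ w) j × i + j ≡ l
    length-interval⊆ {l} w-length w-l {x} (i , j , k , x-i , y-j , w-k , i+j≡k)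
      with a , x-a ← codim-exists x | b , y-b ← codim-exists (x ⁻¹ ∙ w) =
      a , b , subst (Length x) (sym a≡i) x-i , x-a , subst (Length (x ⁻¹ ∙ w)) (sym b≡j) y-j , y-b ,
      trans (cong₂ _+_ a≡i b≡j) i+j≡l
      where
      i+j≡l : i + j ≡ l
      i+j≡l = trans i+j≡k (Length-unique {w} w-k w-length)
      a≤i : a ≤ i
      a≤i = Codim≤Factors {p} {x} x-a (proj₁ x-i)
      b≤j : b ≤ j
      b≤j = Codim≤Factors {p} {x ⁻¹ ∙ w} y-b (proj₁ y-j)
      i+j≤a+b : i + j ≤ a + b
      i+j≤a+b = ℕ.≤-trans (ℕ.≤-reflexive i+j≡l) (Codim-subadditive x w x-a y-b w-l)
      a≡i : a ≡ i
      a≡i = ℕ.≤-antisym a≤i (ℕ.+-cancelʳ-≤ j i a (ℕ.≤-trans i+j≤a+b (ℕ.+-monoʳ-≤ a b≤j)))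
      b≡j : b ≡ j
      b≡j = ℕ.≤-antisym b≤j (ℕ.+-cancelˡ-≤ i j b (ℕ.≤-trans i+j≤a+b (ℕ.+-monoˡ-≤ b a≤i)))

    module _ (length⇒codim : ∀ {x} → x ∈G⟨ p ⟩ → Below Length x w → Below Codim x w)
             (codim⇒length : ∀ {x} → x ∈G⟨ p ⟩ → Below Codim x w → Below Length x w) where

      -- The element w lies below itself in the codimension order, the cofactor w⁻¹w being the
      -- identity of codimension 0. The assumed inclusion turns this into a statement that contains
      -- a length of w.
      length-exists : ∃[ k ] Length w k
      length-exists =
        let c , w-c = codim-exists w
            _ , _ , k , _ , _ , w-k , _ = codim⇒length {w} w-null
              (c , 0 , c , w-c , Codim-≃ (≃.sym (≃.inverseˡ w)) (trans (ℕ.+-identityʳ _) fixedDim-ε) , w-c , ℕ.+-identityʳ c)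
        in k , w-k

      -- Merging u and v keeps the index and removes one weight, so y has length k - 1 and the
      -- merging reflection lies below w for length. By assumption it lies below w for codimension
      -- too, so the merge gains exactly one zero, and only u ⊕ v can be it.
      merge-zero-sum : ∀ {k u v b K j} → Length w k → k + K ≡ n + length (cycleWeights w) →
        ∀ {V} → cycleWeights w ↭ u ∷ v ∷ b ++ V → u ⊕ (v ⊕ sumₘ b) ≡0[mod p ] → NullPartition p V j →
        K ≡ suc (δ (u ⊕ (v ⊕ sumₘ b)) + j) → u ⊕ v ≡ 0ₘ
      merge-zero-sum {k} {u} {v} {b} {K} w-k k+K≡ {V} σ null P refl
        with i , j , i≢j , τ ← merge-move w σ
        with l , l-factors , l+K≡ ← factorize p∣m (⟦ exchange i j i≢j 0ₘ ⟧ ∙ w)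
          (block (subst (_≡0[mod p ]) (sym (⊕-assoc u v (sumₘ b))) null) P τ) =
        u+v≡0
        where
        t : Move
        t = exchange i j i≢j 0ₘ
        r y : G m n
        r = ⟦ inverse t ⟧
        y = ⟦ t ⟧ ∙ w
        r⁻¹w≃y : r ⁻¹ ∙ w ≃ y
        r⁻¹w≃y = divide-left r y w (≃.sym (inverse-cancel t w))
        1+l≡k : suc l ≡ k
        1+l≡k = ℕ.+-cancelʳ-≡ K (suc l) k (begin
          suc (l + K)                                ≡⟨ cong (λ s → suc (l + suc (δ s + _))) (⊕-assoc u v (sumₘ b)) ⟨
          suc (l + suc (δ ((u ⊕ v) ⊕ sumₘ b) + _))   ≡⟨ cong suc l+K≡ ⟩
          suc (n + length (cycleWeights y))          ≡⟨ ℕ.+-suc n _ ⟨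
          n + suc (length (cycleWeights y))          ≡⟨ cong (λ a → n + suc a) (↭-length τ) ⟩
          n + length (u ∷ v ∷ b ++ V)                ≡⟨ cong (n +_) (↭-length σ) ⟨
          n + length (cycleWeights w)                ≡⟨ k+K≡ ⟨
          k + K                                      ∎)
          where open ≡-Reasoning
        -- A shorter factorization of y, extended by the inverse of t, would contradict the
        -- minimality of k.
        y-length : Length y l
        y-length = l-factors , λ a fs → s≤s⁻¹ (ℕ.≤-trans (ℕ.≤-reflexive 1+l≡k)
          (proj₂ w-k (suc a) (Factors-unmove p∣m t w tt fs)))
        r-length : Length r 1
        r-length = (inverse t ∷ [] , tt ∷ [] , refl , ≃.identityʳ r) ,
          λ a fs → Codim≤Factors {p} {r} (fixedDim-move (inverse t)) fs
        y-codim : ∃[ c ] Codim y c × Codim w (suc c)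
        y-codim =
          let a , c , e , r-a , y-c , w-e , a+c≡e = length⇒codim {r} (NullMove⇒null p∣m (inverse t) tt)
                (1 , l , k , r-length , Length-≃ (≃.sym r⁻¹w≃y) y-length , w-k , 1+l≡k)
          in c , Codim-≃ r⁻¹w≃y y-c ,
             subst (Codim w) (trans (sym a+c≡e) (cong (_+ c) (Codim-unique {r} r-a (fixedDim-move (inverse t))))) w-e
        fixedDim-y : fixedDim y ≡ suc (fixedDim w)
        fixedDim-y = let c , y-c , w-c = y-codim in
          ℕ.+-cancelʳ-≡ c _ _ (trans y-c (trans (sym w-c) (ℕ.+-suc (fixedDim w) c)))
        δ-eq : δ (u ⊕ v) ≡ suc (δ u + δ v)
        δ-eq = ℕ.+-cancelʳ-≡ (zeros (b ++ V)) _ _ (begin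
          δ (u ⊕ v) + zeros (b ++ V)              ≡⟨ zeros-↭ τ ⟨
          fixedDim y                              ≡⟨ fixedDim-y ⟩
          suc (fixedDim w)                        ≡⟨ cong suc (zeros-↭ σ) ⟩
          suc (δ u + (δ v + zeros (b ++ V)))      ≡⟨ cong suc (ℕ.+-assoc (δ u) (δ v) _) ⟨
          suc (δ u + δ v) + zeros (b ++ V)        ∎)
          where open ≡-Reasoning
        u+v≡0 : u ⊕ v ≡ 0ₘ
        u+v≡0 = δ≢0⇒≡0ₘ δ-eq

      partition⇒Split : ∀ {k K} → Length w k → NullPartition p (cycleWeights w) K →
                        n + length (cycleWeights w) ≤ k + K → Split p (cycleWeights w)
      partition⇒Split {k} {K} w-k P n+l≤k+K =
        zero-sum-merges⇒Split p∣m P optimal (λ σ null Q → merge-zero-sum w-k k+K≡ σ null Q)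
        where
        optimal : ∀ {j} → NullPartition p (cycleWeights w) j → j ≤ K
        optimal {j} Q with i , fs , i+j≡ ← factorize p∣m w Q = ℕ.+-cancelˡ-≤ i j K (begin
          i + j                          ≡⟨ i+j≡ ⟩
          n + length (cycleWeights w)    ≤⟨ n+l≤k+K ⟩
          k + K                          ≤⟨ ℕ.+-monoˡ-≤ K (proj₂ w-k i fs) ⟩
          i + K                          ∎)
          where open ℕ.≤-Reasoning
        k+K≡ : k + K ≡ n + length (cycleWeights w)
        k+K≡ with i , fs , i+K≡ ← factorize p∣m w P =
          ℕ.≤-antisym (ℕ.≤-trans (ℕ.+-monoˡ-≤ K (proj₂ w-k i fs)) (ℕ.≤-reflexive i+K≡)) n+l≤k+K

      interval⇒Split : Split p (cycleWeights w)
      interval⇒Split =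
        let k , w-k = length-exists
            K , P , n+l≤k+K = Factors⇒partition p∣m (proj₁ w-k)
        in partition⇒Split w-k P n+l≤k+K

      -- Killing the weights of T splits w as x y with codimensions that add up. So x lies below w
      -- for codimension, hence for length; then length and codimension of y agree, and its weights
      -- split.
      killed-complement-split : ∀ {S T k} → cycleWeights w ↭ S ++ T → sumₘ S ≡0[mod p ] → Length w k → Codim w k →
        ∀ ts y → w ≃ act ts y → cycleWeights y ↭ replicate (length T + 0) 0ₘ ++ S → length ts + zeros T ≡ length T →
        Split p (cycleWeights y)
      killed-complement-split {S} {T} {k} σ S-null w-length w-k ts y e τ ts+z≡T = y-split
        where
        R : ℕ
        R = length T + 0
        x : G m n
        x = act ts ε
        x⁻¹w≃y : x ⁻¹ ∙ w ≃ y
        x⁻¹w≃y = divide-left x y w (≃.trans e (≃.sym (act-ε-∙ ts y)))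
        sum-zeros : ∀ r → sumₘ (replicate r 0ₘ ++ S) ≡ sumₘ S
        sum-zeros zero    = refl
        sum-zeros (suc r) = trans (⊕-identityˡ _) (sum-zeros r)
        y-null : y ∈G⟨ p ⟩
        y-null = subst (_≡0[mod p ]) (trans (sym (trans (sumₘ-↭ τ) (sum-zeros R))) (wt-cycleWeights y)) S-null
        -- The scalings in `ts` need not be null one by one; their product is, because w and y both
        -- are.
        x-null : x ∈G⟨ p ⟩
        x-null = ⊕-nullʳ p∣m y-null (subst (_≡0[mod p ])
          (trans (wt-≃ p∣m (≃.trans e (≃.sym (act-ε-∙ ts y)))) (wt-∙ p∣m x y)) w-null)
        zeros-replicate : ∀ r → zeros (replicate r 0ₘ ++ S) ≡ r + zeros S
        zeros-replicate zero    = refl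
        zeros-replicate (suc r) = cong₂ _+_ δ-0ₘ (zeros-replicate r)
        zeros-++ : ∀ (A B : List (ZMod m)) → zeros (A ++ B) ≡ zeros A + zeros B
        zeros-++ []      B = refl
        zeros-++ (a ∷ A) B = trans (cong (δ a +_) (zeros-++ A B)) (sym (ℕ.+-assoc (δ a) (zeros A) (zeros B)))
        fixedDim-y : fixedDim y ≡ length ts + fixedDim w
        fixedDim-y = begin
          fixedDim y                             ≡⟨ zeros-↭ τ ⟩
          zeros (replicate R 0ₘ ++ S)            ≡⟨ zeros-replicate R ⟩
          length T + 0 + zeros S                 ≡⟨ cong (_+ zeros S) (trans (ℕ.+-identityʳ _) (sym ts+z≡T)) ⟩
          length ts + zeros T + zeros S          ≡⟨ regroup (length ts) (zeros T) (zeros S) ⟩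
          length ts + (zeros S + zeros T)        ≡⟨ cong (length ts +_) (trans (sym (zeros-++ S T)) (sym (zeros-↭ σ))) ⟩
          length ts + fixedDim w                 ∎
          where
          open ≡-Reasoning
          regroup : ∀ a b c → a + b + c ≡ a + (c + b)
          regroup = solve-∀
        -- The codimension of y is smaller than that of w by `length ts`. Subadditivity makes the
        -- codimension of x at least `length ts`, and the factorization `ts` makes it at most that.
        x-below : ∃[ a ] ∃[ b ] Codim x a × Codim (x ⁻¹ ∙ w) b × a + b ≡ k
        x-below =
          let a , x-a = codim-exists x
              b , y-b = codim-exists (x ⁻¹ ∙ w)
              ts+b≡k : length ts + b ≡ k
              ts+b≡k = ℕ.+-cancelˡ-≡ (fixedDim w) _ _ (begin
                fixedDim w + (length ts + b)     ≡⟨ regroup (fixedDim w) (length ts) b ⟩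
                length ts + fixedDim w + b       ≡⟨ cong (_+ b) fixedDim-y ⟨
                fixedDim y + b                   ≡⟨ Codim-≃ x⁻¹w≃y y-b ⟩
                n                                ≡⟨ w-k ⟨
                fixedDim w + k                   ∎)
              a≤ts : a ≤ length ts
              a≤ts = Codim≤Factors {1} {x} x-a (ts , All.universal null-1 ts , refl , ≃.refl {x = x})
              ts≤a : length ts ≤ a
              ts≤a = ℕ.+-cancelʳ-≤ b _ _ (ℕ.≤-trans (ℕ.≤-reflexive ts+b≡k) (Codim-subadditive x w x-a y-b w-k))
          in a , b , x-a , y-b , trans (cong (_+ b) (ℕ.≤-antisym a≤ts ts≤a)) ts+b≡k
          where
          open ≡-Reasoning
          regroup : ∀ z t b → z + (t + b) ≡ t + z + b
          regroup = solve-∀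
        y-split : Split p (cycleWeights y)
        y-split =
          let a , b , x-a , y-b , a+b≡k = x-below
              _ , j , _ , _ , y-length , y-j , _ = length-interval⊆ w-length w-k {x}
                (codim⇒length x-null (a , b , k , x-a , y-b , w-k , a+b≡k))
          in length≡codim⇒Split {y} (Length-≃ x⁻¹w≃y y-length) (Codim-≃ x⁻¹w≃y y-j)

      interval⇒NullSubsetsSplit : NullSubsetsSplit p∣m (cycleWeights w)
      interval⇒NullSubsetsSplit {S} {T} σ S-null =
        let k , w-length , w-k = Split⇒length≡codim {w} interval⇒Split
            ts , y , e , τ , ts+z≡T = kill-weights S T 0 w (↭-trans σ (++-comm S T))
        in Split-drop-zeros p∣m (length T + 0)
             (Split-↭ τ (killed-complement-split {S} {T} σ S-null w-length w-k ts y e τ ts+z≡T))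

-- Back to cycles, matrices and reflections

filter-complement : ∀ {A : Set} {P : A → Set} (P? : Decidable P) xs →
                    filter (λ x → ¬? (P? x)) xs ++ filter P? xs ↭ xs
filter-complement P? []       = ↭-refl
filter-complement P? (x ∷ xs) with P? x
... | yes _ = ↭-trans (shift x (filter (λ y → ¬? (P? y)) xs) _) (↭-prep x (filter-complement P? xs))
... | no  _ = ↭-prep x (filter-complement P? xs)

unique-sublist : ∀ {S ys : List A} → Unique S → All (_∈ ys) S → ∃[ T ] ys ↭ S ++ T
unique-sublist {S = []}    {ys} _ _ = ys , ↭-refl
unique-sublist {S = x ∷ S} {ys} (x∉S ∷ unique) (x∈ ∷ S⊆) =
  let ys′ , σ = extract-∈ x∈
      T , τ   = unique-sublist unique (All.tabulate λ z∈ → remaining z∈ (∈-resp-↭ σ (All.lookup S⊆ z∈)))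
  in T , ↭-trans σ (↭-prep x τ)
  where
  remaining : ∀ {z ys′} → z ∈ S → z ∈ x ∷ ys′ → z ∈ ys′
  remaining z∈ (here z≡x) = contradiction (sym z≡x) (All.lookup x∉S z∈)
  remaining z∈ (there z∈ys′) = z∈ys′

map-++-inv : ∀ {A B : Set} (f : A → B) S {T} ys → S ++ T ≡ map f ys →
             ∃[ ys₁ ] ∃[ ys₂ ] ys ≡ ys₁ ++ ys₂ × S ≡ map f ys₁
map-++-inv f []      ys       _  = [] , ys , refl , refl
map-++-inv f (x ∷ S) (y ∷ ys) eq =
  let ys₁ , ys₂ , ys≡ , S≡ = map-++-inv f S ys (∷-injectiveʳ eq)
  in y ∷ ys₁ , ys₂ , cong (y ∷_) ys≡ , cong₂ _∷_ (∷-injectiveˡ eq) S≡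

-- From splits of weights to the two conditions on cycles

module _ {m p : ℕ} .{{_ : NonZero m}} (p∣m : p ∣ m) where

  private
    null? : Decidable (λ (x : ZMod m) → x ≡0[mod p ])
    null? x = x ≡0[mod p ]?

    nonnull : List (ZMod m) → List (ZMod m)
    nonnull = filter (λ x → ¬? (null? x))

  ZeroSumPairing : List (ZMod m) → Set
  ZeroSumPairing W = ∃[ pairs ] All (λ (x , y) → x ⊕ y ≡ 0ₘ) pairs × unpair pairs ↭ W

  Split⇒pairing : ∀ {W} → Split p W → ZeroSumPairing (nonnull W)
  Split⇒pairing [] = [] , [] , ↭-refl
  Split⇒pairing (single {x} {V} x-null s σ) =
    let pairs , zero-sum , τ = Split⇒pairing s in
    pairs , zero-sum , ↭-trans τ (↭-trans
      (↭-reflexive (sym (filter-reject (λ x → ¬? (null? x)) {x} {V} (λ x-nonnull → x-nonnull x-null))))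
      (filter-↭ (λ x → ¬? (null? x)) (↭-sym σ)))
  Split⇒pairing {W} (pair {x} {y} {V} x+y≡0 s σ) with pairs , zero-sum , τ ← Split⇒pairing s = go (null? x)
    where
    nonnull? : Decidable (λ (x : ZMod m) → ¬ (x ≡0[mod p ]))
    nonnull? x = ¬? (null? x)
    -- A sum equal to 0 is null, so x and y are both null or both not: the filter drops or keeps the
    -- pair as a whole.
    sum-null : x ⊕ y ≡0[mod p ]
    sum-null = subst (_≡0[mod p ]) (sym x+y≡0) (0-null p∣m)
    go : Dec (x ≡0[mod p ]) → ZeroSumPairing (nonnull W)
    go (yes x-null) = pairs , zero-sum , ↭-trans τ (↭-trans
      (↭-reflexive (sym (trans (filter-reject nonnull? {x} {y ∷ V} (λ nonnull → nonnull x-null))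
        (filter-reject nonnull? {y} {V} (λ nonnull → nonnull (⊕-nullʳ p∣m x-null sum-null))))))
      (filter-↭ nonnull? (↭-sym σ)))
    go (no x-nonnull) = (x , y) ∷ pairs , x+y≡0 ∷ zero-sum , ↭-trans (↭-prep x (↭-prep y τ)) (↭-trans
      (↭-reflexive (sym (trans (filter-accept nonnull? {x} {y ∷ V} x-nonnull)
        (cong (x ∷_) (filter-accept nonnull? {y} {V} (λ y-null → x-nonnull (⊕-nullˡ p∣m y-null sum-null)))))))
      (filter-↭ nonnull? (↭-sym σ)))

  unpair-Split : ∀ pairs {V} → All (λ (x , y) → x ⊕ y ≡ 0ₘ) pairs → Split p V → Split p (unpair pairs ++ V)
  unpair-Split []             []             s = s
  unpair-Split ((x , y) ∷ ps) (eq ∷ zero-sum) s = pair eq (unpair-Split ps zero-sum s) ↭-refl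

  pairing⇒Split : ∀ {W} → ZeroSumPairing (nonnull W) → Split p W
  pairing⇒Split {W} (pairs , zero-sum , σ) =
    Split-↭ (↭-trans (++⁺ʳ (filter null? W) σ) (filter-complement null? W))
      (unpair-Split pairs zero-sum (nulls-Split (all-filter null? W)))
    where
    nulls-Split : ∀ {V} → All (_≡0[mod p ]) V → Split p V
    nulls-Split []             = []
    nulls-Split (null ∷ nulls) = single null (nulls-Split nulls) ↭-refl

  module _ {I : Set} (f : I → ZMod m) where

    -- Different cycles may have the same weight, so a split of weights has to be pulled back along
    -- f to the cycles themselves; f is `weightOf w` in the application.
    SplitsVia : List I → Set
    SplitsVia S = ∃[ singles ] ∃[ pairs ]
      All (λ C → f C ≡0[mod p ]) singles × All (λ (C , C′) → f C ⊕ f C′ ≡ 0ₘ) pairs × singles ++ unpair pairs ↭ S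

    Split⇒SplitsVia : ∀ {V} → Split p V → ∀ {S} → map f S ↭ V → SplitsVia S
    Split⇒SplitsVia [] σ with ↭-map-inv f σ
    ... | [] , _ , τ = [] , [] , [] , [] , ↭-sym τ
    Split⇒SplitsVia (single null s σ) ρ with ↭-map-inv f (↭-trans ρ σ)
    ... | C ∷ S′ , refl , τ =
      let singles , pairs , nulls , zero-sums , υ = Split⇒SplitsVia s {S′} ↭-refl in
      C ∷ singles , pairs , null ∷ nulls , zero-sums , ↭-trans (↭-prep C υ) (↭-sym τ)
    Split⇒SplitsVia (pair eq s σ) ρ with ↭-map-inv f (↭-trans ρ σ)
    ... | C ∷ C′ ∷ S′ , refl , τ =
      let singles , pairs , nulls , zero-sums , υ = Split⇒SplitsVia s {S′} ↭-refl in
      singles , (C , C′) ∷ pairs , nulls , eq ∷ zero-sums ,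
      ↭-trans (shifts singles (C ∷ C′ ∷ [])) (↭-trans (↭-prep C (↭-prep C′ υ)) (↭-sym τ))

    SplitsVia⇒Split : ∀ {S} → SplitsVia S → Split p (map f S)
    SplitsVia⇒Split (singles , pairs , nulls , zero-sums , σ) = Split-↭ (map⁺ f σ) (split-singles singles nulls)
      where
      split-pairs : ∀ ps → All (λ (C , C′) → f C ⊕ f C′ ≡ 0ₘ) ps → Split p (map f (unpair ps))
      split-pairs []             []              = []
      split-pairs ((C , C′) ∷ ps) (eq ∷ zero-sums) = pair eq (split-pairs ps zero-sums) ↭-refl
      split-singles : ∀ Cs → All (λ C → f C ≡0[mod p ]) Cs → Split p (map f (Cs ++ unpair pairs))
      split-singles []       []             = split-pairs pairs zero-sums
      split-singles (C ∷ Cs) (null ∷ nulls) = single null (split-singles Cs nulls) ↭-refl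

  module _ {n : ℕ} (w : G m n) where

    NonzeroWeightsPairUp⇒Split : NonzeroWeightsPairUp p w → Split p (cycleWeights w)
    NonzeroWeightsPairUp⇒Split pairing = subst (Split p) (sym (cycleWeights≡ w)) (pairing⇒Split pairing)

    Split⇒NonzeroWeightsPairUp : Split p (cycleWeights w) → NonzeroWeightsPairUp p w
    Split⇒NonzeroWeightsPairUp s = Split⇒pairing (subst (Split p) (cycleWeights≡ w) s)

    NullSubsetsSplit⇒NullCycleSetsSplit : NullSubsetsSplit p∣m (cycleWeights w) → NullCycleSetsSplit p w
    NullSubsetsSplit⇒NullCycleSetsSplit splits S unique S⊆ S-null =
      let T , σ = unique-sublist unique S⊆
          τ = ↭-trans (↭-reflexive (cycleWeights≡ w)) (↭-trans (map⁺ (weightOf w) σ) (↭-reflexive (map-++ (weightOf w) S T)))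
      in Split⇒SplitsVia (weightOf w) (splits τ S-null) ↭-refl

    unique-cycles : Unique (cycles w)
    unique-cycles = DecUnique.deduplicate-! (Vec.≡-dec Bool._≟_) _

    NullCycleSetsSplit⇒NullSubsetsSplit : NullCycleSetsSplit p w → NullSubsetsSplit p∣m (cycleWeights w)
    NullCycleSetsSplit⇒NullSubsetsSplit splits {S} {T} σ S-null
      with ↭-map-inv (weightOf w) (↭-trans (↭-reflexive (sym (cycleWeights≡ w))) σ)
    ... | Cs , S++T≡ , τ with map-++-inv (weightOf w) S Cs S++T≡
    ... | Cs₁ , Cs₂ , refl , refl =
      SplitsVia⇒Split (weightOf w) (splits Cs₁ (Unique-++ˡ Cs₁ (Unique-↭ τ unique-cycles))
        (All.tabulate (λ C∈ → ∈-resp-↭ (↭-sym τ) (∈-++⁺ˡ C∈))) S-null)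

-- Reflections as moves, and the theorem

module Conversion {c ℓ₁ ℓ₂} (K : HeytingField c ℓ₁ ℓ₂) (m p n : ℕ) .{{_ : NonZero m}} (p∣m : p ∣ m)
  (ζ : HeytingField.Carrier K) (root : LinearAlgebra.IsPrimitiveRootOfUnity K m ζ) where

  open Representation K ζ m p n
  open FixedSpace K ζ m p n root using (Codimfix⇒zeros; zeros⇒Codimfix)

  -- Codimension 1 gives a factorization of length 1 in G(m,1,n), that is, a single move; membership
  -- in G(m,p,n) then makes this move null.
  reflection⇒move : ∀ {r} → IsReflection r → ∃[ t ] NullMove p t × ⟦ t ⟧ ≃ r
  reflection⇒move {r} (r-null , r-codim) =
    let t , t≃r = single-factor (Codim⇒Factors p∣m {r} (Codimfix⇒zeros r-codim)) in
    t , null⇒NullMove p∣m t (subst (_≡0[mod p ]) (sym (wt-≃ p∣m t≃r)) r-null) , t≃r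

  move⇒reflection : ∀ t → NullMove p t → IsReflection ⟦ t ⟧
  move⇒reflection t t-null = NullMove⇒null p∣m t t-null , zeros⇒Codimfix (fixedDim-move t)

  product⇒Factors : ∀ {g k} → IsProductOfReflections g k → Factors p g k
  product⇒Factors {g} (rs , reflections , refl , e) = Factors-≃ {h = g} (≃-intro e) (factors rs reflections)
    where
    factors : ∀ rs → All IsReflection rs → Factors p (product rs) (length rs)
    factors []       []                          = [] , [] , refl , ≃.refl {x = ε}
    factors (r ∷ rs) (reflection ∷ reflections) =
      let t , t-null , t≃r = reflection⇒move {r} reflection in
      Factors-≃ (∙-congʳ (product rs) t≃r) (Factors-move {t = t} t-null (factors rs reflections))

  Factors⇒product : ∀ {g k} → Factors p g k → IsProductOfReflections g k
  Factors⇒product {g} (ts , nulls , refl , e) =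
    let rs , reflections , length≡ , f = reflections-of ts nulls in
    rs , reflections , length≡ , ≃⇒≋ (≃.trans f e)
    where
    reflections-of : ∀ ts → All (NullMove p) ts →
      ∃[ rs ] All IsReflection rs × length rs ≡ length ts × product rs ≃ act ts ε
    reflections-of []       []               = [] , [] , refl , ≃.refl {x = ε}
    reflections-of (t ∷ ts) (t-null ∷ nulls) =
      let rs , reflections , length≡ , e = reflections-of ts nulls in
      ⟦ t ⟧ ∷ rs , move⇒reflection t t-null ∷ reflections , cong suc length≡ , ∙-congˡ ⟦ t ⟧ e

  ReflectionLength⇒Length : ∀ {g k} → ReflectionLength g k → Length p∣m g k
  ReflectionLength⇒Length {g} (pr , min) = product⇒Factors {g} pr , λ j fs → min j (Factors⇒product fs)

  Length⇒ReflectionLength : ∀ {g k} → Length p∣m g k → ReflectionLength g k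
  Length⇒ReflectionLength {g} (fs , min) = Factors⇒product fs , λ j pr → min j (product⇒Factors {g} pr)

  below-length : ∀ {x w} → x ≤[ ReflectionLength ] w → Below p∣m (Length p∣m) x w
  below-length {x} {w} (i , j , k , x-i , y-j , w-k , eq) =
    i , j , k , ReflectionLength⇒Length {x} x-i , ReflectionLength⇒Length {x ⁻¹ ∙ w} y-j , ReflectionLength⇒Length {w} w-k , eq

  length-below : ∀ {x w} → Below p∣m (Length p∣m) x w → x ≤[ ReflectionLength ] w
  length-below {x} {w} (i , j , k , x-i , y-j , w-k , eq) =
    i , j , k , Length⇒ReflectionLength {x} x-i , Length⇒ReflectionLength {x ⁻¹ ∙ w} y-j , Length⇒ReflectionLength {w} w-k , eq

  below-codim : ∀ {x w} → x ≤[ Codimfix ] w → Below p∣m (Codim p∣m) x w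
  below-codim {x} {w} (i , j , k , x-i , y-j , w-k , eq) =
    i , j , k , Codimfix⇒zeros x-i , Codimfix⇒zeros y-j , Codimfix⇒zeros w-k , eq

  codim-below : ∀ {x w} → Below p∣m (Codim p∣m) x w → x ≤[ Codimfix ] w
  codim-below {x} {w} (i , j , k , x-i , y-j , w-k , eq) =
    i , j , k , zeros⇒Codimfix x-i , zeros⇒Codimfix y-j , zeros⇒Codimfix w-k , eq

  module _ (w : G m n) (w-null : w ∈G⟨ p ⟩) where

    intervals⇒splits : [id, w ]⟨ ReflectionLength ⟩ ≐ [id, w ]⟨ Codimfix ⟩ → NonzeroWeightsPairUp p w × NullCycleSetsSplit p w
    intervals⇒splits (length⊆codim , codim⊆length) =
      Split⇒NonzeroWeightsPairUp p∣m w (interval⇒Split p∣m w-null to from) ,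
      NullSubsetsSplit⇒NullCycleSetsSplit p∣m w (interval⇒NullSubsetsSplit p∣m w-null to from)
      where
      to : ∀ {x} → x ∈G⟨ p ⟩ → Below p∣m (Length p∣m) x w → Below p∣m (Codim p∣m) x w
      to {x} x-null x≤w = below-codim {x} {w} (proj₂ (length⊆codim {x} (x-null , length-below {x} {w} x≤w)))
      from : ∀ {x} → x ∈G⟨ p ⟩ → Below p∣m (Codim p∣m) x w → Below p∣m (Length p∣m) x w
      from {x} x-null x≤w = below-length {x} {w} (proj₂ (codim⊆length {x} (x-null , codim-below {x} {w} x≤w)))

    splits⇒intervals : NullCycleSetsSplit p w → [id, w ]⟨ ReflectionLength ⟩ ≐ [id, w ]⟨ Codimfix ⟩
    splits⇒intervals cycle-splits =
      (λ {x} (x-null , x≤w) → x-null , codim-below {x} {w} (to {x} (below-length {x} {w} x≤w))) ,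
      (λ {x} (x-null , x≤w) → x-null , length-below {x} {w}
        (codim-interval⊆ p∣m w-null splits {x} x-null (below-codim {x} {w} x≤w)))
      where
      splits : NullSubsetsSplit p∣m (cycleWeights w)
      splits = NullCycleSetsSplit⇒NullSubsetsSplit p∣m w cycle-splits
      w-length≡codim : ∃[ k ] Length p∣m w k × Codim p∣m w k
      w-length≡codim = Split⇒length≡codim p∣m {w} (NullSubsetsSplit⇒Split p∣m {w} splits w-null)
      to : ∀ {x} → Below p∣m (Length p∣m) x w → Below p∣m (Codim p∣m) x w
      to {x} x≤w =
        let k , w-length , w-codim = w-length≡codim
            i , j , _ , x-i , _ , y-j , eq = length-interval⊆ p∣m w-null w-length w-codim {x} x≤w
        in i , j , k , x-i , y-j , w-codim , eq

    pairUp⇒length≡codim : NonzeroWeightsPairUp p w → LengthEqualsCodim w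
    pairUp⇒length≡codim pairing =
      let k , w-length , w-codim = Split⇒length≡codim p∣m {w} (NonzeroWeightsPairUp⇒Split p∣m w pairing) in
      k , Length⇒ReflectionLength {w} w-length , zeros⇒Codimfix w-codim

    length≡codim⇒pairUp : LengthEqualsCodim w → NonzeroWeightsPairUp p w
    length≡codim⇒pairUp (k , w-length , w-codim) = Split⇒NonzeroWeightsPairUp p∣m w
      (length≡codim⇒Split p∣m {w} (ReflectionLength⇒Length {w} w-length) (Codimfix⇒zeros w-codim))

theorem1p1 : ∀ {c ℓ₁ ℓ₂ : Level} (K : HeytingField c ℓ₁ ℓ₂)
    (m p n : ℕ) .{{_ : NonZero m}} .{{_ : NonZero p}} .{{_ : NonZero n}} →
    p ∣ m →
    (ζ : HeytingField.Carrier K) → LinearAlgebra.IsPrimitiveRootOfUnity K m ζ →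
    (w : G m n) → w ∈G⟨ p ⟩ →
    let open Representation K ζ m p n in
    (([id, w ]⟨ ReflectionLength ⟩ ≐ [id, w ]⟨ Codimfix ⟩)
    ⇔ (NonzeroWeightsPairUp p w × NullCycleSetsSplit p w))
    × (NonzeroWeightsPairUp p w ⇔ LengthEqualsCodim w)
theorem1p1 K m p n p∣m ζ root w w-null =
  mk⇔ (intervals⇒splits w w-null) (λ (_ , cycle-splits) → splits⇒intervals w w-null cycle-splits) ,
  mk⇔ (pairUp⇒length≡codim w w-null) (length≡codim⇒pairUp w w-null)
  where open Conversion K m p n p∣m ζ root
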